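{- For every integer $n\ge 0$, the algebraic number $2\cos\left(\frac{\pi}{3}+\frac{\pi}{2^n}\right)$ has degree $2^n$ over $\mathbb{Q}$. -}

module Defs where

open import Data.Nat.Base as ℕ using (ℕ; zero; suc; _!)
import Data.Nat.Properties as ℕ
import Data.Rational.Unnormalised as ℚᵘ
import Data.Rational.Unnormalised.Properties as ℚᵘ
import Data.Nat.Coprimality as Coprimality
open import Data.Integer.Base as ℤ using (+_; -[1+_])
import Data.Integer.Properties as ℤ
open import Data.Empty using (⊥)
open import Data.Sum.Base using ([_,_]′)
open import Data.Product.Base using (_×_; _,_; proj₁; proj₂; Σ-syntax)
open import Data.Rational.Base
open import Data.Rational.Properties
open import Data.Rational.Solver using (module +-*-Solver)
open import Data.Vec.Base using (Vec; []; _∷_)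
open import Algebra.Definitions.RawSemiring +-*-rawSemiring using (_^_)
open import Relation.Nullary using (¬_; Dec; yes; no; contradiction)
open import Relation.Nullary.Decidable using (from-yes; from-no)
open import Relation.Binary.PropositionalEquality
  using (_≡_; refl; sym; trans; cong; cong₂; subst; subst₂; module ≡-Reasoning)

Cauchy : (ℕ → ℚ) → Set
Cauchy x = ∀ ε → 0ℚ < ε →
  Σ[ N ∈ ℕ ] (∀ m n → N ℕ.≤ m → N ℕ.≤ n → ∣ x m - x n ∣ < ε)

Null : (ℕ → ℚ) → Set
Null x = ∀ ε → 0ℚ < ε → Σ[ N ∈ ℕ ] (∀ n → N ℕ.≤ n → ∣ x n ∣ < ε)

EventuallyBounded : (ℕ → ℚ) → Set
EventuallyBounded x =
  Σ[ B ∈ ℚ ] 0ℚ < B × (Σ[ N ∈ ℕ ] (∀ n → N ℕ.≤ n → ∣ x n ∣ ≤ B))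

0<1 : 0ℚ < 1ℚ
0<1 = positive⁻¹ 1ℚ

0<* : ∀ {p q} → 0ℚ < p → 0ℚ < q → 0ℚ < p * q
0<* {p} {q} 0<p 0<q =
  positive⁻¹ (p * q) {{pos*pos⇒pos p {{positive 0<p}} q {{positive 0<q}}}}

0<+ : ∀ {p q} → 0ℚ < p → 0ℚ < q → 0ℚ < p + q
0<+ 0<p 0<q = +-mono-< 0<p 0<q

half+half : ∀ ε → ε * ½ + ε * ½ ≡ ε
half+half ε = trans (sym (*-distribˡ-+ ε ½ ½)) (*-identityʳ ε)

∣p-p∣≡0 : ∀ p → ∣ p - p ∣ ≡ 0ℚ
∣p-p∣≡0 p = cong ∣_∣ (+-inverseʳ p)

∣-∣-sym : ∀ p q → ∣ p - q ∣ ≡ ∣ q - p ∣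
∣-∣-sym p q = trans (sym (∣-p∣≡∣p∣ (p - q)))
  (cong ∣_∣ (solve 2 (λ p q → :- (p :- q) := q :- p) refl p q))
  where open +-*-Solver

∣-∣-triangle : ∀ p q r → ∣ p - r ∣ ≤ ∣ p - q ∣ + ∣ q - r ∣
∣-∣-triangle p q r = subst (λ z → ∣ z ∣ ≤ ∣ p - q ∣ + ∣ q - r ∣)
  (solve 3 (λ p q r → (p :- q) :+ (q :- r) := p :- r) refl p q r)
  (∣p+q∣≤∣p∣+∣q∣ (p - q) (q - r))
  where open +-*-Solver

cauchy-const : ∀ q → Cauchy (λ _ → q)
cauchy-const q ε 0<ε = 0 , λ _ _ _ _ → subst (_< ε) (sym (∣p-p∣≡0 q)) 0<ε

cauchy-neg : ∀ {x} → Cauchy x → Cauchy (λ n → - x n)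
cauchy-neg {x} cx ε 0<ε with cx ε 0<ε
... | N , h = N , λ m n N≤m N≤n →
  subst (_< ε) (trans (sym (∣-p∣≡∣p∣ (x m - x n))) (cong ∣_∣ (eq (x m) (x n)))) (h m n N≤m N≤n)
  where
  open +-*-Solver
  eq : ∀ p q → - (p - q) ≡ - p - (- q)
  eq = solve 2 (λ p q → :- (p :- q) := :- p :- (:- q)) refl

cauchy-+ : ∀ {x y} → Cauchy x → Cauchy y → Cauchy (λ n → x n + y n)
cauchy-+ {x} {y} cx cy ε 0<ε
  with cx (ε * ½) (0<* 0<ε (positive⁻¹ ½)) | cy (ε * ½) (0<* 0<ε (positive⁻¹ ½))
... | M , h | N , k = M ℕ.⊔ N , λ m n p q → begin-strict
  ∣ (x m + y m) - (x n + y n) ∣     ≡⟨ cong ∣_∣ (eq (x m) (y m) (x n) (y n)) ⟩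
  ∣ (x m - x n) + (y m - y n) ∣     ≤⟨ ∣p+q∣≤∣p∣+∣q∣ (x m - x n) (y m - y n) ⟩
  ∣ x m - x n ∣ + ∣ y m - y n ∣     <⟨ +-mono-< (h m n (ℕ.m⊔n≤o⇒m≤o M N p) (ℕ.m⊔n≤o⇒m≤o M N q))
                                                (k m n (ℕ.m⊔n≤o⇒n≤o M N p) (ℕ.m⊔n≤o⇒n≤o M N q)) ⟩
  ε * ½ + ε * ½                     ≡⟨ half+half ε ⟩
  ε                                 ∎
  where
  open ≤-Reasoning
  open +-*-Solver using (solve; _:+_; _:-_; _:=_)
  eq : ∀ a b c d → (a + b) - (c + d) ≡ (a - c) + (b - d)
  eq = solve 4 (λ a b c d → (a :+ b) :- (c :+ d) := (a :- c) :+ (b :- d)) refl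

cauchy⇒bounded : ∀ {x} → Cauchy x → EventuallyBounded x
cauchy⇒bounded {x} cx with cx 1ℚ 0<1
... | N , h = 1ℚ + ∣ x N ∣
            , +-mono-<-≤ 0<1 (0≤∣p∣ (x N))
            , N , λ n N≤n → begin
  ∣ x n ∣                  ≡⟨ cong ∣_∣ (eq (x n) (x N)) ⟩
  ∣ (x n - x N) + x N ∣    ≤⟨ ∣p+q∣≤∣p∣+∣q∣ (x n - x N) (x N) ⟩
  ∣ x n - x N ∣ + ∣ x N ∣  ≤⟨ +-monoˡ-≤ ∣ x N ∣ (<⇒≤ (h n N N≤n ℕ.≤-refl)) ⟩
  1ℚ + ∣ x N ∣             ∎
  where
  open ≤-Reasoning
  open +-*-Solver using (solve; _:+_; _:-_; _:=_)
  eq : ∀ a b → a ≡ (a - b) + b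
  eq = solve 2 (λ a b → a := (a :- b) :+ b) refl

shrink : ∀ C ε → 0ℚ < C → 0ℚ < ε → Σ[ δ ∈ ℚ ] 0ℚ < δ × C * δ ≡ ε
shrink C ε 0<C 0<ε =
    (1/ C) * ε
  , 0<* (positive⁻¹ (1/ C) {{1/pos⇒pos C}}) 0<ε
  , trans (sym (*-assoc C (1/ C) ε)) (trans (cong (_* ε) (*-inverseʳ C)) (*-identityˡ ε))
  where
  instance
    C⁺ : Positive C
    C⁺ = positive 0<C
    C≢0 : NonZero C
    C≢0 = pos⇒nonZero C

∣*∣-bound : ∀ {C δ η} u v → 0ℚ < C → C * δ ≡ η → ∣ u ∣ ≤ C → ∣ v ∣ < δ → ∣ u * v ∣ < η
∣*∣-bound {C} {δ} {η} u v 0<C Cδ≡η u≤C v<δ = begin-strict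
  ∣ u * v ∣      ≡⟨ ∣p*q∣≡∣p∣*∣q∣ u v ⟩
  ∣ u ∣ * ∣ v ∣  ≤⟨ *-monoʳ-≤-nonNeg ∣ v ∣ {{∣-∣-nonNeg v}} u≤C ⟩
  C * ∣ v ∣      <⟨ *-monoʳ-<-pos C {{positive 0<C}} v<δ ⟩
  C * δ          ≡⟨ Cδ≡η ⟩
  η              ∎
  where open ≤-Reasoning

∣*-*∣-bound : ∀ {A B δ₁ δ₂ ε} a b c d → 0ℚ < A → 0ℚ < B →
  A * δ₁ ≡ ε * ½ → B * δ₂ ≡ ε * ½ → ∣ a ∣ ≤ A → ∣ d ∣ ≤ B →
  ∣ b - d ∣ < δ₁ → ∣ a - c ∣ < δ₂ → ∣ a * b - c * d ∣ < ε
∣*-*∣-bound {ε = ε} a b c d 0<A 0<B Aδ₁ Bδ₂ a≤A d≤B b-d a-c = begin-strict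
  ∣ a * b - c * d ∣                    ≡⟨ cong ∣_∣ (eq a b c d) ⟩
  ∣ a * (b - d) + d * (a - c) ∣        ≤⟨ ∣p+q∣≤∣p∣+∣q∣ (a * (b - d)) (d * (a - c)) ⟩
  ∣ a * (b - d) ∣ + ∣ d * (a - c) ∣    <⟨ +-mono-< (∣*∣-bound a (b - d) 0<A Aδ₁ a≤A b-d)
                                                   (∣*∣-bound d (a - c) 0<B Bδ₂ d≤B a-c) ⟩
  ε * ½ + ε * ½                        ≡⟨ half+half ε ⟩
  ε                                    ∎
  where
  open ≤-Reasoning
  open +-*-Solver using (solve; _:+_; _:-_; _:*_; _:=_)
  eq : ∀ a b c d → a * b - c * d ≡ a * (b - d) + d * (a - c)
  eq = solve 4 (λ a b c d → a :* b :- c :* d := a :* (b :- d) :+ d :* (a :- c)) refl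

cauchy-* : ∀ {x y} → Cauchy x → Cauchy y → Cauchy (λ n → x n * y n)
cauchy-* {x} {y} cx cy ε 0<ε = shrunk (cauchy⇒bounded cx) (cauchy⇒bounded cy)
  where
  0<ε½ : 0ℚ < ε * ½
  0<ε½ = 0<* 0<ε (positive⁻¹ ½)
  Goal = Σ[ N ∈ ℕ ] (∀ m n → N ℕ.≤ m → N ℕ.≤ n → ∣ x m * y m - x n * y n ∣ < ε)
  CloseFrom : (ℕ → ℚ) → ℚ → Set
  CloseFrom z δ = Σ[ N ∈ ℕ ] (∀ m n → N ℕ.≤ m → N ℕ.≤ n → ∣ z m - z n ∣ < δ)
  combine : ∀ {A B δ₁ δ₂ NA NB} → 0ℚ < A → 0ℚ < B →
    (∀ n → NA ℕ.≤ n → ∣ x n ∣ ≤ A) → (∀ n → NB ℕ.≤ n → ∣ y n ∣ ≤ B) →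
    A * δ₁ ≡ ε * ½ → B * δ₂ ≡ ε * ½ → CloseFrom y δ₁ → CloseFrom x δ₂ → Goal
  combine {NA = NA} {NB = NB} 0<A 0<B hA hB Aδ₁ Bδ₂ (Ny , hy) (Nx , hx) = N , λ m n N≤m N≤n →
    ∣*-*∣-bound (x m) (y m) (x n) (y n) 0<A 0<B Aδ₁ Bδ₂
      (hA m (ℕ.m⊔n≤o⇒m≤o NA NB (ab N≤m)))
      (hB n (ℕ.m⊔n≤o⇒n≤o NA NB (ab N≤n)))
      (hy m n (ℕ.m⊔n≤o⇒n≤o Nx Ny (xy N≤m)) (ℕ.m⊔n≤o⇒n≤o Nx Ny (xy N≤n)))
      (hx m n (ℕ.m⊔n≤o⇒m≤o Nx Ny (xy N≤m)) (ℕ.m⊔n≤o⇒m≤o Nx Ny (xy N≤n)))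
    where
    N = (NA ℕ.⊔ NB) ℕ.⊔ (Nx ℕ.⊔ Ny)
    ab : ∀ {k} → N ℕ.≤ k → NA ℕ.⊔ NB ℕ.≤ k
    ab = ℕ.m⊔n≤o⇒m≤o (NA ℕ.⊔ NB) (Nx ℕ.⊔ Ny)
    xy : ∀ {k} → N ℕ.≤ k → Nx ℕ.⊔ Ny ℕ.≤ k
    xy = ℕ.m⊔n≤o⇒n≤o (NA ℕ.⊔ NB) (Nx ℕ.⊔ Ny)
  choose : ∀ {A B NA NB} → 0ℚ < A → 0ℚ < B →
    (∀ n → NA ℕ.≤ n → ∣ x n ∣ ≤ A) → (∀ n → NB ℕ.≤ n → ∣ y n ∣ ≤ B) →
    (Σ[ δ ∈ ℚ ] 0ℚ < δ × A * δ ≡ ε * ½) → (Σ[ δ ∈ ℚ ] 0ℚ < δ × B * δ ≡ ε * ½) → Goal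
  choose 0<A 0<B hA hB (δ₁ , 0<δ₁ , Aδ₁) (δ₂ , 0<δ₂ , Bδ₂) =
    combine 0<A 0<B hA hB Aδ₁ Bδ₂ (cy δ₁ 0<δ₁) (cx δ₂ 0<δ₂)
  shrunk : EventuallyBounded x → EventuallyBounded y → Goal
  shrunk (A , 0<A , NA , hA) (B , 0<B , NB , hB) = choose 0<A 0<B hA hB
    (shrink A (ε * ½) 0<A 0<ε½) (shrink B (ε * ½) 0<B 0<ε½)

cauchy-^ : ∀ {x} → Cauchy x → ∀ k → Cauchy (λ n → x n ^ k)
cauchy-^ cx zero = cauchy-const 1ℚ
cauchy-^ {x} cx (suc k) = cauchy-* {x} {λ n → x n ^ k} cx (cauchy-^ {x} cx k)

record ℝ : Set where
  constructor mkℝ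
  field
    seq    : ℕ → ℚ
    cauchy : Cauchy seq

open ℝ public

infix  4 _≃ᵣ_ _<ᵣ_
infixl 6 _+ᵣ_
infixl 7 _*ᵣ_ _/ᵣ_

_≃ᵣ_ : ℝ → ℝ → Set
x ≃ᵣ y = Null (λ n → seq x n - seq y n)

_<ᵣ_ : ℝ → ℝ → Set
x <ᵣ y = Σ[ ε ∈ ℚ ] 0ℚ < ε × (Σ[ N ∈ ℕ ] (∀ n → N ℕ.≤ n → seq x n + ε < seq y n))

fromℚ : ℚ → ℝ
fromℚ q = mkℝ (λ _ → q) (cauchy-const q)

_+ᵣ_ : ℝ → ℝ → ℝ
x +ᵣ y = mkℝ (λ n → seq x n + seq y n) (cauchy-+ {seq x} {seq y} (cauchy x) (cauchy y))

_*ᵣ_ : ℝ → ℝ → ℝ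
x *ᵣ y = mkℝ (λ n → seq x n * seq y n) (cauchy-* {seq x} {seq y} (cauchy x) (cauchy y))

_/ᵣ_ : ℝ → (k : ℕ) → .{{_ : ℕ.NonZero k}} → ℝ
x /ᵣ k = x *ᵣ fromℚ (+ 1 / k)

1/fact : ℕ → ℚ
1/fact n = (+ 1 / (n !)) {{n ℕ.!≢0}}

cosTerm : ℚ → ℕ → ℚ
cosTerm q k = (- 1ℚ) ^ k * q ^ (2 ℕ.* k) * 1/fact (2 ℕ.* k)

-- The sum of the first n terms.
cosPartial : ℕ → ℚ → ℚ
cosPartial zero    q = 0ℚ
cosPartial (suc n) q = cosPartial n q + cosTerm q n

cauchy-cosTerm : ∀ {x} → Cauchy x → ∀ k → Cauchy (λ n → cosTerm (x n) k)
cauchy-cosTerm {x} cx k =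
  cauchy-* {λ n → (- 1ℚ) ^ k * x n ^ (2 ℕ.* k)} {λ _ → 1/fact (2 ℕ.* k)}
    (cauchy-* {λ _ → (- 1ℚ) ^ k} {λ n → x n ^ (2 ℕ.* k)}
      (cauchy-const ((- 1ℚ) ^ k)) (cauchy-^ {x} cx (2 ℕ.* k)))
    (cauchy-const (1/fact (2 ℕ.* k)))

cauchy-cosPartial : ∀ {x} → Cauchy x → ∀ p → Cauchy (λ n → cosPartial p (x n))
cauchy-cosPartial cx zero = cauchy-const 0ℚ
cauchy-cosPartial {x} cx (suc p) =
  cauchy-+ {λ n → cosPartial p (x n)} {λ n → cosTerm (x n) p}
    (cauchy-cosPartial {x} cx p) (cauchy-cosTerm {x} cx p)

ι : ℕ → ℚ
ι m = mkℚ (+ m) 0 (Coprimality.sym (Coprimality.1-coprimeTo m))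

ι-* : ∀ m n → ι m * ι n ≡ ι (m ℕ.* n)
ι-* m n = trans (cong (_/ 1) (sym (ℤ.pos-* m n))) (↥p/↧p≡p (ι (m ℕ.* n)))

ι-mono : ∀ {m n} → m ℕ.≤ n → ι m ≤ ι n
ι-mono m≤n = *≤* (ℤ.*-monoʳ-≤-nonNeg (+ 1) (ℤ.+≤+ m≤n))

ι-suc : ∀ m → ι (suc m) ≡ 1ℚ + ι m
ι-suc m = sym (trans (cong (_/ 1) eq) (↥p/↧p≡p (ι (suc m))))
  where
  eq : + 1 ℤ.* + 1 ℤ.+ + m ℤ.* + 1 ≡ + suc m
  eq = cong (λ i → + 1 ℤ.+ i) (ℤ.*-identityʳ (+ m))

0<ι-suc : ∀ m → 0ℚ < ι (suc m)
0<ι-suc m = positive⁻¹ (ι (suc m))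

0≤ι : ∀ m → 0ℚ ≤ ι m
0≤ι m = nonNegative⁻¹ (ι m)

archimedean : ∀ q → Σ[ m ∈ ℕ ] q ≤ ι m
archimedean (mkℚ (+ n) d _) = n , *≤* (ℤ.*-monoˡ-≤-nonNeg (+ n) (ℤ.+≤+ (ℕ.s≤s ℕ.z≤n)))
archimedean (mkℚ -[1+ n ] d _) = 0 , *≤* ℤ.-≤+

1/m*m≡1 : ∀ m .{{_ : ℕ.NonZero m}} → (+ 1 / m) * ι m ≡ 1ℚ
1/m*m≡1 (suc m) = toℚᵘ-injective (ℚᵘ.≃-trans (toℚᵘ-homo-* (+ 1 / suc m) (ι (suc m)))
  (ℚᵘ.≃-trans (ℚᵘ.*-congʳ {ℚᵘ.mkℚᵘ (+ suc m) 0} (toℚᵘ-fromℚᵘ (ℚᵘ.mkℚᵘ (+ 1) m)))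
    (ℚᵘ.*≡* (eq (+ suc m)))))
  where
  eq : ∀ i → + 1 ℤ.* i ℤ.* + 1 ≡ + 1 ℤ.* (i ℤ.* + 1)
  eq i = ℤ.*-assoc (+ 1) i (+ 1)

1/fact-step : ∀ n → 1/fact (suc (suc n)) * ι (suc (suc n) ℕ.* suc n) ≡ 1/fact n
1/fact-step n = begin
  a * ι (suc (suc n) ℕ.* suc n)              ≡⟨ *-identityʳ (a * ι (suc (suc n) ℕ.* suc n)) ⟨
  a * ι (suc (suc n) ℕ.* suc n) * 1ℚ         ≡⟨ cong (a * ι (suc (suc n) ℕ.* suc n) *_) (inv n) ⟨
  a * ι (suc (suc n) ℕ.* suc n) * (b * ι (n !)) ≡⟨ rearrange a (ι (suc (suc n) ℕ.* suc n)) b (ι (n !)) ⟩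
  a * (ι (suc (suc n) ℕ.* suc n) * ι (n !)) * b ≡⟨ cong (λ z → a * z * b) (ι-* (suc (suc n) ℕ.* suc n) (n !)) ⟩
  a * ι (suc (suc n) ℕ.* suc n ℕ.* n !) * b  ≡⟨ cong (λ z → a * ι z * b) (ℕ.*-assoc (suc (suc n)) (suc n) (n !)) ⟩
  a * ι (suc (suc n) !) * b                  ≡⟨ cong (_* b) (inv (suc (suc n))) ⟩
  1ℚ * b                                     ≡⟨ *-identityˡ b ⟩
  b                                          ∎
  where
  open ≡-Reasoning
  open +-*-Solver using (solve; _:*_; _:=_)
  a = 1/fact (suc (suc n))
  b = 1/fact n
  inv : ∀ k → 1/fact k * ι (k !) ≡ 1ℚ
  inv k = 1/m*m≡1 (k !) {{k ℕ.!≢0}}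
  rearrange : ∀ a d b e → a * d * (b * e) ≡ a * (d * e) * b
  rearrange = solve 4 (λ a d b e → a :* d :* (b :* e) := a :* (d :* e) :* b) refl

cosTerm-step : ∀ q k → cosTerm q (suc k) * ι (suc (suc (2 ℕ.* k)) ℕ.* suc (2 ℕ.* k)) ≡
                       - (q * q * cosTerm q k)
cosTerm-step q k = begin
  s' * q ^ (2 ℕ.* suc k) * 1/fact (2 ℕ.* suc k) * D  ≡⟨ cong (λ z → s' * q ^ z * 1/fact z * D) (ℕ.*-suc 2 k) ⟩
  (- 1ℚ * s) * (q * (q * r)) * f * D                 ≡⟨ rearrange s q r f D ⟩
  - (q * q * (s * r * (f * D)))                      ≡⟨ cong (λ z → - (q * q * (s * r * z))) (1/fact-step (2 ℕ.* k)) ⟩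
  - (q * q * (s * r * 1/fact (2 ℕ.* k)))             ∎
  where
  open ≡-Reasoning
  open +-*-Solver using (solve; _:*_; _:=_; :-_; con)
  s = (- 1ℚ) ^ k
  s' = (- 1ℚ) ^ suc k
  r = q ^ (2 ℕ.* k)
  f = 1/fact (suc (suc (2 ℕ.* k)))
  D = ι (suc (suc (2 ℕ.* k)) ℕ.* suc (2 ℕ.* k))
  rearrange : ∀ s q r f D → (- 1ℚ * s) * (q * (q * r)) * f * D ≡ - (q * q * (s * r * (f * D)))
  rearrange = solve 5 (λ s q r f D → (con (- 1ℚ) :* s) :* (q :* (q :* r)) :* f :* D
                                       := :- (q :* q :* (s :* r :* (f :* D)))) refl

-- From index K on, the terms at any q with ∣ q ∣ ≤ K at least halve.
cosTerm-halve : ∀ q K k → ∣ q ∣ ≤ ι K → K ℕ.≤ k →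
  ∣ cosTerm q (suc k) ∣ + ∣ cosTerm q (suc k) ∣ ≤ ∣ cosTerm q k ∣
cosTerm-halve q K k q≤K K≤k = *-cancelʳ-≤-pos D (begin
  (u' + u') * D                     ≡⟨ *-distribʳ-+ D u' u' ⟩
  u' * D + u' * D                   ≡⟨ cong₂ _+_ step step ⟩
  ∣ q ∣ * ∣ q ∣ * u + ∣ q ∣ * ∣ q ∣ * u ≡⟨ *-distribʳ-+ u (∣ q ∣ * ∣ q ∣) (∣ q ∣ * ∣ q ∣) ⟨
  (∣ q ∣ * ∣ q ∣ + ∣ q ∣ * ∣ q ∣) * u   ≤⟨ *-monoʳ-≤-nonNeg u {{∣-∣-nonNeg (cosTerm q k)}} small ⟩
  D * u                             ≡⟨ *-comm D u ⟩
  u * D                             ∎)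
  where
  open ≤-Reasoning
  u = ∣ cosTerm q k ∣
  u' = ∣ cosTerm q (suc k) ∣
  d = suc (suc (2 ℕ.* k)) ℕ.* suc (2 ℕ.* k)
  D = ι d
  ∣D∣ : ∣ D ∣ ≡ D
  ∣D∣ = refl
  step : u' * D ≡ ∣ q ∣ * ∣ q ∣ * u
  step = begin-equality
    u' * D                             ≡⟨ ∣p*q∣≡∣p∣*∣q∣ (cosTerm q (suc k)) D ⟨
    ∣ cosTerm q (suc k) * D ∣          ≡⟨ cong ∣_∣ (cosTerm-step q k) ⟩
    ∣ - (q * q * cosTerm q k) ∣        ≡⟨ ∣-p∣≡∣p∣ (q * q * cosTerm q k) ⟩
    ∣ q * q * cosTerm q k ∣            ≡⟨ ∣p*q∣≡∣p∣*∣q∣ (q * q) (cosTerm q k) ⟩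
    ∣ q * q ∣ * u                      ≡⟨ cong (_* u) (∣p*q∣≡∣p∣*∣q∣ q q) ⟩
    ∣ q ∣ * ∣ q ∣ * u                  ∎
  square : ∣ q ∣ * ∣ q ∣ ≤ ι (k ℕ.* k)
  square = begin
    ∣ q ∣ * ∣ q ∣  ≤⟨ *-monoˡ-≤-nonNeg ∣ q ∣ {{∣-∣-nonNeg q}} q≤k ⟩
    ∣ q ∣ * ι k    ≤⟨ *-monoʳ-≤-nonNeg (ι k) q≤k ⟩
    ι k * ι k      ≡⟨ ι-* k k ⟩
    ι (k ℕ.* k)    ∎
    where
    q≤k : ∣ q ∣ ≤ ι k
    q≤k = ≤-trans q≤K (ι-mono K≤k)
  2k : k ℕ.≤ 2 ℕ.* k
  2k = ℕ.m≤m+n k (k ℕ.+ 0)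
  2kk≤d : 2 ℕ.* (k ℕ.* k) ℕ.≤ d
  2kk≤d = subst (ℕ._≤ d) (ℕ.*-assoc 2 k k)
    (ℕ.*-mono-≤ {2 ℕ.* k} {suc (suc (2 ℕ.* k))} {k} (ℕ.≤-trans (ℕ.n≤1+n _) (ℕ.n≤1+n _)) (ℕ.≤-trans 2k (ℕ.n≤1+n _)))
  small : ∣ q ∣ * ∣ q ∣ + ∣ q ∣ * ∣ q ∣ ≤ D
  small = begin
    ∣ q ∣ * ∣ q ∣ + ∣ q ∣ * ∣ q ∣  ≤⟨ +-mono-≤ square square ⟩
    ι (k ℕ.* k) + ι (k ℕ.* k)      ≡⟨ double (k ℕ.* k) ⟩
    ι (2 ℕ.* (k ℕ.* k))            ≤⟨ ι-mono 2kk≤d ⟩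
    D                              ∎
    where
    double : ∀ m → ι m + ι m ≡ ι (2 ℕ.* m)
    double m = begin-equality
      ι m + ι m            ≡⟨ cong₂ _+_ (*-identityˡ (ι m)) (*-identityˡ (ι m)) ⟨
      1ℚ * ι m + 1ℚ * ι m  ≡⟨ *-distribʳ-+ (ι m) 1ℚ 1ℚ ⟨
      ι 2 * ι m            ≡⟨ ι-* 2 m ⟩
      ι (2 ℕ.* m)          ∎

module _ (q : ℚ) (K : ℕ) (q≤K : ∣ q ∣ ≤ ι K) where
  open ≤-Reasoning

  private
    u : ℕ → ℚ
    u k = ∣ cosTerm q k ∣

    2u : ℕ → ℚ
    2u k = u k + u k

  cosTerm-decay : ∀ j → ι (suc j) * ∣ cosTerm q (j ℕ.+ K) ∣ ≤ ∣ cosTerm q K ∣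
  cosTerm-decay zero = ≤-reflexive (*-identityˡ (u K))
  cosTerm-decay (suc j) = begin
    ι (suc (suc j)) * u'             ≡⟨ cong (_* u') (ι-suc (suc j)) ⟩
    (1ℚ + ι (suc j)) * u'            ≤⟨ *-monoʳ-≤-nonNeg u' {{∣-∣-nonNeg (cosTerm q (suc j ℕ.+ K))}}
                                          (+-monoˡ-≤ (ι (suc j)) (ι-mono (ℕ.s≤s (ℕ.z≤n {j})))) ⟩
    (ι (suc j) + ι (suc j)) * u'     ≡⟨ *-distribʳ-+ u' (ι (suc j)) (ι (suc j)) ⟩
    ι (suc j) * u' + ι (suc j) * u'  ≡⟨ *-distribˡ-+ (ι (suc j)) u' u' ⟨
    ι (suc j) * (u' + u')            ≤⟨ *-monoˡ-≤-nonNeg (ι (suc j)) (cosTerm-halve q K (j ℕ.+ K) q≤K (ℕ.m≤n+m K j)) ⟩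
    ι (suc j) * u (j ℕ.+ K)          ≤⟨ cosTerm-decay j ⟩
    u K                              ∎
    where u' = u (suc j ℕ.+ K)

  cosPartial-tail : ∀ p i → K ℕ.≤ p →
    ∣ cosPartial (i ℕ.+ p) q - cosPartial p q ∣ + 2u (i ℕ.+ p) ≤ 2u p
  cosPartial-tail p zero K≤p = ≤-reflexive
    (trans (cong (_+ 2u p) (∣p-p∣≡0 (cosPartial p q))) (+-identityˡ (2u p)))
  cosPartial-tail p (suc i) K≤p = begin
    ∣ (S + t) - S₀ ∣ + 2u (suc i ℕ.+ p)       ≡⟨ cong (λ z → ∣ z ∣ + 2u (suc i ℕ.+ p)) (swap S t S₀) ⟩
    ∣ (S - S₀) + t ∣ + 2u (suc i ℕ.+ p)       ≤⟨ +-mono-≤ (∣p+q∣≤∣p∣+∣q∣ (S - S₀) t)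
                                                  (cosTerm-halve q K (i ℕ.+ p) q≤K (ℕ.≤-trans K≤p (ℕ.m≤n+m p i))) ⟩
    (∣ S - S₀ ∣ + u (i ℕ.+ p)) + u (i ℕ.+ p)  ≡⟨ +-assoc ∣ S - S₀ ∣ (u (i ℕ.+ p)) (u (i ℕ.+ p)) ⟩
    ∣ S - S₀ ∣ + 2u (i ℕ.+ p)                 ≤⟨ cosPartial-tail p i K≤p ⟩
    2u p                                      ∎
    where
    open +-*-Solver using (solve; _:+_; _:-_; _:=_)
    S = cosPartial (i ℕ.+ p) q
    t = cosTerm q (i ℕ.+ p)
    S₀ = cosPartial p q
    swap : ∀ a b c → (a + b) - c ≡ (a - c) + b
    swap = solve 3 (λ a b c → (a :+ b) :- c := (a :- c) :+ b) refl

  cosPartial-close : ∀ p n → K ℕ.≤ p → p ℕ.≤ n →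
    ∣ cosPartial n q - cosPartial p q ∣ ≤ ∣ cosTerm q p ∣ + ∣ cosTerm q p ∣
  cosPartial-close p n K≤p p≤n = begin
    d                    ≡⟨ +-identityʳ d ⟨
    d + 0ℚ               ≤⟨ +-monoʳ-≤ d (+-mono-≤ (0≤∣p∣ (cosTerm q n)) (0≤∣p∣ (cosTerm q n))) ⟩
    d + 2u n             ≤⟨ subst (λ z → ∣ cosPartial z q - cosPartial p q ∣ + 2u z ≤ 2u p)
                              (ℕ.m∸n+n≡m p≤n) (cosPartial-tail p (n ℕ.∸ p) K≤p) ⟩
    2u p                 ∎
    where d = ∣ cosPartial n q - cosPartial p q ∣

cosPartial-uniform : ∀ {x} → Cauchy x → ∀ η → 0ℚ < η →
  Σ[ p ∈ ℕ ] Σ[ N ∈ ℕ ] (∀ i n → N ℕ.≤ i → p ℕ.≤ n →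
    ∣ cosPartial n (x i) - cosPartial p (x i) ∣ ≤ η + η)
cosPartial-uniform {x} cx η 0<η = fromBound (cauchy⇒bounded cx)
  where
  open ≤-Reasoning
  Goal = Σ[ p ∈ ℕ ] Σ[ N ∈ ℕ ] (∀ i n → N ℕ.≤ i → p ℕ.≤ n →
    ∣ cosPartial n (x i) - cosPartial p (x i) ∣ ≤ η + η)
  finish : ∀ {M δ NB NM} K j → (∀ n → NB ℕ.≤ n → ∣ x n ∣ ≤ ι K) →
    (∀ n → NM ℕ.≤ n → ∣ cosTerm (x n) K ∣ ≤ M) → η * δ ≡ M → δ ≤ ι j → Goal
  finish {M} {δ} {NB} {NM} K j hB hM ηδ δ≤j = j ℕ.+ K , NB ℕ.⊔ NM , λ i n N≤i p≤n →
    ≤-trans (cosPartial-close (x i) K (hB i (ℕ.m⊔n≤o⇒m≤o NB NM N≤i)) (j ℕ.+ K) n (ℕ.m≤n+m K j) p≤n)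
            (+-mono-≤ (small i N≤i) (small i N≤i))
    where
    small : ∀ i → NB ℕ.⊔ NM ℕ.≤ i → ∣ cosTerm (x i) (j ℕ.+ K) ∣ ≤ η
    small i N≤i = *-cancelˡ-≤-pos (ι (suc j)) (begin
      ι (suc j) * ∣ cosTerm (x i) (j ℕ.+ K) ∣  ≤⟨ cosTerm-decay (x i) K (hB i (ℕ.m⊔n≤o⇒m≤o NB NM N≤i)) j ⟩
      ∣ cosTerm (x i) K ∣                      ≤⟨ hM i (ℕ.m⊔n≤o⇒n≤o NB NM N≤i) ⟩
      M                                        ≡⟨ ηδ ⟨
      η * δ                                    ≤⟨ *-monoˡ-≤-nonNeg η {{nonNegative (<⇒≤ 0<η)}}
                                                    (≤-trans δ≤j (ι-mono (ℕ.n≤1+n j))) ⟩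
      η * ι (suc j)                            ≡⟨ *-comm η (ι (suc j)) ⟩
      ι (suc j) * η                            ∎)
  fromδ : ∀ {M NB NM} K → (∀ n → NB ℕ.≤ n → ∣ x n ∣ ≤ ι K) →
    (∀ n → NM ℕ.≤ n → ∣ cosTerm (x n) K ∣ ≤ M) → (Σ[ δ ∈ ℚ ] 0ℚ < δ × η * δ ≡ M) → Goal
  fromδ {NB = NB} {NM} K hB hM (δ , _ , ηδ) =
    finish {NB = NB} {NM} K (proj₁ (archimedean δ)) hB hM ηδ (proj₂ (archimedean δ))
  fromK : ∀ {NB} K → (∀ n → NB ℕ.≤ n → ∣ x n ∣ ≤ ι K) →
    EventuallyBounded (λ n → cosTerm (x n) K) → Goal
  fromK {NB} K hB (M , 0<M , NM , hM) = fromδ {NB = NB} {NM} K hB hM (shrink η M 0<η 0<M)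
  fromBound : EventuallyBounded x → Goal
  fromBound (B , _ , NB , hB) = fromK {NB} (proj₁ (archimedean B))
    (λ n N≤n → ≤-trans (hB n N≤n) (proj₂ (archimedean B)))
    (cauchy⇒bounded (cauchy-cosTerm {x} cx (proj₁ (archimedean B))))

cauchy-cos : ∀ {x} → Cauchy x → Cauchy (λ n → cosPartial n (x n))
cauchy-cos {x} cx ε 0<ε = fromUniform (cosPartial-uniform {x} cx η 0<η)
  where
  open ≤-Reasoning
  0<½ = positive⁻¹ ½
  η = ε * ½ * ½ * ½
  0<η : 0ℚ < η
  0<η = 0<* (0<* (0<* 0<ε 0<½) 0<½) 0<½
  Goal = Σ[ N ∈ ℕ ] (∀ m n → N ℕ.≤ m → N ℕ.≤ n → ∣ cosPartial m (x m) - cosPartial n (x n) ∣ < ε)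
  2η = η + η
  total : 2η + (ε * ½ + 2η) ≡ ε
  total = begin-equality
    2η + (ε * ½ + 2η)                          ≡⟨ cong (λ z → z + (ε * ½ + z)) (half+half (ε * ½ * ½)) ⟩
    ε * ½ * ½ + (ε * ½ + ε * ½ * ½)            ≡⟨ rearrange (ε * ½ * ½) (ε * ½) ⟩
    (ε * ½ * ½ + ε * ½ * ½) + ε * ½            ≡⟨ cong (_+ ε * ½) (half+half (ε * ½)) ⟩
    ε * ½ + ε * ½                              ≡⟨ half+half ε ⟩
    ε                                          ∎
    where
    open +-*-Solver using (solve; _:+_; _:=_)
    rearrange : ∀ a b → a + (b + a) ≡ (a + a) + b
    rearrange = solve 2 (λ a b → a :+ (b :+ a) := (a :+ a) :+ b) refl
  three : ∀ a b c d → ∣ a - b ∣ ≤ 2η → ∣ b - c ∣ < ε * ½ → ∣ d - c ∣ ≤ 2η → ∣ a - d ∣ < ε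
  three a b c d ab bc dc = begin-strict
    ∣ a - d ∣                              ≤⟨ ∣-∣-triangle a b d ⟩
    ∣ a - b ∣ + ∣ b - d ∣                  ≤⟨ +-monoʳ-≤ ∣ a - b ∣ (∣-∣-triangle b c d) ⟩
    ∣ a - b ∣ + (∣ b - c ∣ + ∣ c - d ∣)    <⟨ +-mono-≤-< ab (+-mono-<-≤ bc (subst (_≤ 2η) (∣-∣-sym d c) dc)) ⟩
    2η + (ε * ½ + 2η)                      ≡⟨ total ⟩
    ε                                      ∎
  fromMiddle : ∀ p N → (∀ i n → N ℕ.≤ i → p ℕ.≤ n → ∣ cosPartial n (x i) - cosPartial p (x i) ∣ ≤ 2η) →
    (Σ[ L ∈ ℕ ] (∀ m n → L ℕ.≤ m → L ℕ.≤ n → ∣ cosPartial p (x m) - cosPartial p (x n) ∣ < ε * ½)) → Goal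
  fromMiddle p N tail (L , middle) = (p ℕ.⊔ N) ℕ.⊔ L , λ m n a b →
    three (cosPartial m (x m)) (cosPartial p (x m)) (cosPartial p (x n)) (cosPartial n (x n))
      (tail m m (≥N a) (≥p a)) (middle m n (≥L a) (≥L b)) (tail n n (≥N b) (≥p b))
    where
    ≥L : ∀ {k} → (p ℕ.⊔ N) ℕ.⊔ L ℕ.≤ k → L ℕ.≤ k
    ≥L = ℕ.m⊔n≤o⇒n≤o (p ℕ.⊔ N) L
    ≥p : ∀ {k} → (p ℕ.⊔ N) ℕ.⊔ L ℕ.≤ k → p ℕ.≤ k
    ≥p h = ℕ.m⊔n≤o⇒m≤o p N (ℕ.m⊔n≤o⇒m≤o (p ℕ.⊔ N) L h)
    ≥N : ∀ {k} → (p ℕ.⊔ N) ℕ.⊔ L ℕ.≤ k → N ℕ.≤ k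
    ≥N h = ℕ.m⊔n≤o⇒n≤o p N (ℕ.m⊔n≤o⇒m≤o (p ℕ.⊔ N) L h)
  fromUniform : (Σ[ p ∈ ℕ ] Σ[ N ∈ ℕ ] (∀ i n → N ℕ.≤ i → p ℕ.≤ n →
    ∣ cosPartial n (x i) - cosPartial p (x i) ∣ ≤ 2η)) → Goal
  fromUniform (p , N , tail) =
    fromMiddle p N tail (cauchy-cosPartial {x} cx p (ε * ½) (0<* 0<ε 0<½))

-- The partial sums converge uniformly on bounded sets, so evaluating the n-th
-- partial sum at the n-th approximation of x converges to the sum of the series at x.
cos : ℝ → ℝ
cos x = mkℝ (λ n → cosPartial n (seq x n)) (cauchy-cos {seq x} (cauchy x))

≤-by : ∀ {a b r} → 0ℚ ≤ r → a + r ≡ b → a ≤ b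
≤-by {a} {b} {r} 0≤r a+r≡b = subst₂ _≤_ (+-identityʳ a) a+r≡b (+-monoʳ-≤ a 0≤r)

<⇒≱ : ∀ {p q} → p < q → ¬ (q ≤ p)
<⇒≱ p<q q≤p = <-irrefl refl (<-≤-trans p<q q≤p)

0≤- : ∀ {p q} → p ≤ q → 0ℚ ≤ q - p
0≤- {p} {q} p≤q = subst (_≤ q - p) (+-inverseʳ p) (+-monoˡ-≤ (- p) p≤q)

0≤* : ∀ {p q} → 0ℚ ≤ p → 0ℚ ≤ q → 0ℚ ≤ p * q
0≤* {p} {q} 0≤p 0≤q = nonNegative⁻¹ (p * q)
  {{nonNeg*nonNeg⇒nonNeg p {{nonNegative 0≤p}} q {{nonNegative 0≤q}}}}

0≤+ : ∀ {p q} → 0ℚ ≤ p → 0ℚ ≤ q → 0ℚ ≤ p + q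
0≤+ 0≤p 0≤q = +-mono-≤ 0≤p 0≤q

0≤^ : ∀ {p} → 0ℚ ≤ p → ∀ k → 0ℚ ≤ p ^ k
0≤^ 0≤p zero    = <⇒≤ 0<1
0≤^ 0≤p (suc k) = 0≤* 0≤p (0≤^ 0≤p k)

*-mono-≤-nonNeg : ∀ {p q r s} → 0ℚ ≤ p → 0ℚ ≤ s → p ≤ q → r ≤ s → p * r ≤ q * s
*-mono-≤-nonNeg {p} {q} {r} {s} 0≤p 0≤s p≤q r≤s = ≤-trans
  (*-monoˡ-≤-nonNeg p {{nonNegative 0≤p}} r≤s)
  (*-monoʳ-≤-nonNeg s {{nonNegative 0≤s}} p≤q)

^-mono-≤ : ∀ {p q} → 0ℚ ≤ p → p ≤ q → ∀ k → p ^ k ≤ q ^ k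
^-mono-≤ 0≤p p≤q zero    = ≤-refl
^-mono-≤ 0≤p p≤q (suc k) =
  *-mono-≤-nonNeg 0≤p (0≤^ (≤-trans 0≤p p≤q) k) p≤q (^-mono-≤ 0≤p p≤q k)

-- a₀ - (a₁ - (a₂ - …)), with n terms.
altSum : (ℕ → ℚ) → ℕ → ℚ
altSum a zero    = 0ℚ
altSum a (suc n) = a 0 - altSum (λ k → a (suc k)) n

altSum-snoc : ∀ a n → altSum a (suc n) ≡ altSum a n + (- 1ℚ) ^ n * a n
altSum-snoc a zero = eq (a 0)
  where
  open +-*-Solver using (solve; _:+_; _:*_; _:-_; _:=_; con)
  eq : ∀ p → p - 0ℚ ≡ 0ℚ + 1ℚ * p
  eq = solve 1 (λ p → p :- con 0ℚ := con 0ℚ :+ con 1ℚ :* p) refl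
altSum-snoc a (suc n) = trans (cong (λ z → a 0 - z) (altSum-snoc (λ k → a (suc k)) n))
  (eq (a 0) (altSum (λ k → a (suc k)) n) ((- 1ℚ) ^ n) (a (suc n)))
  where
  open +-*-Solver using (solve; _:+_; _:*_; _:-_; _:=_; con)
  eq : ∀ p q s r → p - (q + s * r) ≡ (p - q) + (- 1ℚ * s) * r
  eq = solve 4 (λ p q s r → p :- (q :+ s :* r) := (p :- q) :+ (con (- 1ℚ) :* s) :* r) refl

altSum-sub : ∀ a b n → altSum (λ k → a k - b k) n ≡ altSum a n - altSum b n
altSum-sub a b zero    = refl
altSum-sub a b (suc n) = trans
  (cong (λ z → (a 0 - b 0) - z) (altSum-sub (λ k → a (suc k)) (λ k → b (suc k)) n))
  (eq (a 0) (b 0) (altSum (λ k → a (suc k)) n) (altSum (λ k → b (suc k)) n))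
  where
  open +-*-Solver using (solve; _:-_; _:=_)
  eq : ∀ p q r s → (p - q) - (r - s) ≡ (p - r) - (q - s)
  eq = solve 4 (λ p q r s → (p :- q) :- (r :- s) := (p :- r) :- (q :- s)) refl

p-q≤p : ∀ {p q} → 0ℚ ≤ q → p - q ≤ p
p-q≤p {p} {q} 0≤q = ≤-by 0≤q (solve 2 (λ p q → (p :- q) :+ q := p) refl p q)
  where open +-*-Solver using (solve; _:+_; _:-_; _:=_)

altSum-bounds : ∀ a n → (∀ k → 0ℚ ≤ a k) → (∀ k → a (suc k) ≤ a k) →
  0ℚ ≤ altSum a n × altSum a n ≤ a 0
altSum-bounds a zero    0≤a dec = ≤-refl , 0≤a 0
altSum-bounds a (suc n) 0≤a dec =
  let (lo , hi) = altSum-bounds (λ k → a (suc k)) n (λ k → 0≤a (suc k)) (λ k → dec (suc k))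
  in 0≤- (≤-trans hi (dec 0)) , p-q≤p lo

cosCoef : ℚ → ℕ → ℚ
cosCoef s k = s ^ k * 1/fact (2 ℕ.* k)

^-square : ∀ q k → q ^ (2 ℕ.* k) ≡ (q * q) ^ k
^-square q zero    = refl
^-square q (suc k) = begin
  q ^ (2 ℕ.* suc k)       ≡⟨ cong (q ^_) (ℕ.*-suc 2 k) ⟩
  q * (q * q ^ (2 ℕ.* k)) ≡⟨ *-assoc q q (q ^ (2 ℕ.* k)) ⟨
  q * q * q ^ (2 ℕ.* k)   ≡⟨ cong (q * q *_) (^-square q k) ⟩
  q * q * (q * q) ^ k     ∎
  where open ≡-Reasoning

cosPartial≡altSum : ∀ n q → cosPartial n q ≡ altSum (cosCoef (q * q)) n
cosPartial≡altSum zero    q = refl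
cosPartial≡altSum (suc n) q = begin
  cosPartial n q + cosTerm q n
    ≡⟨ cong₂ _+_ (cosPartial≡altSum n q)
         (trans (cong (λ z → (- 1ℚ) ^ n * z * 1/fact (2 ℕ.* n)) (^-square q n))
                (*-assoc ((- 1ℚ) ^ n) ((q * q) ^ n) (1/fact (2 ℕ.* n)))) ⟩
  altSum (cosCoef (q * q)) n + (- 1ℚ) ^ n * cosCoef (q * q) n
    ≡⟨ altSum-snoc (cosCoef (q * q)) n ⟨
  altSum (cosCoef (q * q)) (suc n) ∎
  where open ≡-Reasoning

0≤1/fact : ∀ n → 0ℚ ≤ 1/fact n
0≤1/fact n = nonNegative⁻¹ (1/fact n) {{normalize-nonNeg 1 (n !) {{n ℕ.!≢0}}}}

module _ (s t : ℚ) (0≤s : 0ℚ ≤ s) (s≤t : s ≤ t) (t≤4 : t ≤ ι 4) where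
  open ≤-Reasoning

  private
    z d : ℕ → ℚ
    z k = t ^ suc k - s ^ suc k
    d k = cosCoef t (suc k) - cosCoef s (suc k)

    0≤t : 0ℚ ≤ t
    0≤t = ≤-trans 0≤s s≤t

    d≡ : ∀ k → d k ≡ z k * 1/fact (2 ℕ.* suc k)
    d≡ k = eq (t ^ suc k) (s ^ suc k) (1/fact (2 ℕ.* suc k))
      where
      open +-*-Solver using (solve; _:*_; _:-_; _:=_)
      eq : ∀ a b c → a * c - b * c ≡ (a - b) * c
      eq = solve 3 (λ a b c → a :* c :- b :* c := (a :- b) :* c) refl

    0≤z : ∀ k → 0ℚ ≤ z k
    0≤z k = 0≤- (^-mono-≤ 0≤s s≤t (suc k))

    0≤d : ∀ k → 0ℚ ≤ d k
    0≤d k = subst (0ℚ ≤_) (sym (d≡ k)) (0≤* (0≤z k) (0≤1/fact (2 ℕ.* suc k)))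

    z-step : ∀ k → z (suc k) ≤ ι 8 * z k
    z-step k = ≤-trans
      (≤-by (0≤* (0≤* 0≤s 0≤t) (0≤- (^-mono-≤ 0≤s s≤t k))) (eq s t (s ^ k) (t ^ k)))
      (*-monoʳ-≤-nonNeg (z k) {{nonNegative (0≤z k)}} (+-mono-≤ t≤4 (≤-trans s≤t t≤4)))
      where
      open +-*-Solver using (solve; _:*_; _:-_; _:+_; _:=_)
      eq : ∀ s t a b → (t * (t * b) - s * (s * a)) + s * t * (b - a) ≡ (t + s) * (t * b - s * a)
      eq = solve 4 (λ s t a b → (t :* (t :* b) :- s :* (s :* a)) :+ s :* t :* (b :- a)
                                  := (t :+ s) :* (t :* b :- s :* a)) refl

    d-step : ∀ k → ι 12 * d (suc k) ≤ ι 8 * d k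
    d-step k = begin
      ι 12 * d (suc k)           ≤⟨ *-monoʳ-≤-nonNeg (d (suc k)) {{nonNegative (0≤d (suc k))}} (ι-mono 12≤D) ⟩
      ι D * d (suc k)            ≡⟨ cong (ι D *_) (d≡ (suc k)) ⟩
      ι D * (z (suc k) * 1/fact (2 ℕ.* suc (suc k)))
                                 ≡⟨ cong (λ m → ι D * (z (suc k) * 1/fact m)) (ℕ.*-suc 2 (suc k)) ⟩
      ι D * (z (suc k) * f')     ≡⟨ eq (ι D) (z (suc k)) f' ⟩
      z (suc k) * (f' * ι D)     ≡⟨ cong (z (suc k) *_) (1/fact-step (2 ℕ.* suc k)) ⟩
      z (suc k) * f              ≤⟨ *-monoʳ-≤-nonNeg f {{nonNegative (0≤1/fact (2 ℕ.* suc k))}} (z-step k) ⟩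
      ι 8 * z k * f              ≡⟨ *-assoc (ι 8) (z k) f ⟩
      ι 8 * (z k * f)            ≡⟨ cong (ι 8 *_) (d≡ k) ⟨
      ι 8 * d k                  ∎
      where
      open +-*-Solver using (solve; _:*_; _:=_)
      D = suc (suc (2 ℕ.* suc k)) ℕ.* suc (2 ℕ.* suc k)
      f = 1/fact (2 ℕ.* suc k)
      f' = 1/fact (suc (suc (2 ℕ.* suc k)))
      2≤ : 2 ℕ.≤ 2 ℕ.* suc k
      2≤ = ℕ.*-monoʳ-≤ 2 (ℕ.s≤s (ℕ.z≤n {k}))
      12≤D : 12 ℕ.≤ D
      12≤D = ℕ.*-mono-≤ {4} {suc (suc (2 ℕ.* suc k))} {3} (ℕ.s≤s (ℕ.s≤s 2≤)) (ℕ.s≤s 2≤)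
      eq : ∀ a b c → a * (b * c) ≡ b * (c * a)
      eq = solve 3 (λ a b c → a :* (b :* c) := b :* (c :* a)) refl

    d-dec : ∀ k → d (suc k) ≤ d k
    d-dec k = *-cancelˡ-≤-pos (ι 12) (≤-trans (d-step k)
      (*-monoʳ-≤-nonNeg (d k) {{nonNegative (0≤d k)}} (ι-mono {8} {12} (ℕ.m≤m+n 8 4))))

    diff : ∀ n → altSum (cosCoef s) (suc n) - altSum (cosCoef t) (suc n) ≡ altSum d n
    diff n = trans (eq (cosCoef s 0) (altSum (λ k → cosCoef s (suc k)) n) (altSum (λ k → cosCoef t (suc k)) n))
      (sym (altSum-sub (λ k → cosCoef t (suc k)) (λ k → cosCoef s (suc k)) n))
      where
      open +-*-Solver using (solve; _:-_; _:=_)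
      eq : ∀ c a b → (c - a) - (c - b) ≡ b - a
      eq = solve 3 (λ c a b → (c :- a) :- (c :- b) := b :- a) refl

  altSum-cosCoef-upper : ∀ n → altSum (cosCoef s) (suc n) - altSum (cosCoef t) (suc n) ≤ (t - s) * ½
  altSum-cosCoef-upper n = begin
    altSum (cosCoef s) (suc n) - altSum (cosCoef t) (suc n)  ≡⟨ diff n ⟩
    altSum d n       ≤⟨ proj₂ (altSum-bounds d n 0≤d d-dec) ⟩
    d 0              ≡⟨ d≡ 0 ⟩
    z 0 * ½          ≡⟨ cong (_* ½) (cong₂ _-_ (*-identityʳ t) (*-identityʳ s)) ⟩
    (t - s) * ½      ∎

  altSum-cosCoef-lower′ : ∀ n → d 0 - d 1 ≤
    altSum (cosCoef s) (suc (suc n)) - altSum (cosCoef t) (suc (suc n))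
  altSum-cosCoef-lower′ n = begin
    d 0 - d 1        ≤⟨ +-monoʳ-≤ (d 0) (neg-antimono-≤
                          (proj₂ (altSum-bounds (λ k → d (suc k)) n (λ k → 0≤d (suc k)) (λ k → d-dec (suc k))))) ⟩
    altSum d (suc n) ≡⟨ diff (suc n) ⟨
    altSum (cosCoef s) (suc (suc n)) - altSum (cosCoef t) (suc (suc n)) ∎

  altSum-cosCoef-lower : ∀ n → t - s ≤
    ι 6 * (altSum (cosCoef s) (suc (suc n)) - altSum (cosCoef t) (suc (suc n)))
  altSum-cosCoef-lower n = ≤-trans (≤-by (0≤* (nonNegative⁻¹ ½) (0≤- (d-step 0))) eq′)
      (*-monoˡ-≤-nonNeg (ι 6) (altSum-cosCoef-lower′ n))
    where
    open +-*-Solver using (solve; _:*_; _:+_; _:-_; _:=_; con)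
    d₀ : (t - s) * ½ ≡ d 0
    d₀ = sym (trans (d≡ 0) (cong (_* ½) (cong₂ _-_ (*-identityʳ t) (*-identityʳ s))))
    eq : ∀ a b → ι 2 * a + ½ * (ι 8 * a - ι 12 * b) ≡ ι 6 * (a - b)
    eq = solve 2 (λ a b → con (ι 2) :* a :+ con ½ :* (con (ι 8) :* a :- con (ι 12) :* b)
                            := con (ι 6) :* (a :- b)) refl
    twice : ∀ a → a ≡ ι 2 * (a * ½)
    twice = solve 1 (λ a → a := con (ι 2) :* (a :* con ½)) refl
    eq′ : (t - s) + ½ * (ι 8 * d 0 - ι 12 * d 1) ≡ ι 6 * (d 0 - d 1)
    eq′ = trans (cong (_+ ½ * (ι 8 * d 0 - ι 12 * d 1)) (trans (twice (t - s)) (cong (ι 2 *_) d₀)))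
            (eq (d 0) (d 1))

0≤square : ∀ {x} → 0ℚ ≤ x → 0ℚ ≤ x * x
0≤square 0≤x = 0≤* 0≤x 0≤x

square-mono : ∀ {x y} → 0ℚ ≤ x → x ≤ y → x * x ≤ y * y
square-mono 0≤x x≤y = *-mono-≤-nonNeg 0≤x (≤-trans 0≤x x≤y) x≤y x≤y

cosPartial-upper : ∀ x y n → 0ℚ ≤ x → x ≤ y → y ≤ ι 2 →
  cosPartial (suc n) x - cosPartial (suc n) y ≤ (y * y - x * x) * ½
cosPartial-upper x y n 0≤x x≤y y≤2 = subst₂ (λ a b → a - b ≤ (y * y - x * x) * ½)
  (sym (cosPartial≡altSum (suc n) x)) (sym (cosPartial≡altSum (suc n) y))
  (altSum-cosCoef-upper (x * x) (y * y) (0≤square 0≤x) (square-mono 0≤x x≤y)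
    (square-mono (≤-trans 0≤x x≤y) y≤2) n)

cosPartial-lower : ∀ x y n → 0ℚ ≤ x → x ≤ y → y ≤ ι 2 →
  y * y - x * x ≤ ι 6 * (cosPartial (suc (suc n)) x - cosPartial (suc (suc n)) y)
cosPartial-lower x y n 0≤x x≤y y≤2 = subst₂ (λ a b → y * y - x * x ≤ ι 6 * (a - b))
  (sym (cosPartial≡altSum (suc (suc n)) x)) (sym (cosPartial≡altSum (suc (suc n)) y))
  (altSum-cosCoef-lower (x * x) (y * y) (0≤square 0≤x) (square-mono 0≤x x≤y)
    (square-mono (≤-trans 0≤x x≤y) y≤2) n)

cosPartial-0 : ∀ n → cosPartial (suc n) 0ℚ ≡ 1ℚ
cosPartial-0 zero    = refl
cosPartial-0 (suc n) = trans (cong₂ _+_ (cosPartial-0 n) term≡0) (+-identityʳ 1ℚ)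
  where
  open ≡-Reasoning
  s = (- 1ℚ) ^ suc n
  f = 1/fact (2 ℕ.* suc n)
  term≡0 : cosTerm 0ℚ (suc n) ≡ 0ℚ
  term≡0 = begin
    s * (0ℚ * 0ℚ ^ (n ℕ.+ 1 ℕ.* suc n)) * f  ≡⟨ cong (λ z → s * z * f) (*-zeroˡ (0ℚ ^ (n ℕ.+ 1 ℕ.* suc n))) ⟩
    s * 0ℚ * f                               ≡⟨ cong (_* f) (*-zeroʳ s) ⟩
    0ℚ * f                                   ≡⟨ *-zeroˡ f ⟩
    0ℚ                                       ∎

cosPartial-2 : ∀ n → cosPartial (suc (suc n)) (ι 2) ≤ 0ℚ
cosPartial-2 n = ≤-trans (≤-by (0≤- bound) eq) (from-yes (1ℚ - gap ≤? 0ℚ))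
  where
  open +-*-Solver using (solve; _:+_; _:-_; _:=_)
  gap = (cosCoef (ι 4) 1 - cosCoef 0ℚ 1) - (cosCoef (ι 4) 2 - cosCoef 0ℚ 2)
  C = cosPartial (suc (suc n)) (ι 2)
  bound : gap ≤ 1ℚ - C
  bound = subst₂ (λ a b → gap ≤ a - b)
    (trans (sym (cosPartial≡altSum (suc (suc n)) 0ℚ)) (cosPartial-0 (suc n)))
    (sym (cosPartial≡altSum (suc (suc n)) (ι 2)))
    (altSum-cosCoef-lower′ 0ℚ (ι 4) ≤-refl (0≤ι 4) ≤-refl n)
  eq : C + ((1ℚ - C) - gap) ≡ 1ℚ - gap
  eq = solve 3 (λ c o g → c :+ ((o :- c) :- g) := o :- g) refl C 1ℚ gap

-- The least j < k with f j ≤ 0, or k if there is none.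
search : (ℕ → ℚ) → ℕ → ℕ
search f zero    = 0
search f (suc k) with f 0 ≤? 0ℚ
... | yes _ = 0
... | no  _ = suc (search (λ j → f (suc j)) k)

search-spec : ∀ f k → 0ℚ < f 0 → f k ≤ 0ℚ →
  Σ[ i ∈ ℕ ] search f k ≡ suc i × 0ℚ < f i × f (suc i) ≤ 0ℚ × suc i ℕ.≤ k
search-spec f zero    0<f0 fk≤0 = contradiction fk≤0 (<⇒≱ 0<f0)
search-spec f (suc k) 0<f0 fk≤0 with f 0 ≤? 0ℚ
... | yes f0≤0 = contradiction f0≤0 (<⇒≱ 0<f0)
... | no  _    = next (f 1 ≤? 0ℚ)
  where
  f₁ : ℕ → ℚ
  f₁ j = f (suc j)
  search-0 : ∀ g k → g 0 ≤ 0ℚ → search g k ≡ 0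
  search-0 g zero    _ = refl
  search-0 g (suc k) g0≤0 with g 0 ≤? 0ℚ
  ... | yes _    = refl
  ... | no  g0≰0 = contradiction g0≤0 g0≰0
  next : Dec (f 1 ≤ 0ℚ) → Σ[ i ∈ ℕ ] suc (search f₁ k) ≡ suc i × 0ℚ < f i × f (suc i) ≤ 0ℚ × suc i ℕ.≤ suc k
  next (yes f1≤0) = 0 , cong suc (search-0 f₁ k f1≤0) , 0<f0 , f1≤0 , ℕ.s≤s ℕ.z≤n
  next (no  f1≰0) =
    let (i , eq , 0<fi , f≤0 , i<k) = search-spec f₁ k (≰⇒> f1≰0) fk≤0
    in suc i , cong suc eq , 0<fi , f≤0 , ℕ.s≤s i<k

-- The least multiple of 1/(n+1) in [0, 2] at which the n-th partial sum is not positive;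
-- a Cauchy sequence converging to the least positive zero of the cosine.
halfPi : ℕ → ℚ
halfPi n = ι (search (λ j → cosPartial n (ι j * (+ 1 / suc n))) (2 ℕ.* suc n)) * (+ 1 / suc n)

unit : ℕ → ℚ
unit n = + 1 / suc n

0<unit : ∀ n → 0ℚ < unit n
0<unit n = positive⁻¹ (unit n) {{normalize-pos 1 (suc n)}}

unit*ι : ∀ n → unit n * ι (suc n) ≡ 1ℚ
unit*ι n = 1/m*m≡1 (suc n)

p≤ι*q⇒unit*p≤q : ∀ n {p q} → p ≤ ι (suc n) * q → unit n * p ≤ q
p≤ι*q⇒unit*p≤q n {p} {q} h = begin
  unit n * p                   ≤⟨ *-monoˡ-≤-nonNeg (unit n) {{nonNegative (<⇒≤ (0<unit n))}} h ⟩
  unit n * (ι (suc n) * q)     ≡⟨ *-assoc (unit n) (ι (suc n)) q ⟨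
  unit n * ι (suc n) * q       ≡⟨ cong (_* q) (unit*ι n) ⟩
  1ℚ * q                       ≡⟨ *-identityˡ q ⟩
  q                            ∎
  where open ≤-Reasoning

unit-antimono : ∀ {m n} → m ℕ.≤ n → unit n ≤ unit m
unit-antimono {m} {n} m≤n = subst (_≤ unit m) (*-identityʳ (unit n))
  (p≤ι*q⇒unit*p≤q n (begin
    1ℚ                  ≡⟨ unit*ι m ⟨
    unit m * ι (suc m)  ≡⟨ *-comm (unit m) (ι (suc m)) ⟩
    ι (suc m) * unit m  ≤⟨ *-monoʳ-≤-nonNeg (unit m) {{nonNegative (<⇒≤ (0<unit m))}} (ι-mono (ℕ.s≤s m≤n)) ⟩
    ι (suc n) * unit m  ∎))
  where open ≤-Reasoning

unit-small : ∀ C ε → 0ℚ < C → 0ℚ < ε → Σ[ N ∈ ℕ ] (∀ n → N ℕ.≤ n → C * unit n < ε)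
unit-small C ε 0<C 0<ε = fromδ (shrink ε C 0<ε 0<C)
  where
  open ≤-Reasoning
  fromδ : (Σ[ δ ∈ ℚ ] 0ℚ < δ × ε * δ ≡ C) → Σ[ N ∈ ℕ ] (∀ n → N ℕ.≤ n → C * unit n < ε)
  fromδ (δ , _ , εδ≡C) = proj₁ (archimedean δ) , λ n N≤n →
    *-cancelʳ-<-nonNeg (ι (suc n)) (begin-strict
      C * unit n * ι (suc n)    ≡⟨ *-assoc C (unit n) (ι (suc n)) ⟩
      C * (unit n * ι (suc n))  ≡⟨ cong (C *_) (unit*ι n) ⟩
      C * 1ℚ                    ≡⟨ *-identityʳ C ⟩
      C                         ≡⟨ εδ≡C ⟨
      ε * δ                     <⟨ *-monoʳ-<-pos ε {{positive 0<ε}} (δ< n N≤n) ⟩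
      ε * ι (suc n)             ∎)
    where
    δ< : ∀ n → proj₁ (archimedean δ) ℕ.≤ n → δ < ι (suc n)
    δ< n N≤n = begin-strict
      δ          ≤⟨ proj₂ (archimedean δ) ⟩
      ι (proj₁ (archimedean δ))  ≤⟨ ι-mono N≤n ⟩
      ι n        ≡⟨ +-identityˡ (ι n) ⟨
      0ℚ + ι n   <⟨ +-monoˡ-< (ι n) 0<1 ⟩
      1ℚ + ι n   ≡⟨ ι-suc n ⟨
      ι (suc n)  ∎

record HalfPiSpec (n : ℕ) (h : ℚ) : Set where
  field
    1≤h : 1ℚ ≤ h
    h≤2 : h ≤ ι 2
    cos≤0 : cosPartial n h ≤ 0ℚ
    cos≥ : - (ι 2 * unit n) ≤ cosPartial n h

halfPi-spec : ∀ n → HalfPiSpec (suc (suc n)) (halfPi (suc (suc n)))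
halfPi-spec n = fromSearch (search-spec f k 0<f0 fk≤0)
  where
  open ≤-Reasoning
  N = suc (suc n)
  w = unit N
  k = 2 ℕ.* suc N
  f : ℕ → ℚ
  f j = cosPartial N (ι j * w)
  0<f0 : 0ℚ < f 0
  0<f0 = subst (0ℚ <_) (sym (trans (cong (cosPartial N) (*-zeroˡ w)) (cosPartial-0 (suc n)))) 0<1
  end : ι k * w ≡ ι 2
  end = begin-equality
    ι k * w                ≡⟨ cong (_* w) (ι-* 2 (suc N)) ⟨
    ι 2 * ι (suc N) * w    ≡⟨ *-assoc (ι 2) (ι (suc N)) w ⟩
    ι 2 * (ι (suc N) * w)  ≡⟨ cong (ι 2 *_) (trans (*-comm (ι (suc N)) w) (unit*ι N)) ⟩
    ι 2                    ∎
  fk≤0 : f k ≤ 0ℚ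
  fk≤0 = subst (_≤ 0ℚ) (sym (cong (cosPartial N) end)) (cosPartial-2 n)
  fromSearch : (Σ[ i ∈ ℕ ] search f k ≡ suc i × 0ℚ < f i × f (suc i) ≤ 0ℚ × suc i ℕ.≤ k) →
               HalfPiSpec N (halfPi N)
  fromSearch (i , found , 0<fi , fsi≤0 , si≤k) =
    subst (λ j → HalfPiSpec N (ι j * w)) (sym found) (record
      { 1≤h = 1≤h ; h≤2 = h≤2 ; cos≤0 = fsi≤0 ; cos≥ = cos≥ })
    where
    h h₀ C : ℚ
    h = ι (suc i) * w
    h₀ = ι i * w
    C = cosPartial N h
    0≤w : 0ℚ ≤ w
    0≤w = <⇒≤ (0<unit N)
    0≤h₀ : 0ℚ ≤ h₀
    0≤h₀ = 0≤* (0≤ι i) 0≤w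
    0≤h : 0ℚ ≤ h
    0≤h = 0≤* (0≤ι (suc i)) 0≤w
    h≡ : h ≡ w + h₀
    h≡ = begin-equality
      ι (suc i) * w       ≡⟨ cong (_* w) (ι-suc i) ⟩
      (1ℚ + ι i) * w      ≡⟨ *-distribʳ-+ w 1ℚ (ι i) ⟩
      1ℚ * w + h₀         ≡⟨ cong (_+ h₀) (*-identityˡ w) ⟩
      w + h₀              ∎
    h₀≤h : h₀ ≤ h
    h₀≤h = *-monoʳ-≤-nonNeg w {{nonNegative 0≤w}} (ι-mono (ℕ.n≤1+n i))
    h≤2 : h ≤ ι 2
    h≤2 = subst (h ≤_) end (*-monoʳ-≤-nonNeg w {{nonNegative 0≤w}} (ι-mono si≤k))
    1≤h : 1ℚ ≤ h
    1≤h = ≮⇒≥ λ h<1 → contradiction (≤-trans 1≤1-C (small (<⇒≤ h<1))) (from-no (1ℚ ≤? ½))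
      where
      1≤1-C : 1ℚ ≤ 1ℚ - C
      1≤1-C = +-monoʳ-≤ 1ℚ {0ℚ} { - C} (neg-antimono-≤ fsi≤0)
      small : h ≤ 1ℚ → 1ℚ - C ≤ ½
      small h≤1 = begin
        1ℚ - C                 ≡⟨ cong (_- C) (cosPartial-0 (suc n)) ⟨
        cosPartial N 0ℚ - C    ≤⟨ cosPartial-upper 0ℚ h (suc n) ≤-refl 0≤h h≤2 ⟩
        (h * h - 0ℚ) * ½       ≡⟨ cong (_* ½) (+-identityʳ (h * h)) ⟩
        h * h * ½              ≤⟨ *-monoʳ-≤-nonNeg ½ (square-mono 0≤h h≤1) ⟩
        ½                      ∎
    cos≥ : - (ι 2 * w) ≤ C
    cos≥ = subst (- (ι 2 * w) ≤_) (neg-involutive C) (neg-antimono-≤ (begin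
      - C                           ≡⟨ +-identityˡ (- C) ⟨
      0ℚ - C                        ≤⟨ +-monoˡ-≤ (- C) (<⇒≤ 0<fi) ⟩
      cosPartial N h₀ - C           ≤⟨ cosPartial-upper h₀ h (suc n) 0≤h₀ h₀≤h h≤2 ⟩
      (h * h - h₀ * h₀) * ½         ≡⟨ factor h h₀ ⟩
      (h - h₀) * ((h + h₀) * ½)     ≡⟨ cong (_* ((h + h₀) * ½)) (trans (cong (_- h₀) h≡) (cancel w h₀)) ⟩
      w * ((h + h₀) * ½)            ≤⟨ *-monoˡ-≤-nonNeg w {{nonNegative 0≤w}}
                                         (*-monoʳ-≤-nonNeg ½ (+-mono-≤ h≤2 (≤-trans h₀≤h h≤2))) ⟩
      w * ι 2                       ≡⟨ *-comm w (ι 2) ⟩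
      ι 2 * w                       ∎))
      where
      open +-*-Solver using (solve; _:+_; _:-_; _:*_; :-_; _:=_; con)
      neg-involutive : ∀ a → - (- a) ≡ a
      neg-involutive = solve 1 (λ a → :- (:- a) := a) refl
      factor : ∀ a b → (a * a - b * b) * ½ ≡ (a - b) * ((a + b) * ½)
      factor = solve 2 (λ a b → (a :* a :- b :* b) :* con ½ := (a :- b) :* ((a :+ b) :* con ½)) refl
      cancel : ∀ a b → (a + b) - b ≡ a
      cancel = solve 2 (λ a b → (a :+ b) :- b := a) refl

halfPi-spec≥2 : ∀ {n} → 2 ℕ.≤ n → HalfPiSpec n (halfPi n)
halfPi-spec≥2 (ℕ.s≤s (ℕ.s≤s {n = n} _)) = halfPi-spec n

p≤∣p∣ : ∀ p → p ≤ ∣ p ∣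
p≤∣p∣ p = [ (λ 0≤p → ≤-reflexive (sym (0≤p⇒∣p∣≡p 0≤p)))
          , (λ p≤0 → ≤-trans p≤0 (0≤∣p∣ p)) ]′ (≤-total 0ℚ p)

∣nonPos∣≤ : ∀ {p b} → p ≤ 0ℚ → - b ≤ p → ∣ p ∣ ≤ b
∣nonPos∣≤ {p} {b} p≤0 -b≤p = begin
  ∣ p ∣    ≡⟨ ∣-p∣≡∣p∣ p ⟨
  ∣ - p ∣  ≡⟨ 0≤p⇒∣p∣≡p (neg-antimono-≤ p≤0) ⟩
  - p      ≤⟨ neg-antimono-≤ -b≤p ⟩
  - (- b)  ≡⟨ solve 1 (λ a → :- (:- a) := a) refl b ⟩
  b        ∎
  where
  open ≤-Reasoning
  open +-*-Solver using (solve; :-_; _:=_)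

difference≤ : ∀ {x y} → 0ℚ ≤ x → x ≤ y → 1ℚ ≤ y → y - x ≤ y * y - x * x
difference≤ {x} {y} 0≤x x≤y 1≤y = ≤-by (0≤* (0≤- x≤y) (0≤- 1≤x+y))
  (solve 2 (λ x y → (y :- x) :+ (y :- x) :* ((x :+ y) :- con 1ℚ) := y :* y :- x :* x) refl x y)
  where
  open +-*-Solver using (solve; _:+_; _:-_; _:*_; _:=_; con)
  1≤x+y : 1ℚ ≤ x + y
  1≤x+y = +-mono-≤ 0≤x 1≤y

cosPartial-inverseLipschitz : ∀ n x y → 1ℚ ≤ x → x ≤ ι 2 → 1ℚ ≤ y → y ≤ ι 2 →
  ∣ x - y ∣ ≤ ι 6 * ∣ cosPartial (suc (suc n)) x - cosPartial (suc (suc n)) y ∣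
cosPartial-inverseLipschitz n x y 1≤x x≤2 1≤y y≤2 =
  [ (λ x≤y → subst (_≤ ι 6 * ∣ C x - C y ∣) (∣-∣-sym y x) (ordered x y 1≤x 1≤y y≤2 x≤y))
  , (λ y≤x → subst (λ z → ∣ x - y ∣ ≤ ι 6 * z) (∣-∣-sym (C y) (C x)) (ordered y x 1≤y 1≤x x≤2 y≤x)) ]′
  (≤-total x y)
  where
  open ≤-Reasoning
  C = cosPartial (suc (suc n))
  ordered : ∀ a b → 1ℚ ≤ a → 1ℚ ≤ b → b ≤ ι 2 → a ≤ b → ∣ b - a ∣ ≤ ι 6 * ∣ C a - C b ∣
  ordered a b 1≤a 1≤b b≤2 a≤b = begin
    ∣ b - a ∣            ≡⟨ 0≤p⇒∣p∣≡p (0≤- a≤b) ⟩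
    b - a                ≤⟨ difference≤ 0≤a a≤b 1≤b ⟩
    b * b - a * a        ≤⟨ cosPartial-lower a b n 0≤a a≤b b≤2 ⟩
    ι 6 * (C a - C b)    ≤⟨ *-monoˡ-≤-nonNeg (ι 6) (p≤∣p∣ (C a - C b)) ⟩
    ι 6 * ∣ C a - C b ∣  ∎
    where
    0≤a : 0ℚ ≤ a
    0≤a = ≤-trans (<⇒≤ 0<1) 1≤a

∣cosTerm∣≤unit : ∀ j q → 0ℚ ≤ q → q ≤ ι 2 → ∣ cosTerm q (j ℕ.+ 2) ∣ ≤ unit j
∣cosTerm∣≤unit j q 0≤q q≤2 = begin
  u                             ≡⟨ *-identityˡ u ⟨
  1ℚ * u                        ≡⟨ cong (_* u) (unit*ι j) ⟨
  unit j * ι (suc j) * u        ≡⟨ *-assoc (unit j) (ι (suc j)) u ⟩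
  unit j * (ι (suc j) * u)      ≤⟨ *-monoˡ-≤-nonNeg (unit j) {{nonNegative (<⇒≤ (0<unit j))}}
                                     (≤-trans (cosTerm-decay q 2 ∣q∣≤2 j) second) ⟩
  unit j * 1ℚ                   ≡⟨ *-identityʳ (unit j) ⟩
  unit j                        ∎
  where
  open ≤-Reasoning
  u = ∣ cosTerm q (j ℕ.+ 2) ∣
  f = 1/fact 4
  ∣q∣≤2 : ∣ q ∣ ≤ ι 2
  ∣q∣≤2 = subst (_≤ ι 2) (sym (0≤p⇒∣p∣≡p 0≤q)) q≤2
  second : ∣ cosTerm q 2 ∣ ≤ 1ℚ
  second = begin
    ∣ 1ℚ * q ^ 4 * f ∣  ≡⟨ cong (λ z → ∣ z * f ∣) (*-identityˡ (q ^ 4)) ⟩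
    ∣ q ^ 4 * f ∣       ≡⟨ 0≤p⇒∣p∣≡p (0≤* (0≤^ 0≤q 4) (0≤1/fact 4)) ⟩
    q ^ 4 * f           ≤⟨ *-monoʳ-≤-nonNeg f (^-mono-≤ 0≤q q≤2 4) ⟩
    ι 2 ^ 4 * f         ≤⟨ from-yes (ι 2 ^ 4 * f ≤? 1ℚ) ⟩
    1ℚ                  ∎

∣cosPartial-halfPi∣≤ : ∀ j n → j ℕ.+ 2 ℕ.≤ n → ∣ cosPartial (j ℕ.+ 2) (halfPi n) ∣ ≤ ι 4 * unit j
∣cosPartial-halfPi∣≤ j n j+2≤n = begin
  ∣ c ∣                    ≡⟨ cong ∣_∣ (split c c′) ⟩
  ∣ c′ - (c′ - c) ∣        ≤⟨ ∣p-q∣≤∣p∣+∣q∣ c′ (c′ - c) ⟩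
  ∣ c′ ∣ + ∣ c′ - c ∣      ≤⟨ +-mono-≤
      (≤-trans (∣nonPos∣≤ cos≤0 cos≥) (*-monoˡ-≤-nonNeg (ι 2) (unit-antimono j≤n)))
      (≤-trans (cosPartial-close h 2 ∣h∣≤2 (j ℕ.+ 2) n (ℕ.m≤n+m 2 j) j+2≤n)
               (+-mono-≤ (∣cosTerm∣≤unit j h 0≤h h≤2) (∣cosTerm∣≤unit j h 0≤h h≤2))) ⟩
  ι 2 * w + (w + w)        ≡⟨ collect w ⟩
  ι 4 * w                  ∎
  where
  open ≤-Reasoning
  open +-*-Solver using (solve; _:+_; _:-_; _:*_; _:=_; con)
  h = halfPi n
  w = unit j
  c = cosPartial (j ℕ.+ 2) h
  c′ = cosPartial n h
  open HalfPiSpec (halfPi-spec≥2 (ℕ.≤-trans (ℕ.m≤n+m 2 j) j+2≤n))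
  j≤n : j ℕ.≤ n
  j≤n = ℕ.≤-trans (ℕ.m≤m+n j 2) j+2≤n
  0≤h : 0ℚ ≤ h
  0≤h = ≤-trans (<⇒≤ 0<1) 1≤h
  ∣h∣≤2 : ∣ h ∣ ≤ ι 2
  ∣h∣≤2 = subst (_≤ ι 2) (sym (0≤p⇒∣p∣≡p 0≤h)) h≤2
  split : ∀ a b → a ≡ b - (b - a)
  split = solve 2 (λ a b → a := b :- (b :- a)) refl
  collect : ∀ w → ι 2 * w + (w + w) ≡ ι 4 * w
  collect = solve 1 (λ w → con (ι 2) :* w :+ (w :+ w) := con (ι 4) :* w) refl

halfPi-close : ∀ j m n → j ℕ.+ 2 ℕ.≤ m → j ℕ.+ 2 ℕ.≤ n → ∣ halfPi m - halfPi n ∣ ≤ ι 48 * unit j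
halfPi-close j m n j+2≤m j+2≤n = begin
  ∣ x - y ∣                          ≤⟨ subst (λ p → ∣ x - y ∣ ≤ ι 6 * ∣ cosPartial p x - cosPartial p y ∣) (ℕ.+-comm 2 j)
                                          (cosPartial-inverseLipschitz j x y X.1≤h X.h≤2 Y.1≤h Y.h≤2) ⟩
  ι 6 * ∣ C x - C y ∣                ≤⟨ *-monoˡ-≤-nonNeg (ι 6) (≤-trans (∣p-q∣≤∣p∣+∣q∣ (C x) (C y))
                                          (+-mono-≤ (∣cosPartial-halfPi∣≤ j m j+2≤m) (∣cosPartial-halfPi∣≤ j n j+2≤n))) ⟩
  ι 6 * (ι 4 * w + ι 4 * w)          ≡⟨ collect w ⟩
  ι 48 * w                           ∎
  where
  open ≤-Reasoning
  open +-*-Solver using (solve; _:+_; _:*_; _:=_; con)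
  C = cosPartial (j ℕ.+ 2)
  x = halfPi m
  y = halfPi n
  w = unit j
  module X = HalfPiSpec (halfPi-spec≥2 (ℕ.≤-trans (ℕ.m≤n+m 2 j) j+2≤m))
  module Y = HalfPiSpec (halfPi-spec≥2 (ℕ.≤-trans (ℕ.m≤n+m 2 j) j+2≤n))
  collect : ∀ w → ι 6 * (ι 4 * w + ι 4 * w) ≡ ι 48 * w
  collect = solve 1 (λ w → con (ι 6) :* (con (ι 4) :* w :+ con (ι 4) :* w) := con (ι 48) :* w) refl

cauchy-halfPi : Cauchy halfPi
cauchy-halfPi ε 0<ε = fromSmall (unit-small (ι 48) ε (0<ι-suc 47) 0<ε)
  where
  fromSmall : (Σ[ N ∈ ℕ ] (∀ n → N ℕ.≤ n → ι 48 * unit n < ε)) →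
    Σ[ N ∈ ℕ ] (∀ m n → N ℕ.≤ m → N ℕ.≤ n → ∣ halfPi m - halfPi n ∣ < ε)
  fromSmall (j , small) = j ℕ.+ 2 , λ m n a b →
    ≤-<-trans (halfPi-close j m n a b) (small j ℕ.≤-refl)

π : ℝ
π = fromℚ (+ 2 / 1) *ᵣ mkℝ halfPi cauchy-halfPi

-- The defining property of π: π/2 is the least positive zero of the cosine.
record IsPi (π : ℝ) : Set where
  field
    0<π      : fromℚ 0ℚ <ᵣ π
    cos-zero : cos (π /ᵣ 2) ≃ᵣ fromℚ 0ℚ
    least    : ∀ t → fromℚ 0ℚ <ᵣ t → t <ᵣ π /ᵣ 2 → ¬ (cos t ≃ᵣ fromℚ 0ℚ)

π/2≡halfPi : ∀ n → seq (π /ᵣ 2) n ≡ halfPi n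
π/2≡halfPi n = eq (halfPi n)
  where
  open +-*-Solver using (solve; _:*_; _:=_; con)
  eq : ∀ h → ι 2 * h * ½ ≡ h
  eq = solve 1 (λ h → con (ι 2) :* h :* con ½ := h) refl

π-isPi : IsPi π
π-isPi = record { 0<π = positive-π ; cos-zero = cos-zero ; least = least }
  where
  open ≤-Reasoning
  positive-π : fromℚ 0ℚ <ᵣ π
  positive-π = 1ℚ , 0<1 , 2 , λ n 2≤n → begin-strict
    0ℚ + 1ℚ          <⟨ from-yes (0ℚ + 1ℚ <? ι 2 * 1ℚ) ⟩
    ι 2 * 1ℚ         ≤⟨ *-monoˡ-≤-nonNeg (ι 2) (HalfPiSpec.1≤h (halfPi-spec≥2 2≤n)) ⟩
    ι 2 * halfPi n   ∎
  cos-zero : cos (π /ᵣ 2) ≃ᵣ fromℚ 0ℚ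
  cos-zero ε 0<ε = fromSmall (unit-small (ι 2) ε (0<ι-suc 1) 0<ε)
    where
    fromSmall : (Σ[ N ∈ ℕ ] (∀ n → N ℕ.≤ n → ι 2 * unit n < ε)) →
      Σ[ N ∈ ℕ ] (∀ n → N ℕ.≤ n → ∣ cosPartial n (seq (π /ᵣ 2) n) - 0ℚ ∣ < ε)
    fromSmall (N , small) = N ℕ.⊔ 2 , λ n h → begin-strict
      ∣ cosPartial n (seq (π /ᵣ 2) n) - 0ℚ ∣  ≡⟨ cong ∣_∣ (+-identityʳ (cosPartial n (seq (π /ᵣ 2) n))) ⟩
      ∣ cosPartial n (seq (π /ᵣ 2) n) ∣       ≡⟨ cong (λ z → ∣ cosPartial n z ∣) (π/2≡halfPi n) ⟩
      ∣ cosPartial n (halfPi n) ∣             ≤⟨ zero-bound n (ℕ.m⊔n≤o⇒n≤o N 2 h) ⟩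
      ι 2 * unit n                            <⟨ small n (ℕ.m⊔n≤o⇒m≤o N 2 h) ⟩
      ε                                       ∎
      where
      zero-bound : ∀ n → 2 ℕ.≤ n → ∣ cosPartial n (halfPi n) ∣ ≤ ι 2 * unit n
      zero-bound n 2≤n = ∣nonPos∣≤ (HalfPiSpec.cos≤0 (halfPi-spec≥2 2≤n)) (HalfPiSpec.cos≥ (halfPi-spec≥2 2≤n))
  apart : ∀ n s ε η → 2 ℕ.≤ n → 0ℚ < ε → 0ℚ ≤ s → s + ε < halfPi n → cosPartial n s < η →
    ι 6 * η ≡ ε * ½ → ι 12 * unit n < ε * ½ → ⊥
  apart (suc (suc n)) s ε η (ℕ.s≤s (ℕ.s≤s _)) 0<ε 0≤s s+ε<h cos<η 6η small = <-irrefl refl (begin-strict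
    ε                                        ≡⟨ cancel s ε ⟩
    (s + ε) - s                              ≤⟨ +-monoˡ-≤ (- s) (<⇒≤ s+ε<h) ⟩
    h - s                                    ≤⟨ difference≤ 0≤s s≤h 1≤h ⟩
    h * h - s * s                            ≤⟨ cosPartial-lower s h n 0≤s s≤h h≤2 ⟩
    ι 6 * (cosPartial N s - cosPartial N h)  ≤⟨ *-monoˡ-≤-nonNeg (ι 6) (+-mono-≤ (<⇒≤ cos<η) (neg-antimono-≤ cos≥)) ⟩
    ι 6 * (η - (- (ι 2 * unit N)))           ≡⟨ expand η (unit N) ⟩
    ι 6 * η + ι 12 * unit N                  ≡⟨ cong (_+ ι 12 * unit N) 6η ⟩
    ε * ½ + ι 12 * unit N                    <⟨ +-monoʳ-< (ε * ½) small ⟩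
    ε * ½ + ε * ½                            ≡⟨ half+half ε ⟩
    ε                                        ∎)
    where
    open +-*-Solver using (solve; _:+_; _:-_; _:*_; :-_; _:=_; con)
    N = suc (suc n)
    h = halfPi N
    open HalfPiSpec (halfPi-spec n)
    s≤h : s ≤ h
    s≤h = ≤-trans (≤-by (<⇒≤ 0<ε) refl) (<⇒≤ s+ε<h)
    cancel : ∀ s e → e ≡ (s + e) - s
    cancel = solve 2 (λ s e → e := (s :+ e) :- s) refl
    expand : ∀ a w → ι 6 * (a - (- (ι 2 * w))) ≡ ι 6 * a + ι 12 * w
    expand = solve 2 (λ a w → con (ι 6) :* (a :- (:- (con (ι 2) :* w))) := con (ι 6) :* a :+ con (ι 12) :* w) refl
  least : ∀ t → fromℚ 0ℚ <ᵣ t → t <ᵣ π /ᵣ 2 → ¬ (cos t ≃ᵣ fromℚ 0ℚ)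
  least t (ε₁ , 0<ε₁ , N₁ , 0<t) (ε , 0<ε , N₂ , t<π/2) cos≃0 =
    fromShrink (shrink (ι 6) (ε * ½) (0<ι-suc 5) 0<ε½)
    where
    0<ε½ : 0ℚ < ε * ½
    0<ε½ = 0<* 0<ε (positive⁻¹ ½)
    fromNull : ∀ η → ι 6 * η ≡ ε * ½ →
      (Σ[ N ∈ ℕ ] (∀ n → N ℕ.≤ n → ∣ cosPartial n (seq t n) - 0ℚ ∣ < η)) →
      (Σ[ N ∈ ℕ ] (∀ n → N ℕ.≤ n → ι 12 * unit n < ε * ½)) → ⊥
    fromNull η 6η (N₃ , null) (N₄ , small) = apart n (seq t n) ε η
      (ℕ.m≤n⊔m M 2) 0<ε 0≤t (subst (seq t n + ε <_) (π/2≡halfPi n) (t<π/2 n N₂≤n)) cos<η 6η (small n N₄≤n)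
      where
      M = (N₁ ℕ.⊔ N₂) ℕ.⊔ (N₃ ℕ.⊔ N₄)
      n = M ℕ.⊔ 2
      M≤n : M ℕ.≤ n
      M≤n = ℕ.m≤m⊔n M 2
      N₁₂≤n : N₁ ℕ.⊔ N₂ ℕ.≤ n
      N₁₂≤n = ℕ.m⊔n≤o⇒m≤o (N₁ ℕ.⊔ N₂) (N₃ ℕ.⊔ N₄) M≤n
      N₃₄≤n : N₃ ℕ.⊔ N₄ ℕ.≤ n
      N₃₄≤n = ℕ.m⊔n≤o⇒n≤o (N₁ ℕ.⊔ N₂) (N₃ ℕ.⊔ N₄) M≤n
      N₂≤n : N₂ ℕ.≤ n
      N₂≤n = ℕ.m⊔n≤o⇒n≤o N₁ N₂ N₁₂≤n
      N₄≤n : N₄ ℕ.≤ n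
      N₄≤n = ℕ.m⊔n≤o⇒n≤o N₃ N₄ N₃₄≤n
      0≤t : 0ℚ ≤ seq t n
      0≤t = ≤-trans (<⇒≤ (subst (0ℚ <_) (sym (+-identityˡ ε₁)) 0<ε₁))
        (<⇒≤ (0<t n (ℕ.m⊔n≤o⇒m≤o N₁ N₂ N₁₂≤n)))
      cos<η : cosPartial n (seq t n) < η
      cos<η = ≤-<-trans (p≤∣p∣ (cosPartial n (seq t n)))
        (subst (λ z → ∣ z ∣ < η) (+-identityʳ (cosPartial n (seq t n)))
          (null n (ℕ.m⊔n≤o⇒m≤o N₃ N₄ N₃₄≤n)))
    fromShrink : (Σ[ η ∈ ℚ ] 0ℚ < η × ι 6 * η ≡ ε * ½) → ⊥
    fromShrink (η , 0<η , 6η) = fromNull η 6η (cos≃0 η 0<η)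
      (unit-small (ι 12) (ε * ½) (0<ι-suc 11) 0<ε½)

-- c₀ ∷ … ∷ c_{d-1} ∷ [] stands for c₀ + c₁ X + … + c_{d-1} X^{d-1} + X^d.
MonicPoly : ℕ → Set
MonicPoly d = Vec ℚ d

eval : ∀ {d} → MonicPoly d → ℝ → ℝ
eval []      x = fromℚ 1ℚ
eval (c ∷ p) x = fromℚ c +ᵣ x *ᵣ eval p x

IsMinimalPolynomial : ∀ {d} → MonicPoly d → ℝ → Set
IsMinimalPolynomial {d} p α =
  eval p α ≃ᵣ fromℚ 0ℚ × (∀ {m} (q : MonicPoly m) → eval q α ≃ᵣ fromℚ 0ℚ → d ℕ.≤ m)

-- α is algebraic over ℚ and its minimal polynomial has degree d.
HasDegree : ℝ → ℕ → Set
HasDegree α d = Σ[ p ∈ MonicPoly d ] IsMinimalPolynomial p α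

{-# OPTIONS --safe #-}
module Submission where

-- Write g for the number in question and g′ for 2 cos (π/3 - π/2ⁿ).  The duplication formula gives
-- g_{n+1}² = 2 - g′_n and g′_{n+1}² = 2 - g_n with g₀ = g′₀ = -1, so g_n is reached from -1 by n steps
-- h² = 2 - g.  Abstractly this is a tower of quadratic extensions of ℚ with generators γ₀ = -1 and
-- γ_{k+1} = √(2 - γ_k).  The norm of 2 ± γ_{k+1} is 2 + γ_k, so going down the norms, all that is needed
-- for 2 ± γ_k (k ≥ 1) not to be squares is that 2 ± √3 = (1 ± √3)² / 2 are not squares in ℚ(√3), i.e. that
-- 2, 3 and 6 are not squares in ℚ.  Hence the tower embeds into ℝ, and a monic polynomial of degree d
-- vanishing at γ_{k+1} has an even or odd part which is monic of degree ⌊d/2⌋ in X² and vanishes at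
-- γ_{k+1}² = 2 - γ_k, so that d ≥ 2ᵏ⁺¹ by induction.
--
-- The duplication formula comes from cos (x + y) + cos (x - y) = 2 cos x cos y, that is from the Cauchy
-- product of the power series, where y = π/2 also yields cos (π - x) = - cos x.

open import Defs
open import Data.Nat using (ℕ; _^_)
open import Data.Nat.Properties using (m^n≢0)
open import Data.Integer using (+_)
open import Data.Rational using (_/_)

open import Algebra.Bundles using (AbelianGroup; CommutativeRing)
import Algebra.Construct.DirectProduct as DirectProduct
import Algebra.Solver.Ring as RingSolver
open import Algebra.Solver.Ring.AlmostCommutativeRing
  using (fromCommutativeRing; _-Raw-AlmostCommutative⟶_; -raw-almostCommutative⟶)
open import Algebra.Structures using (IsCommutativeRing)
import Data.Integer.Base as ℤ
import Data.Integer.Properties as ℤ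
open import Data.Maybe.Base using (Maybe; just; nothing)
import Data.Nat.Base as ℕ
open import Data.Nat.Base using (zero; suc; _!)
open import Data.Nat.Divisibility using (_∣_; divides; _∣?_; ∣m⇒∣m*n; m∣m*n)
open import Data.Nat.Induction using (<-rec)
open import Data.Nat.Primality using (Prime; prime?; euclidsLemma; prime⇒nonTrivial)
import Data.Nat.Properties as ℕ
import Data.Nat.Solver as ℕ
open import Data.Product.Base using (_×_; _,_; proj₁; proj₂; Σ-syntax)
import Data.Rational.Base as ℚ
open import Data.Rational.Base using (ℚ; 0ℚ; 1ℚ; ½; mkℚ)
import Data.Rational.Properties as ℚ
import Data.Rational.Solver as ℚ
import Data.Rational.Unnormalised.Base as ℚᵘ
import Data.Rational.Unnormalised.Properties as ℚᵘ
open import Data.Sum.Base using (_⊎_; inj₁; inj₂; [_,_]′)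
open import Data.Vec.Base using ([]; _∷_)
open import Function.Base using (id)
open import Level using (0ℓ)
import Relation.Binary.Reasoning.Setoid as SetoidReasoning
open import Relation.Binary.PropositionalEquality as ≡ using (_≡_)
open import Relation.Nullary using (¬_; yes; no; contradiction)
open import Relation.Nullary.Decidable using (from-yes; from-no)

open import Algebra.Definitions.RawSemiring ℚ.+-*-rawSemiring using () renaming (_^_ to _^ℚ_)

-- Algebras over ℚ and quadratic extensions

-- Equality of reals is undecidable here, and from a vanishing product of reals one cannot in
-- general pick a vanishing factor, so the lower bound on degrees is not proved inside ℝ. The tower
-- is formal, made of pairs over ℚ, where the vanishing of a polynomial value can be read off
-- coordinate by coordinate; ℝ enters through an injective map out of it. No level is shown to be a
-- field: `Nonsquare` speaks of a² = t b² and makes the norm vanish at 0 alone, which does the work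
-- of inverses in every induction. Nothing depends on which of the two roots √(2 - γ) denotes. Hence
-- one tower serves g and g′ alike, and the signs of the cosines never matter, with one exception:
-- cos (π/3) ≥ 0 is what singles out 1/2 among the roots of (2c - 1)(c + 1).

-- Without η and with copatterns, two extensions are compared by their parameters, not by their fields.
record ℚ-Algebra : Set₁ where
  no-eta-equality
  field
    commutativeRing : CommutativeRing 0ℓ 0ℓ
    structure       : CommutativeRing.rawRing ℚ.+-*-commutativeRing
                      -Raw-AlmostCommutative⟶ fromCommutativeRing commutativeRing

  open CommutativeRing commutativeRing public
  open _-Raw-AlmostCommutative⟶_ structure public
    renaming (⟦_⟧ to algebraMap)

  -- The ring solver has to recognise equal coefficients only. Deciding them in ℚ makes it available
  -- over rings whose own equality is undecidable, such as ℝ.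
  algebraMap-≟ : ∀ p q → Maybe (algebraMap p ≈ algebraMap q)
  algebraMap-≟ p q with p ℚ.≟ q
  ... | yes ≡.refl = just refl
  ... | no  _      = nothing

  module Solver = RingSolver (CommutativeRing.rawRing ℚ.+-*-commutativeRing)
    (fromCommutativeRing commutativeRing) structure algebraMap-≟

  module ≈-Reasoning = SetoidReasoning setoid

  algebraMap-cong : ∀ {p q} → p ≡ q → algebraMap p ≈ algebraMap q
  algebraMap-cong ≡.refl = refl

ℚ-algebra : ℚ-Algebra
ℚ-algebra .ℚ-Algebra.commutativeRing = ℚ.+-*-commutativeRing
ℚ-algebra .ℚ-Algebra.structure       = -raw-almostCommutative⟶ (fromCommutativeRing ℚ.+-*-commutativeRing)

-- A[√t]; the pair (a , b) stands for a + b √t.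
module QuadraticExtension (A : ℚ-Algebra) (t : ℚ-Algebra.Carrier A) where
  open ℚ-Algebra A
  open Solver using (solve; _:+_; _:*_; _:-_; :-_; _:=_; con)

  private
    pairs : AbelianGroup 0ℓ 0ℓ
    pairs = DirectProduct.abelianGroup +-abelianGroup +-abelianGroup

    module + = AbelianGroup pairs

    infixl 7 _·_
    _·_ : +.Carrier → +.Carrier → +.Carrier
    (a , b) · (c , d) = a * c + t * (b * d) , a * d + b * c

    ·-cong : ∀ {x y u v} → x +.≈ y → u +.≈ v → x · u +.≈ y · v
    ·-cong (p , q) (r , s) =
      +-cong (*-cong p r) (*-congˡ (*-cong q s)) , +-cong (*-cong p s) (*-cong q r)

    ·-comm : ∀ x y → x · y +.≈ y · x
    ·-comm (a , b) (c , d) =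
        solve 5 (λ t a b c d → a :* c :+ t :* (b :* d) := c :* a :+ t :* (d :* b)) refl t a b c d
      , solve 4 (λ a b c d → a :* d :+ b :* c := c :* b :+ d :* a) refl a b c d

    ·-assoc : ∀ x y z → (x · y) · z +.≈ x · (y · z)
    ·-assoc (a , b) (c , d) (e , f) =
        solve 7 (λ t a b c d e f →
          (a :* c :+ t :* (b :* d)) :* e :+ t :* ((a :* d :+ b :* c) :* f) :=
          a :* (c :* e :+ t :* (d :* f)) :+ t :* (b :* (c :* f :+ d :* e))) refl t a b c d e f
      , solve 7 (λ t a b c d e f →
          (a :* c :+ t :* (b :* d)) :* f :+ (a :* d :+ b :* c) :* e :=
          a :* (c :* f :+ d :* e) :+ b :* (c :* e :+ t :* (d :* f))) refl t a b c d e f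

    ·-distribˡ : ∀ x y z → x · (y +.∙ z) +.≈ (x · y) +.∙ (x · z)
    ·-distribˡ (a , b) (c , d) (e , f) =
        solve 7 (λ t a b c d e f →
          a :* (c :+ e) :+ t :* (b :* (d :+ f)) :=
          (a :* c :+ t :* (b :* d)) :+ (a :* e :+ t :* (b :* f))) refl t a b c d e f
      , solve 6 (λ a b c d e f →
          a :* (d :+ f) :+ b :* (c :+ e) := (a :* d :+ b :* c) :+ (a :* f :+ b :* e)) refl a b c d e f

    ·-distribʳ : ∀ x y z → (y +.∙ z) · x +.≈ (y · x) +.∙ (z · x)
    ·-distribʳ x y z = +.trans (·-comm (y +.∙ z) x)
      (+.trans (·-distribˡ x y z) (+.∙-cong (·-comm x y) (·-comm x z)))

    ·-identityˡ : ∀ x → (1# , 0#) · x +.≈ x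
    ·-identityˡ (a , b) =
        trans (+-cong (*-identityˡ a) (trans (*-congˡ (zeroˡ b)) (zeroʳ t))) (+-identityʳ a)
      , trans (+-cong (*-identityˡ b) (zeroˡ a)) (+-identityʳ b)

    extension : CommutativeRing 0ℓ 0ℓ
    extension = record
      { Carrier = +.Carrier
      ; _≈_ = +._≈_
      ; _+_ = +._∙_
      ; _*_ = _·_
      ; -_  = +._⁻¹
      ; 0#  = +.ε
      ; 1#  = 1# , 0#
      ; isCommutativeRing = record
        { isRing = record
          { +-isAbelianGroup = +.isAbelianGroup
          ; *-cong     = ·-cong
          ; *-assoc    = ·-assoc
          ; *-identity = ·-identityˡ , λ x → +.trans (·-comm x (1# , 0#)) (·-identityˡ x)
          ; distrib    = ·-distribˡ , ·-distribʳ
          }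
        ; *-comm = ·-comm
        }
      }

  -0≈0 : - 0# ≈ 0#
  -0≈0 = trans (sym (+-identityˡ (- 0#))) (-‿inverseʳ 0#)

  algebra : ℚ-Algebra
  algebra .ℚ-Algebra.commutativeRing = extension
  algebra .ℚ-Algebra.structure = record
    { ⟦_⟧    = λ q → algebraMap q , 0#
    ; +-homo = λ p q → +-homo p q , sym (+-identityˡ 0#)
    ; *-homo = λ p q →
          trans (*-homo p q) (trans (sym (+-identityʳ _)) (+-congˡ (sym (trans (*-congˡ (zeroˡ 0#)) (zeroʳ t)))))
        , sym (trans (+-cong (zeroʳ _) (zeroˡ _)) (+-identityˡ 0#))
    ; -‿homo = λ p → -‿homo p , sym -0≈0
    ; 0-homo = 0-homo , refl
    ; 1-homo = 1-homo , refl
    }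

  √t : ℚ-Algebra.Carrier algebra
  √t = 0# , 1#

  norm : ℚ-Algebra.Carrier algebra → Carrier
  norm (a , b) = a * a - t * (b * b)

-- Division-free; over a field it says that t is not a square.
Nonsquare : (A : ℚ-Algebra) → ℚ-Algebra.Carrier A → Set
Nonsquare A t = ∀ a b → a * a ≈ t * (b * b) → a ≈ 0# × b ≈ 0#
  where open ℚ-Algebra A

module _ (A : ℚ-Algebra) (t : ℚ-Algebra.Carrier A) (nonsquare : Nonsquare A t) where
  open ℚ-Algebra A
  open QuadraticExtension A t
  open Solver using (solve; _:+_; _:*_; _:-_; :-_; _:=_; con)

  private module Q = ℚ-Algebra algebra

  -- A vanishing norm is the equation a² = t b², so it leaves no room for a nonzero x. Statements
  -- about the extension are brought down to `A` by taking norms and come back up through this.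
  norm≈0⇒≈0 : ∀ x → norm x ≈ 0# → x Q.≈ Q.0#
  norm≈0⇒≈0 (a , b) h = nonsquare a b (begin
    a * a                               ≈⟨ solve 2 (λ u v → u := (u :- v) :+ v) refl (a * a) (t * (b * b)) ⟩
    (a * a - t * (b * b)) + t * (b * b) ≈⟨ +-congʳ h ⟩
    0# + t * (b * b)                    ≈⟨ +-identityˡ _ ⟩
    t * (b * b)                         ∎)
    where open ≈-Reasoning

  -- Taking norms in x² = s y² gives N(x)² = N(s) N(y)².
  nonsquare-extension : ∀ s → Nonsquare A (norm s) → Nonsquare algebra s
  nonsquare-extension s@(p , q) norm-nonsquare x@(a , b) y@(c , d) (e₁ , e₂) =
    let (nx , ny) = norm-nonsquare (norm x) (norm y) (begin
          norm x * norm x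
            ≈⟨ solve 3 (λ t a b → let n = a :* a :- t :* (b :* b); u = a :* a :+ t :* (b :* b); v = a :* b :+ b :* a in
                 n :* n := u :* u :- t :* (v :* v)) refl t a b ⟩
          norm (x Q.* x)
            ≈⟨ +-cong (*-cong e₁ e₁) (-‿cong (*-congˡ (*-cong e₂ e₂))) ⟩
          norm (s Q.* (y Q.* y))
            ≈⟨ solve 5 (λ t p q c d →
                 let n = c :* c :- t :* (d :* d); u = c :* c :+ t :* (d :* d); v = c :* d :+ d :* c
                     w = p :* u :+ t :* (q :* v); z = p :* v :+ q :* u
                 in w :* w :- t :* (z :* z) := (p :* p :- t :* (q :* q)) :* (n :* n)) refl t p q c d ⟩
          norm s * (norm y * norm y) ∎)
    in norm≈0⇒≈0 x nx , norm≈0⇒≈0 y ny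
    where open ≈-Reasoning

-- Nonsquares

module _ where
  open ≡ using (refl; sym; trans; cong; cong₂; subst)

  prime∣square⇒∣ : ∀ {p} → Prime p → ∀ x → p ∣ x ℕ.* x → p ∣ x
  prime∣square⇒∣ pr x h = [ id , id ]′ (euclidsLemma x x pr h)

  -- Infinite descent: such an equation forces p ∣ x and p ∣ y, and persists after dividing both by p.
  square≢prime*coprime*square : ∀ {p m} → Prime p → ¬ (p ∣ m) →
    ∀ y x → x ℕ.* x ≡ p ℕ.* m ℕ.* (y ℕ.* y) → y ≡ 0
  square≢prime*coprime*square {p} {m} pr p∤m = <-rec _ λ where
      zero      rec x eq → refl
      y@(suc _) rec x eq → descend y rec x eq
        (prime∣square⇒∣ pr x (subst (p ∣_) (sym eq) (∣m⇒∣m*n (y ℕ.* y) (m∣m*n m))))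
    where
    open ℕ.+-*-Solver
    instance
      p-nonTrivial : ℕ.NonTrivial p
      p-nonTrivial = prime⇒nonTrivial pr
      p-nonZero : ℕ.NonZero p
      p-nonZero = ℕ.nonTrivial⇒nonZero p
    descend : ∀ y .{{_ : ℕ.NonZero y}} →
      (∀ {r} → r ℕ.< y → ∀ x → x ℕ.* x ≡ p ℕ.* m ℕ.* (r ℕ.* r) → r ≡ 0) →
      ∀ x → x ℕ.* x ≡ p ℕ.* m ℕ.* (y ℕ.* y) → p ∣ x → y ≡ 0
    descend y rec _ eq (divides q refl) with
      [ (λ p∣m → contradiction p∣m p∤m) , prime∣square⇒∣ pr y ]′
        (euclidsLemma m (y ℕ.* y) pr (divides (q ℕ.* q) (sym eq′)))
      where
      eq′ : q ℕ.* q ℕ.* p ≡ m ℕ.* (y ℕ.* y)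
      eq′ = ℕ.*-cancelˡ-≡ _ _ p (trans
        (solve 2 (λ p q → p :* (q :* q :* p) := q :* p :* (q :* p)) refl p q)
        (trans eq (ℕ.*-assoc p m (y ℕ.* y))))
    ... | divides r refl = cong (ℕ._* p) (rec r<y q eq″)
      where
      instance
        r-nonZero : ℕ.NonZero r
        r-nonZero = ℕ.m*n≢0⇒m≢0 r
      r<y : r ℕ.< r ℕ.* p
      r<y = ℕ.m<m*n r p (ℕ.nonTrivial⇒n>1 p)
      eq″ : q ℕ.* q ≡ p ℕ.* m ℕ.* (r ℕ.* r)
      eq″ = ℕ.*-cancelˡ-≡ _ _ (p ℕ.* p) {{ℕ.m*n≢0 p p}} (trans
        (solve 2 (λ p q → p :* p :* (q :* q) := q :* p :* (q :* p)) refl p q)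
        (trans eq (solve 3 (λ p m r → p :* m :* (r :* p :* (r :* p)) := p :* p :* (p :* m :* (r :* r))) refl p m r)))

  ι-injective : ∀ {m n} → ι m ≡ ι n → m ≡ n
  ι-injective eq = ℤ.+-injective (cong ℚ.numerator eq)

  -- Clears denominators with the sign already discarded, so that the descent can run in ℕ.
  ∣p∣*denominator : ∀ p → ℚ.∣ p ∣ ℚ.* ι (ℚ.denominatorℕ p) ≡ ι ℤ.∣ ℚ.numerator p ∣
  ∣p∣*denominator p@(mkℚ n d _) = ℚ.toℚᵘ-injective (ℚᵘ.≃-trans (ℚ.toℚᵘ-homo-* ℚ.∣ p ∣ (ι (suc d)))
    (ℚᵘ.*≡* (ℤ.*-assoc (ℤ.+ ℤ.∣ n ∣) (ℤ.+ suc d) (ℤ.+ 1))))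

  ∣p∣*∣p∣ : ∀ p → ℚ.∣ p ∣ ℚ.* ℚ.∣ p ∣ ≡ p ℚ.* p
  ∣p∣*∣p∣ p with ℚ.∣p∣≡p∨∣p∣≡-p p
  ... | inj₁ eq = cong₂ ℚ._*_ eq eq
  ... | inj₂ eq = trans (cong₂ ℚ._*_ eq eq) (solve 1 (λ p → :- p :* :- p := p :* p) refl p)
    where open ℚ.+-*-Solver

  p*q≡0⇒p≡0∨q≡0 : ∀ p q → p ℚ.* q ≡ 0ℚ → p ≡ 0ℚ ⊎ q ≡ 0ℚ
  p*q≡0⇒p≡0∨q≡0 p q pq≡0 with p ℚ.≟ 0ℚ
  ... | yes p≡0 = inj₁ p≡0
  ... | no  p≢0 = inj₂ (begin
    q                        ≡⟨ ℚ.*-identityˡ q ⟨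
    1ℚ ℚ.* q                 ≡⟨ cong (ℚ._* q) (ℚ.*-inverseˡ p) ⟨
    (ℚ.1/ p) ℚ.* p ℚ.* q     ≡⟨ ℚ.*-assoc (ℚ.1/ p) p q ⟩
    (ℚ.1/ p) ℚ.* (p ℚ.* q)   ≡⟨ cong ((ℚ.1/ p) ℚ.*_) pq≡0 ⟩
    (ℚ.1/ p) ℚ.* 0ℚ          ≡⟨ ℚ.*-zeroʳ (ℚ.1/ p) ⟩
    0ℚ                       ∎)
    where
    open ≡.≡-Reasoning
    instance
      p-nonZero : ℚ.NonZero p
      p-nonZero = ℚ.≢-nonZero p≢0

  p*p≡0⇒p≡0 : ∀ p → p ℚ.* p ≡ 0ℚ → p ≡ 0ℚ
  p*p≡0⇒p≡0 p h = [ id , id ]′ (p*q≡0⇒p≡0∨q≡0 p p h)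

  -- Multiplying a² = p m b² by the squares of both denominators leaves an equation of natural
  -- numbers, to which the descent applies. The cofactor m lets 2, 3 and 6 = 2 · 3 come from one
  -- statement.
  prime*coprime-nonsquare : ∀ {p m} → Prime p → ¬ (p ∣ m) → Nonsquare ℚ-algebra (ι (p ℕ.* m))
  prime*coprime-nonsquare {p} {m} pr p∤m a b eq = a≡0 , b≡0
    where
    open ℚ.+-*-Solver
    open ≡.≡-Reasoning
    d = ℚ.denominatorℕ a
    e = ℚ.denominatorℕ b
    X = ℤ.∣ ℚ.numerator a ∣
    Y = ℤ.∣ ℚ.numerator b ∣
    integral : (X ℕ.* e) ℕ.* (X ℕ.* e) ≡ p ℕ.* m ℕ.* ((Y ℕ.* d) ℕ.* (Y ℕ.* d))
    integral = ι-injective (begin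
      ι ((X ℕ.* e) ℕ.* (X ℕ.* e))                              ≡⟨ expand X e ⟩
      (ι X ℚ.* ι e) ℚ.* (ι X ℚ.* ι e)                          ≡⟨ cong (λ z → (z ℚ.* ι e) ℚ.* (z ℚ.* ι e)) (∣p∣*denominator a) ⟨
      (ℚ.∣ a ∣ ℚ.* ι d ℚ.* ι e) ℚ.* (ℚ.∣ a ∣ ℚ.* ι d ℚ.* ι e)  ≡⟨ rearrange ℚ.∣ a ∣ (ι d) (ι e) ⟩
      (ℚ.∣ a ∣ ℚ.* ℚ.∣ a ∣) ℚ.* D                              ≡⟨ cong (ℚ._* D) (∣p∣*∣p∣ a) ⟩
      (a ℚ.* a) ℚ.* D                                          ≡⟨ cong (ℚ._* D) eq ⟩
      N ℚ.* (b ℚ.* b) ℚ.* D                                    ≡⟨ cong (λ z → N ℚ.* z ℚ.* D) (∣p∣*∣p∣ b) ⟨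
      N ℚ.* (ℚ.∣ b ∣ ℚ.* ℚ.∣ b ∣) ℚ.* D                        ≡⟨ rearrange′ N ℚ.∣ b ∣ (ι d) (ι e) ⟩
      N ℚ.* ((ℚ.∣ b ∣ ℚ.* ι e ℚ.* ι d) ℚ.* (ℚ.∣ b ∣ ℚ.* ι e ℚ.* ι d))
                                                               ≡⟨ cong (λ z → N ℚ.* ((z ℚ.* ι d) ℚ.* (z ℚ.* ι d))) (∣p∣*denominator b) ⟩
      N ℚ.* ((ι Y ℚ.* ι d) ℚ.* (ι Y ℚ.* ι d))                  ≡⟨ cong (N ℚ.*_) (expand Y d) ⟨
      N ℚ.* ι ((Y ℕ.* d) ℕ.* (Y ℕ.* d))                        ≡⟨ ι-* (p ℕ.* m) _ ⟩
      ι (p ℕ.* m ℕ.* ((Y ℕ.* d) ℕ.* (Y ℕ.* d)))                ∎)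
      where
      N = ι (p ℕ.* m)
      D = (ι d ℚ.* ι e) ℚ.* (ι d ℚ.* ι e)
      expand : ∀ x y → ι ((x ℕ.* y) ℕ.* (x ℕ.* y)) ≡ (ι x ℚ.* ι y) ℚ.* (ι x ℚ.* ι y)
      expand x y = trans (sym (ι-* (x ℕ.* y) (x ℕ.* y))) (cong₂ ℚ._*_ (sym (ι-* x y)) (sym (ι-* x y)))
      rearrange : ∀ a d e → (a ℚ.* d ℚ.* e) ℚ.* (a ℚ.* d ℚ.* e) ≡ (a ℚ.* a) ℚ.* ((d ℚ.* e) ℚ.* (d ℚ.* e))
      rearrange = solve 3 (λ a d e → (a :* d :* e) :* (a :* d :* e) := (a :* a) :* ((d :* e) :* (d :* e))) refl
      rearrange′ : ∀ n b d e → n ℚ.* (b ℚ.* b) ℚ.* ((d ℚ.* e) ℚ.* (d ℚ.* e)) ≡ n ℚ.* ((b ℚ.* e ℚ.* d) ℚ.* (b ℚ.* e ℚ.* d))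
      rearrange′ = solve 4 (λ n b d e → n :* (b :* b) :* ((d :* e) :* (d :* e)) := n :* ((b :* e :* d) :* (b :* e :* d))) refl
    Yd≡0 : Y ℕ.* d ≡ 0
    Yd≡0 = square≢prime*coprime*square pr p∤m (Y ℕ.* d) (X ℕ.* e) integral
    b≡0 : b ≡ 0ℚ
    b≡0 = ℚ.↥p≡0⇒p≡0 b (ℤ.∣i∣≡0⇒i≡0 (ℕ.m*n≡0⇒m≡0 Y d Yd≡0))
    a≡0 : a ≡ 0ℚ
    a≡0 = p*p≡0⇒p≡0 a (trans eq (trans (cong (λ z → ι (p ℕ.* m) ℚ.* (z ℚ.* z)) b≡0) (ℚ.*-zeroʳ (ι (p ℕ.* m)))))

  nonsquare-2 : Nonsquare ℚ-algebra (ι 2)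
  nonsquare-2 = prime*coprime-nonsquare {2} {1} (from-yes (prime? 2)) (from-no (2 ∣? 1))

  nonsquare-3 : Nonsquare ℚ-algebra (ι 3)
  nonsquare-3 = prime*coprime-nonsquare {3} {1} (from-yes (prime? 3)) (from-no (3 ∣? 1))

  nonsquare-6 : Nonsquare ℚ-algebra (ι 6)
  nonsquare-6 = prime*coprime-nonsquare {2} {3} (from-yes (prime? 2)) (from-no (2 ∣? 3))

-- Transfer of nonsquares

module _ (A : ℚ-Algebra) where
  open ℚ-Algebra A

  nonsquare-cong : ∀ {s t} → s ≈ t → Nonsquare A s → Nonsquare A t
  nonsquare-cong s≈t h a b eq = h a b (trans eq (*-congʳ (sym s≈t)))

  -- From a² = s b² follows (u b)² = r a², so r and s are nonsquares together once u can be
  -- cancelled. The inverse w of u is passed explicitly.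
  nonsquare-scale : ∀ r s u w → u * u ≈ r * s → w * u ≈ 1# → Nonsquare A r → Nonsquare A s
  nonsquare-scale r s u w u²≈rs wu≈1 h a b eq = proj₂ zeros , (begin
    b            ≈⟨ *-identityˡ b ⟨
    1# * b       ≈⟨ *-congʳ wu≈1 ⟨
    w * u * b    ≈⟨ *-assoc w u b ⟩
    w * (u * b)  ≈⟨ *-congˡ (proj₁ zeros) ⟩
    w * 0#       ≈⟨ zeroʳ w ⟩
    0#           ∎)
    where
    open ≈-Reasoning
    open Solver using (solve; _:*_; _:=_)
    zeros : u * b ≈ 0# × a ≈ 0#
    zeros = h (u * b) a (begin
      (u * b) * (u * b)  ≈⟨ solve 2 (λ u b → (u :* b) :* (u :* b) := (u :* u) :* (b :* b)) refl u b ⟩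
      (u * u) * (b * b)  ≈⟨ *-congʳ u²≈rs ⟩
      (r * s) * (b * b)  ≈⟨ *-assoc r s (b * b) ⟩
      r * (s * (b * b))  ≈⟨ *-congˡ eq ⟨
      r * (a * a)        ∎)

module _ (A : ℚ-Algebra) where
  open ℚ-Algebra A

  module _ (zero-product : ∀ a b → a * b ≈ 0# → a ≈ 0# ⊎ b ≈ 0#) where
    open Solver using (solve; _:+_; _:*_; _:-_; :-_; _:=_; con)
    open ≈-Reasoning

    -- If z² = m x² in A[√t], then (z x̄)² = m N(x)² lies in A, so one of the two
    -- coordinates u, v of z x̄ vanishes, and u² or t v² equals m N(x)².
    nonsquare-scalar : ∀ t m → Nonsquare A t → Nonsquare A m → Nonsquare A (m * t) →
      Nonsquare (QuadraticExtension.algebra A t) (m , 0#)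
    nonsquare-scalar t m t-nonsquare m-nonsquare mt-nonsquare z@(p , q) x@(a , b) (e₁ , e₂) =
      norm≈0⇒≈0 A t t-nonsquare z norm-z≈0 , norm≈0⇒≈0 A t t-nonsquare x norm-x≈0
      where
      open QuadraticExtension A t
      u = p * a - t * (q * b)
      v = q * a - p * b
      N = a * a + t * (b * b)
      M = a * b + b * a
      X = p * p + t * (q * q)
      Y = p * q + q * p
      X≈mN : X ≈ m * N
      X≈mN = trans e₁ (trans (+-congˡ (trans (*-congˡ (zeroˡ M)) (zeroʳ t))) (+-identityʳ (m * N)))
      Y≈mM : Y ≈ m * M
      Y≈mM = trans e₂ (trans (+-congˡ (zeroˡ N)) (+-identityʳ (m * M)))
      -- (z x̄)² = m N(x)² has no √t-coordinate, and that coordinate is 2uv. The 2 stays attached to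
      -- u until ½ removes it in `u-zero`.
      uv≈0 : (u + u) * v ≈ 0#
      uv≈0 = begin
        (u + u) * v
          ≈⟨ solve 5 (λ t a b p q →
               let u = p :* a :- t :* (q :* b); v = q :* a :- p :* b
                   X = p :* p :+ t :* (q :* q); Y = p :* q :+ q :* p
               in (u :+ u) :* v := Y :* (a :* a :+ t :* (b :* b)) :- X :* (a :* b :+ b :* a)) refl t a b p q ⟩
        Y * N - X * M              ≈⟨ +-cong (*-congʳ Y≈mM) (-‿cong (*-congʳ X≈mN)) ⟩
        (m * M) * N - (m * N) * M  ≈⟨ +-congʳ (solve 3 (λ m M N → (m :* M) :* N := (m :* N) :* M) refl m M N) ⟩
        (m * N) * M - (m * N) * M  ≈⟨ -‿inverseʳ ((m * N) * M) ⟩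
        0#                         ∎
      u²+tv² : u * u + t * (v * v) ≈ m * (norm x * norm x)
      u²+tv² = begin
        u * u + t * (v * v)
          ≈⟨ solve 5 (λ t a b p q →
               let u = p :* a :- t :* (q :* b); v = q :* a :- p :* b
                   X = p :* p :+ t :* (q :* q); Y = p :* q :+ q :* p
               in u :* u :+ t :* (v :* v) := X :* (a :* a :+ t :* (b :* b)) :- t :* (Y :* (a :* b :+ b :* a))) refl t a b p q ⟩
        X * N - t * (Y * M)              ≈⟨ +-cong (*-congʳ X≈mN) (-‿cong (*-congˡ (*-congʳ Y≈mM))) ⟩
        (m * N) * N - t * ((m * M) * M)
          ≈⟨ solve 4 (λ t m a b →
               let N = a :* a :+ t :* (b :* b); M = a :* b :+ b :* a; n = a :* a :- t :* (b :* b)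
               in (m :* N) :* N :- t :* ((m :* M) :* M) := m :* (n :* n)) refl t m a b ⟩
        m * (norm x * norm x)            ∎
      norm-x≈0 : norm x ≈ 0#
      norm-x≈0 = [ u-zero , v-zero ]′ (zero-product (u + u) v uv≈0)
        where
        u-zero : u + u ≈ 0# → norm x ≈ 0#
        -- What remains is t v² = m N(x)². Multiplied by t it reads (t v)² = m t N(x)², whence the
        -- hypothesis on m t.
        u-zero 2u≈0 = proj₂ (mt-nonsquare (t * v) (norm x) (begin
            (t * v) * (t * v)
              ≈⟨ solve 3 (λ t u v → (t :* v) :* (t :* v) :=
                   t :* (u :* u :+ t :* (v :* v)) :- con ½ :* t :* u :* (u :+ u)) refl t u v ⟩
            t * (u * u + t * (v * v)) - algebraMap ½ * t * u * (u + u)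
              ≈⟨ +-cong (*-congˡ u²+tv²) (-‿cong (*-congˡ (trans 2u≈0 (sym 0-homo)))) ⟩
            t * (m * (norm x * norm x)) - algebraMap ½ * t * u * algebraMap 0ℚ
              ≈⟨ solve 4 (λ t m n u → t :* (m :* n) :- con ½ :* t :* u :* con 0ℚ := m :* t :* n)
                   refl t m (norm x * norm x) u ⟩
            m * t * (norm x * norm x) ∎))
        v-zero : v ≈ 0# → norm x ≈ 0#
        v-zero v≈0 = proj₂ (m-nonsquare u (norm x) (begin
            u * u                        ≈⟨ +-identityʳ (u * u) ⟨
            u * u + 0#                   ≈⟨ +-congˡ (trans (*-congˡ (trans (*-congˡ v≈0) (zeroʳ v))) (zeroʳ t)) ⟨
            u * u + t * (v * v)          ≈⟨ u²+tv² ⟩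
            m * (norm x * norm x)        ∎))
      norm-z≈0 : norm z ≈ 0#
      -- Norms in z² = m x² give N(z)² = m² N(x)², so only the square of N(z) is seen to vanish.
      norm-z≈0 = [ id , id ]′ (zero-product (norm z) (norm z) (begin
        norm z * norm z
          ≈⟨ solve 3 (λ t p q → let n = p :* p :- t :* (q :* q); X = p :* p :+ t :* (q :* q); Y = p :* q :+ q :* p in
               n :* n := X :* X :- t :* (Y :* Y)) refl t p q ⟩
        X * X - t * (Y * Y)
          ≈⟨ +-cong (*-cong X≈mN X≈mN) (-‿cong (*-congˡ (*-cong Y≈mM Y≈mM))) ⟩
        (m * N) * (m * N) - t * ((m * M) * (m * M))
          ≈⟨ solve 4 (λ t m a b →
               let N = a :* a :+ t :* (b :* b); M = a :* b :+ b :* a; n = a :* a :- t :* (b :* b)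
               in (m :* N) :* (m :* N) :- t :* ((m :* M) :* (m :* M)) := m :* m :* n :* n) refl t m a b ⟩
        m * m * norm x * norm x  ≈⟨ *-congˡ norm-x≈0 ⟩
        m * m * norm x * 0#      ≈⟨ zeroʳ _ ⟩
        0#                       ∎))

-- The tower of square roots

module _ (A : ℚ-Algebra) where
  open ℚ-Algebra A

  2minus 2plus : Carrier → Carrier
  2minus x = algebraMap (ι 2) - x
  2plus x = algebraMap (ι 2) + x

module _ (A : ℚ-Algebra) where
  open ℚ-Algebra A

  module _ (g : Carrier) where
    open QuadraticExtension A (2minus A g)
    open Solver using (solve; _:+_; _:*_; _:-_; :-_; _:=_; con)

    private
      -- Both signs at once: 2² - (2 - g) b² depends on b² = 1 alone. The parameter z absorbs the 0
      -- or -0 that the first coordinate of 2 ± √t carries along.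
      norm-scalar±√t : ∀ b z → b * b ≈ 1# → z ≈ 0# → norm (algebraMap (ι 2) + z , b) ≈ 2plus A g
      norm-scalar±√t b z b²≈1 z≈0 = begin
        norm (algebraMap (ι 2) + z , b)
          ≈⟨ +-cong (*-cong two two) (-‿cong (*-congˡ (trans b²≈1 (sym 1-homo)))) ⟩
        algebraMap (ι 2) * algebraMap (ι 2) - (algebraMap (ι 2) - g) * algebraMap 1ℚ
          ≈⟨ solve 1 (λ g → con (ι 2) :* con (ι 2) :- (con (ι 2) :- g) :* con 1ℚ := con (ι 2) :+ g) refl g ⟩
        algebraMap (ι 2) + g ∎
        where
        open ≈-Reasoning
        two : algebraMap (ι 2) + z ≈ algebraMap (ι 2)
        two = trans (+-congˡ z≈0) (+-identityʳ _)

    norm-2-√t : norm (2minus algebra √t) ≈ 2plus A g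
    norm-2-√t = norm-scalar±√t (0# - 1#) (- 0#)
      (trans (solve 2 (λ o i → (o :- i) :* (o :- i) := i :* i :+ o :* (o :- con (ι 2) :* i)) refl 0# 1#)
        (trans (+-cong (*-identityˡ 1#) (zeroˡ _)) (+-identityʳ 1#))) -0≈0

    norm-2+√t : norm (2plus algebra √t) ≈ 2plus A g
    norm-2+√t = norm-scalar±√t (0# + 1#) 0#
      (trans (*-cong (+-identityˡ 1#) (+-identityˡ 1#)) (*-identityˡ 1#)) refl

mutual
  tower : ℕ → ℚ-Algebra
  tower zero    = ℚ-algebra
  tower (suc k) = QuadraticExtension.algebra (tower k) (2minus (tower k) (γ k))

  γ : ∀ k → ℚ-Algebra.Carrier (tower k)
  γ zero    = ℚ.- 1ℚ
  γ (suc k) = QuadraticExtension.√t (tower k) (2minus (tower k) (γ k))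

-- Starts at level 1, since 2 + γ₀ = 1 is a square. Above it the two signs are needed together: the
-- plus half is the norm of both new elements, while the minus half says that the level adjoins a
-- genuine root, without which norms could vanish off 0.
2±γ-nonsquare : ∀ k → Nonsquare (tower (suc k)) (2minus (tower (suc k)) (γ (suc k))) ×
                      Nonsquare (tower (suc k)) (2plus (tower (suc k)) (γ (suc k)))
2±γ-nonsquare zero =
  -- 2 (2 ∓ √3) = (1 ∓ √3)²
    nonsquare-scale (tower 1) (ι 2 , 0ℚ) (2minus (tower 1) (γ 1)) (1ℚ , ℚ.- 1ℚ) (ℚ.- ½ , ℚ.- ½)
      (≡.refl , ≡.refl) (≡.refl , ≡.refl) 2-nonsquare
  , nonsquare-scale (tower 1) (ι 2 , 0ℚ) (2plus (tower 1) (γ 1)) (1ℚ , 1ℚ) (ℚ.- ½ , ½)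
      (≡.refl , ≡.refl) (≡.refl , ≡.refl) 2-nonsquare
  where
  2-nonsquare : Nonsquare (tower 1) (ι 2 , 0ℚ)
  2-nonsquare = nonsquare-scalar ℚ-algebra p*q≡0⇒p≡0∨q≡0 (ι 3) (ι 2) nonsquare-3 nonsquare-2 nonsquare-6
2±γ-nonsquare (suc k) =
    nonsquare-extension A (2minus A g) minus (2minus (tower (2 ℕ.+ k)) (γ (2 ℕ.+ k)))
      (nonsquare-cong A (A.sym (norm-2-√t A g)) plus)
  , nonsquare-extension A (2minus A g) minus (2plus (tower (2 ℕ.+ k)) (γ (2 ℕ.+ k)))
      (nonsquare-cong A (A.sym (norm-2+√t A g)) plus)
  where
  A = tower (suc k)
  g = γ (suc k)
  module A = ℚ-Algebra A
  minus = proj₁ (2±γ-nonsquare k)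
  plus = proj₂ (2±γ-nonsquare k)

2-γ-nonsquare : ∀ k → Nonsquare (tower k) (2minus (tower k) (γ k))
2-γ-nonsquare zero    = nonsquare-3
2-γ-nonsquare (suc k) = proj₁ (2±γ-nonsquare k)

-- The real numbers as an algebra over ℚ

null-≡ : ∀ {x y} → (∀ n → x n ≡ y n) → Null x → Null y
null-≡ x≡y x→0 ε 0<ε =
  let (N , h) = x→0 ε 0<ε in N , λ n N≤n → ≡.subst (λ z → ℚ.∣ z ∣ ℚ.< ε) (x≡y n) (h n N≤n)

null-0 : Null (λ _ → 0ℚ)
null-0 ε 0<ε = 0 , λ _ _ → 0<ε

null-+ : ∀ {x y} → Null x → Null y → Null (λ n → x n ℚ.+ y n)
null-+ {x} {y} x→0 y→0 ε 0<ε =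
  let 0<ε½ = 0<* 0<ε (ℚ.positive⁻¹ ½)
      (M , h) = x→0 (ε ℚ.* ½) 0<ε½
      (N , k) = y→0 (ε ℚ.* ½) 0<ε½
  in M ℕ.⊔ N , λ n M⊔N≤n → begin-strict
    ℚ.∣ x n ℚ.+ y n ∣          ≤⟨ ℚ.∣p+q∣≤∣p∣+∣q∣ (x n) (y n) ⟩
    ℚ.∣ x n ∣ ℚ.+ ℚ.∣ y n ∣    <⟨ ℚ.+-mono-< (h n (ℕ.m⊔n≤o⇒m≤o M N M⊔N≤n)) (k n (ℕ.m⊔n≤o⇒n≤o M N M⊔N≤n)) ⟩
    ε ℚ.* ½ ℚ.+ ε ℚ.* ½        ≡⟨ half+half ε ⟩
    ε                          ∎
  where open ℚ.≤-Reasoning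

null-* : ∀ {x y} → Cauchy x → Null y → Null (λ n → x n ℚ.* y n)
null-* {x} {y} x-cauchy y→0 ε 0<ε =
  let (B , 0<B , M , h) = cauchy⇒bounded {x} x-cauchy
      (δ , 0<δ , Bδ≡ε) = shrink B ε 0<B 0<ε
      (N , k) = y→0 δ 0<δ
  in M ℕ.⊔ N , λ n M⊔N≤n →
    ∣*∣-bound (x n) (y n) 0<B Bδ≡ε (h n (ℕ.m⊔n≤o⇒m≤o M N M⊔N≤n)) (k n (ℕ.m⊔n≤o⇒n≤o M N M⊔N≤n))

-- _≃ᵣ_ as a record, so that its arguments can be inferred.
infix 4 _≈ᵣ_
record _≈ᵣ_ (x y : ℝ) : Set where
  constructor ≃⇒≈
  field ≈⇒≃ : x ≃ᵣ y

open _≈ᵣ_ public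

≡⇒≈ᵣ : ∀ {x y} → (∀ n → seq x n ≡ seq y n) → x ≈ᵣ y
≡⇒≈ᵣ {x} {y} x≡y = ≃⇒≈ (null-≡ (λ n → ≡.sym (≡.trans (≡.cong (ℚ._- seq y n) (x≡y n)) (ℚ.+-inverseʳ (seq y n)))) null-0)

infixl 6 _⊕_
infixl 7 _⊗_
infix  8 ⊖_

-- The ring operations are abstract because conversion checking would otherwise compare moduli of convergence.
abstract
  _⊕_ _⊗_ : ℝ → ℝ → ℝ
  x ⊕ y = x +ᵣ y
  x ⊗ y = x *ᵣ y

  ⊖_ : ℝ → ℝ
  ⊖ x = mkℝ (λ n → ℚ.- seq x n) (cauchy-neg {seq x} (cauchy x))

  seq-⊕ : ∀ x y n → seq (x ⊕ y) n ≡ seq x n ℚ.+ seq y n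
  seq-⊕ x y n = ≡.refl

  seq-⊗ : ∀ x y n → seq (x ⊗ y) n ≡ seq x n ℚ.* seq y n
  seq-⊗ x y n = ≡.refl

  ⊕-⊗-isCommutativeRing : IsCommutativeRing _≈ᵣ_ _⊕_ _⊗_ ⊖_ (fromℚ 0ℚ) (fromℚ 1ℚ)
  ⊕-⊗-isCommutativeRing = record
    { isRing = record
      { +-isAbelianGroup = record
        { isGroup = record
          { isMonoid = record
            { isSemigroup = record
              { isMagma = record
                { isEquivalence = record
                  { refl  = ≡⇒≈ᵣ (λ _ → ≡.refl)
                  ; sym   = λ {x} {y} (≃⇒≈ p) → ≃⇒≈ (null-≡ (λ n → sym-eq (seq x n) (seq y n)) (-1*null (λ n → seq x n ℚ.- seq y n) p))
                  ; trans = λ {x} {y} {z} (≃⇒≈ p) (≃⇒≈ q) → ≃⇒≈ (null-≡ (λ n → trans-eq (seq x n) (seq y n) (seq z n))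
                      (null-+ {λ n → seq x n ℚ.- seq y n} {λ n → seq y n ℚ.- seq z n} p q))
                  }
                ; ∙-cong = λ {x} {y} {u} {v} (≃⇒≈ p) (≃⇒≈ q) → ≃⇒≈ (null-≡ (λ n → +-eq (seq x n) (seq y n) (seq u n) (seq v n))
                    (null-+ {λ n → seq x n ℚ.- seq y n} {λ n → seq u n ℚ.- seq v n} p q))
                }
              ; assoc = λ x y z → ≡⇒≈ᵣ (λ n → ℚ.+-assoc (seq x n) (seq y n) (seq z n))
              }
            ; identity = (λ x → ≡⇒≈ᵣ (λ n → ℚ.+-identityˡ (seq x n)))
                       , (λ x → ≡⇒≈ᵣ (λ n → ℚ.+-identityʳ (seq x n)))
            }
          ; inverse = (λ x → ≡⇒≈ᵣ (λ n → ℚ.+-inverseˡ (seq x n)))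
                    , (λ x → ≡⇒≈ᵣ (λ n → ℚ.+-inverseʳ (seq x n)))
          ; ⁻¹-cong = λ {x} {y} (≃⇒≈ p) → ≃⇒≈ (null-≡ (λ n → neg-eq (seq x n) (seq y n)) (-1*null (λ n → seq x n ℚ.- seq y n) p))
          }
        ; comm = λ x y → ≡⇒≈ᵣ (λ n → ℚ.+-comm (seq x n) (seq y n))
        }
      -- x u - y v = x (u - v) + v (x - y), where each summand is a Cauchy, hence bounded, sequence
      -- times a null one.
      ; *-cong = λ {x} {y} {u} {v} (≃⇒≈ p) (≃⇒≈ q) → ≃⇒≈ (null-≡ (λ n → *-eq (seq x n) (seq y n) (seq u n) (seq v n))
          (null-+ {λ n → seq x n ℚ.* (seq u n ℚ.- seq v n)} {λ n → seq v n ℚ.* (seq x n ℚ.- seq y n)}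
            (null-* {seq x} {λ n → seq u n ℚ.- seq v n} (cauchy x) q)
            (null-* {seq v} {λ n → seq x n ℚ.- seq y n} (cauchy v) p)))
      ; *-assoc = λ x y z → ≡⇒≈ᵣ (λ n → ℚ.*-assoc (seq x n) (seq y n) (seq z n))
      ; *-identity = (λ x → ≡⇒≈ᵣ (λ n → ℚ.*-identityˡ (seq x n)))
                   , (λ x → ≡⇒≈ᵣ (λ n → ℚ.*-identityʳ (seq x n)))
      ; distrib = (λ x y z → ≡⇒≈ᵣ (λ n → ℚ.*-distribˡ-+ (seq x n) (seq y n) (seq z n)))
                , (λ x y z → ≡⇒≈ᵣ (λ n → ℚ.*-distribʳ-+ (seq x n) (seq y n) (seq z n)))
      }
    ; *-comm = λ x y → ≡⇒≈ᵣ (λ n → ℚ.*-comm (seq x n) (seq y n))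
    }
    where
    open ℚ.+-*-Solver
    -1*null : ∀ x → Null x → Null (λ n → ℚ.- 1ℚ ℚ.* x n)
    -1*null x = null-* {λ _ → ℚ.- 1ℚ} {x} (cauchy-const (ℚ.- 1ℚ))
    sym-eq : ∀ a b → ℚ.- 1ℚ ℚ.* (a ℚ.- b) ≡ b ℚ.- a
    sym-eq = solve 2 (λ a b → con (ℚ.- 1ℚ) :* (a :- b) := b :- a) ≡.refl
    trans-eq : ∀ a b c → (a ℚ.- b) ℚ.+ (b ℚ.- c) ≡ a ℚ.- c
    trans-eq = solve 3 (λ a b c → (a :- b) :+ (b :- c) := a :- c) ≡.refl
    +-eq : ∀ a b c d → (a ℚ.- b) ℚ.+ (c ℚ.- d) ≡ (a ℚ.+ c) ℚ.- (b ℚ.+ d)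
    +-eq = solve 4 (λ a b c d → (a :- b) :+ (c :- d) := (a :+ c) :- (b :+ d)) ≡.refl
    neg-eq : ∀ a b → ℚ.- 1ℚ ℚ.* (a ℚ.- b) ≡ ℚ.- a ℚ.- ℚ.- b
    neg-eq = solve 2 (λ a b → con (ℚ.- 1ℚ) :* (a :- b) := :- a :- :- b) ≡.refl
    *-eq : ∀ a b c d → a ℚ.* (c ℚ.- d) ℚ.+ d ℚ.* (a ℚ.- b) ≡ a ℚ.* c ℚ.- b ℚ.* d
    *-eq = solve 4 (λ a b c d → a :* (c :- d) :+ d :* (a :- b) := a :* c :- b :* d) ≡.refl

  fromℚ-⊕ : ∀ p q → fromℚ (p ℚ.+ q) ≈ᵣ fromℚ p ⊕ fromℚ q
  fromℚ-⊕ p q = ≡⇒≈ᵣ (λ _ → ≡.refl)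

  fromℚ-⊗ : ∀ p q → fromℚ (p ℚ.* q) ≈ᵣ fromℚ p ⊗ fromℚ q
  fromℚ-⊗ p q = ≡⇒≈ᵣ (λ _ → ≡.refl)

  fromℚ-⊖ : ∀ p → fromℚ (ℚ.- p) ≈ᵣ ⊖ fromℚ p
  fromℚ-⊖ p = ≡⇒≈ᵣ (λ _ → ≡.refl)

ℝ-commutativeRing : CommutativeRing 0ℓ 0ℓ
ℝ-commutativeRing = record { isCommutativeRing = ⊕-⊗-isCommutativeRing }

ℝ-algebra : ℚ-Algebra
ℝ-algebra .ℚ-Algebra.commutativeRing = ℝ-commutativeRing
ℝ-algebra .ℚ-Algebra.structure = record
  { ⟦_⟧    = fromℚ
  ; +-homo = fromℚ-⊕
  ; *-homo = fromℚ-⊗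
  ; -‿homo = fromℚ-⊖
  ; 0-homo = ≡⇒≈ᵣ (λ _ → ≡.refl)
  ; 1-homo = ≡⇒≈ᵣ (λ _ → ≡.refl)
  }

-- Degrees

module Evaluation (A : ℚ-Algebra) where
  open ℚ-Algebra A

  evaluate : ∀ {d} → MonicPoly d → Carrier → Carrier
  evaluate []      x = 1#
  evaluate (c ∷ p) x = algebraMap c + x * evaluate p x

  evaluate-cong : ∀ {d} (p : MonicPoly d) {x y} → x ≈ y → evaluate p x ≈ evaluate p y
  evaluate-cong []      x≈y = refl
  evaluate-cong (c ∷ p) x≈y = +-congˡ (*-cong x≈y (evaluate-cong p x≈y))

addConstant : ∀ {d} → ℚ → MonicPoly (suc d) → MonicPoly (suc d)
addConstant b (c ∷ p) = (b ℚ.+ c) ∷ p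

-- (X + a) p
mulLinear : ∀ {d} → ℚ → MonicPoly d → MonicPoly (suc d)
mulLinear a []      = a ∷ []
mulLinear a (c ∷ p) = (a ℚ.* c) ∷ addConstant c (mulLinear a p)

sign : ℕ → ℚ
sign zero    = 1ℚ
sign (suc d) = ℚ.- sign d

-- (-1)ᵈ p(2 - X)
reflect : ∀ {d} → MonicPoly d → MonicPoly d
reflect []                = []
reflect {suc d} (c ∷ p) = addConstant (sign (suc d) ℚ.* c) (mulLinear (ℚ.- ι 2) (reflect p))

-- Preferred to 2 * n because the length of a vector then exposes two constructors at a time, as
-- splitting into even and odd coefficients requires.
double : ℕ → ℕ
double zero    = zero
double (suc n) = suc (suc (double n))

double≡2* : ∀ n → double n ≡ 2 ℕ.* n
double≡2* zero    = ≡.refl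
double≡2* (suc n) = ≡.trans (≡.cong (λ m → suc (suc m)) (double≡2* n)) (≡.sym (ℕ.*-suc 2 n))

-- p(X²)
expand : ∀ {d} → MonicPoly d → MonicPoly (double d)
expand []      = []
expand (c ∷ p) = c ∷ 0ℚ ∷ expand p

-- The implicit leading term X²ᵈ becomes the implicit Xᵈ, so monicity survives. For odd degree the
-- same function is applied after dropping the constant term, and then yields the odd part.
evens : ∀ d → MonicPoly (double d) → MonicPoly d
evens zero    []          = []
evens (suc d) (c ∷ _ ∷ p) = c ∷ evens d p

module EvaluationProperties (A : ℚ-Algebra) where
  open ℚ-Algebra A
  open Evaluation A public
  open Solver using (solve; _:+_; _:*_; _:-_; :-_; _:=_; con)
  open ≈-Reasoning

  evaluate-addConstant : ∀ {d} b (p : MonicPoly (suc d)) x →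
    evaluate (addConstant b p) x ≈ algebraMap b + evaluate p x
  evaluate-addConstant b (c ∷ p) x = trans (+-congʳ (+-homo b c)) (+-assoc _ _ _)

  evaluate-mulLinear : ∀ {d} a (p : MonicPoly d) x →
    evaluate (mulLinear a p) x ≈ (x + algebraMap a) * evaluate p x
  evaluate-mulLinear a []      x = begin
    algebraMap a + x * 1#    ≈⟨ +-comm _ _ ⟩
    x * 1# + algebraMap a    ≈⟨ +-congʳ (*-identityʳ x) ⟩
    x + algebraMap a         ≈⟨ *-identityʳ _ ⟨
    (x + algebraMap a) * 1#  ∎
  evaluate-mulLinear a (c ∷ p) x = begin
    algebraMap (a ℚ.* c) + x * evaluate (addConstant c (mulLinear a p)) x
      ≈⟨ +-cong (*-homo a c) (*-congˡ (trans (evaluate-addConstant c (mulLinear a p) x) (+-congˡ (evaluate-mulLinear a p x)))) ⟩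
    algebraMap a * algebraMap c + x * (algebraMap c + (x + algebraMap a) * evaluate p x)
      ≈⟨ solve 4 (λ a c x p → a :* c :+ x :* (c :+ (x :+ a) :* p) := (x :+ a) :* (c :+ x :* p))
           refl (algebraMap a) (algebraMap c) x (evaluate p x) ⟩
    (x + algebraMap a) * (algebraMap c + x * evaluate p x) ∎

  -- The relation between x and y is a hypothesis so that the lemma fits both uses: from 2 - g back
  -- to g for the lower bound, and from g to h² for the construction of a root polynomial.
  evaluate-reflect : ∀ {d} (p : MonicPoly d) x y → y ≈ 2minus A x →
    evaluate (reflect p) y ≈ algebraMap (sign d) * evaluate p x
  evaluate-reflect []      x y y≈2-x = sym (trans (*-identityʳ _) 1-homo)
  evaluate-reflect {suc d} (c ∷ p) x y y≈2-x = begin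
    evaluate (addConstant (sign (suc d) ℚ.* c) (mulLinear (ℚ.- ι 2) (reflect p))) y
      ≈⟨ evaluate-addConstant _ (mulLinear (ℚ.- ι 2) (reflect p)) y ⟩
    algebraMap (sign (suc d) ℚ.* c) + evaluate (mulLinear (ℚ.- ι 2) (reflect p)) y
      ≈⟨ +-cong (*-homo (sign (suc d)) c) (evaluate-mulLinear (ℚ.- ι 2) (reflect p) y) ⟩
    algebraMap (sign (suc d)) * algebraMap c + (y + algebraMap (ℚ.- ι 2)) * evaluate (reflect p) y
      ≈⟨ +-cong (*-congʳ (-‿homo (sign d))) (*-cong (+-congʳ y≈2-x) (evaluate-reflect p x y y≈2-x)) ⟩
    - s * algebraMap c + ((algebraMap (ι 2) - x) + algebraMap (ℚ.- ι 2)) * (s * evaluate p x)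
      ≈⟨ solve 4 (λ s c x p → :- s :* c :+ ((con (ι 2) :- x) :+ con (ℚ.- ι 2)) :* (s :* p) := :- s :* (c :+ x :* p))
           refl s (algebraMap c) x (evaluate p x) ⟩
    - s * (algebraMap c + x * evaluate p x)
      ≈⟨ *-congʳ (-‿homo (sign d)) ⟨
    algebraMap (sign (suc d)) * (algebraMap c + x * evaluate p x) ∎
    where s = algebraMap (sign d)

  evaluate-expand : ∀ {d} (p : MonicPoly d) x → evaluate (expand p) x ≈ evaluate p (x * x)
  evaluate-expand []      x = refl
  evaluate-expand (c ∷ p) x = +-congˡ (begin
    x * (algebraMap 0ℚ + x * evaluate (expand p) x)  ≈⟨ *-congˡ (+-congˡ (*-congˡ (evaluate-expand p x))) ⟩
    x * (algebraMap 0ℚ + x * evaluate p (x * x))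
      ≈⟨ solve 2 (λ x p → x :* (con 0ℚ :+ x :* p) := x :* x :* p) refl x (evaluate p (x * x)) ⟩
    x * x * evaluate p (x * x)                       ∎)

module _ (A : ℚ-Algebra) (t : ℚ-Algebra.Carrier A) where
  open ℚ-Algebra A
  open QuadraticExtension A t
  open Evaluation A
  open Evaluation algebra using () renaming (evaluate to evaluate√)

  private
    √t·₁ : ∀ a b → 0# * a + t * (1# * b) ≈ t * b
    √t·₁ a b = trans (+-cong (zeroˡ a) (*-congˡ (*-identityˡ b))) (+-identityˡ _)

    √t·₂ : ∀ a b → 0# * b + 1# * a ≈ a
    √t·₂ a b = trans (+-cong (zeroˡ b) (*-identityˡ a)) (+-identityˡ a)

  -- Multiplication by √t sends (a , b) to (t b , a). Two Horner steps therefore act on the first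
  -- coordinate as one Horner step at t, and the coefficient between them lands in the other
  -- coordinate.
  evaluate-√-even : ∀ d (p : MonicPoly (double d)) → proj₁ (evaluate√ p √t) ≈ evaluate (evens d p) t
  evaluate-√-even zero    []          = refl
  evaluate-√-even (suc d) (c ∷ b ∷ p) =
    +-congˡ (trans (√t·₁ _ _) (*-congˡ (trans (+-identityˡ _) (trans (√t·₂ _ _) (evaluate-√-even d p)))))

  evaluate-√-odd : ∀ d c (p : MonicPoly (double d)) → proj₂ (evaluate√ (c ∷ p) √t) ≈ evaluate (evens d p) t
  evaluate-√-odd d c p = trans (+-identityˡ _) (trans (√t·₂ _ _) (evaluate-√-even d p))

parity : ∀ n → (Σ[ d ∈ ℕ ] n ≡ double d) ⊎ (Σ[ d ∈ ℕ ] n ≡ suc (double d))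
parity zero    = inj₁ (0 , ≡.refl)
parity (suc n) =
  [ (λ { (d , ≡.refl) → inj₂ (d , ≡.refl) }) , (λ { (d , ≡.refl) → inj₁ (suc d , ≡.refl) }) ]′ (parity n)

DegreeAtLeast : (A : ℚ-Algebra) → ℚ-Algebra.Carrier A → ℕ → Set
DegreeAtLeast A x n = ∀ {d} (p : MonicPoly d) → Evaluation.evaluate A p x ≈ 0# → n ℕ.≤ d
  where open ℚ-Algebra A

module _ (A : ℚ-Algebra) where
  open ℚ-Algebra A

  module _ (g : Carrier) (n : ℕ) (g-degree : DegreeAtLeast A g n) where
    open EvaluationProperties A
    open QuadraticExtension A (2minus A g)
    open Solver using (solve; _:-_; _:=_)

    private
      t = 2minus A g

      degree-t : ∀ d (p : MonicPoly d) → evaluate p t ≈ 0# → 2 ℕ.* n ℕ.≤ double d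
      degree-t d p h = ≡.subst (2 ℕ.* n ℕ.≤_) (≡.sym (double≡2* d)) (ℕ.*-monoʳ-≤ 2 (g-degree (reflect p)
        (trans (evaluate-reflect p t g (solve 2 (λ o g → g := o :- (o :- g)) refl (algebraMap (ι 2)) g))
          (trans (*-congˡ h) (zeroʳ _)))))

      degree-even : ∀ d (p : MonicPoly (double d)) → proj₁ (Evaluation.evaluate algebra p √t) ≈ 0# → 2 ℕ.* n ℕ.≤ double d
      degree-even d p h = degree-t d (evens d p) (trans (sym (evaluate-√-even A t d p)) h)

      degree-odd : ∀ d (p : MonicPoly (suc (double d))) → proj₂ (Evaluation.evaluate algebra p √t) ≈ 0# → 2 ℕ.* n ℕ.≤ suc (double d)
      degree-odd d (c ∷ p) h = ℕ.m≤n⇒m≤1+n (degree-t d (evens d p) (trans (sym (evaluate-√-odd A t d c p)) h))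

    -- The even or the odd part of p is a monic polynomial in X², and vanishes at √t along with p.
    degree-√ : DegreeAtLeast algebra √t (2 ℕ.* n)
    degree-√ {m} p (e , o) =
      [ (λ { (d , ≡.refl) → degree-even d p e }) , (λ { (d , ≡.refl) → degree-odd d p o }) ]′ (parity m)

degree-γ : ∀ k → DegreeAtLeast (tower k) (γ k) (2 ^ k)
degree-γ zero    []      ()
degree-γ zero    (c ∷ p) _ = ℕ.s≤s ℕ.z≤n
degree-γ (suc k) p         = degree-√ (tower k) (γ k) (2 ^ k) (degree-γ k) p

-- All that the degree argument has to know about a real number. Each step admits either square
-- root, since h and -h are conjugate.
data RadicalChain (B : ℚ-Algebra) : ℕ → ℚ-Algebra.Carrier B → Set where
  base : ∀ {g} → let open ℚ-Algebra B in g ≈ algebraMap (ℚ.- 1ℚ) → RadicalChain B 0 g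
  step : ∀ {k g h} → let open ℚ-Algebra B in RadicalChain B k g → h * h ≈ 2minus B g → RadicalChain B (suc k) h

-- Embedding the tower along a chain of radicals

module Embeddings (B : ℚ-Algebra)
  (algebraMap-injective : ∀ q → ℚ-Algebra._≈_ B (ℚ-Algebra.algebraMap B q) (ℚ-Algebra.0# B) → q ≡ 0ℚ) where
  private module R = ℚ-Algebra B
  open EvaluationProperties B

  record Embedding (A : ℚ-Algebra) : Set where
    open ℚ-Algebra A
    field
      ⟦_⟧         : Carrier → R.Carrier
      ⟦⟧-cong     : ∀ {x y} → x ≈ y → ⟦ x ⟧ R.≈ ⟦ y ⟧
      ⟦⟧-+        : ∀ x y → ⟦ x + y ⟧ R.≈ ⟦ x ⟧ R.+ ⟦ y ⟧
      ⟦⟧-*        : ∀ x y → ⟦ x * y ⟧ R.≈ ⟦ x ⟧ R.* ⟦ y ⟧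
      ⟦⟧-neg      : ∀ x → ⟦ - x ⟧ R.≈ R.- ⟦ x ⟧
      ⟦⟧-constant : ∀ q → ⟦ algebraMap q ⟧ R.≈ R.algebraMap q
      injective   : ∀ x → ⟦ x ⟧ R.≈ R.0# → x ≈ 0#

    ⟦⟧-1 : ⟦ 1# ⟧ R.≈ R.1#
    ⟦⟧-1 = R.trans (⟦⟧-cong (sym 1-homo)) (R.trans (⟦⟧-constant 1ℚ) R.1-homo)

    ⟦⟧-0 : ⟦ 0# ⟧ R.≈ R.0#
    ⟦⟧-0 = R.trans (⟦⟧-cong (sym 0-homo)) (R.trans (⟦⟧-constant 0ℚ) R.0-homo)

    ⟦⟧-evaluate : ∀ {d} (p : MonicPoly d) x →
      ⟦ Evaluation.evaluate A p x ⟧ R.≈ Evaluation.evaluate B p ⟦ x ⟧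
    ⟦⟧-evaluate []      x = ⟦⟧-1
    ⟦⟧-evaluate (c ∷ p) x = R.trans (⟦⟧-+ _ _)
      (R.+-cong (⟦⟧-constant c) (R.trans (⟦⟧-* _ _) (R.*-congˡ (⟦⟧-evaluate p x))))

  ℚ-embedding : Embedding ℚ-algebra
  ℚ-embedding = record
    { ⟦_⟧         = R.algebraMap
    ; ⟦⟧-cong     = R.algebraMap-cong
    ; ⟦⟧-+        = R.+-homo
    ; ⟦⟧-*        = R.*-homo
    ; ⟦⟧-neg      = R.-‿homo
    ; ⟦⟧-constant = λ q → R.refl
    ; injective   = algebraMap-injective
    }

  module _ (A : ℚ-Algebra) (t : ℚ-Algebra.Carrier A) (t-nonsquare : Nonsquare A t) (φ : Embedding A) where
    open Embedding φ

    module _ (g : R.Carrier) (g²≈t : g R.* g R.≈ ⟦ t ⟧) where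
      open ℚ-Algebra A
      open QuadraticExtension A t
      open R.Solver using (solve; _:+_; _:*_; _:-_; :-_; _:=_; con)
      open R.≈-Reasoning

      private
        ⟦_⟧√ : ℚ-Algebra.Carrier algebra → R.Carrier
        ⟦ a , b ⟧√ = ⟦ a ⟧ R.+ g R.* ⟦ b ⟧

        √-+ : ∀ a b c d → ⟦ a + c , b + d ⟧√ R.≈ ⟦ a , b ⟧√ R.+ ⟦ c , d ⟧√
        √-+ a b c d = begin
          ⟦ a + c ⟧ R.+ g R.* ⟦ b + d ⟧
            ≈⟨ R.+-cong (⟦⟧-+ a c) (R.*-congˡ (⟦⟧-+ b d)) ⟩
          (⟦ a ⟧ R.+ ⟦ c ⟧) R.+ g R.* (⟦ b ⟧ R.+ ⟦ d ⟧)
            ≈⟨ solve 5 (λ g a b c d → (a :+ c) :+ g :* (b :+ d) := (a :+ g :* b) :+ (c :+ g :* d))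
                 R.refl g ⟦ a ⟧ ⟦ b ⟧ ⟦ c ⟧ ⟦ d ⟧ ⟩
          ⟦ a , b ⟧√ R.+ ⟦ c , d ⟧√ ∎

        √-* : ∀ a b c d → ⟦ a * c + t * (b * d) , a * d + b * c ⟧√ R.≈ ⟦ a , b ⟧√ R.* ⟦ c , d ⟧√
        √-* a b c d = begin
          ⟦ a * c + t * (b * d) ⟧ R.+ g R.* ⟦ a * d + b * c ⟧
            ≈⟨ R.+-cong
                 (R.trans (⟦⟧-+ _ _) (R.+-cong (⟦⟧-* a c)
                   (R.trans (⟦⟧-* t (b * d)) (R.*-cong (R.sym g²≈t) (⟦⟧-* b d)))))
                 (R.*-congˡ (R.trans (⟦⟧-+ _ _) (R.+-cong (⟦⟧-* a d) (⟦⟧-* b c)))) ⟩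
          (⟦ a ⟧ R.* ⟦ c ⟧ R.+ g R.* g R.* (⟦ b ⟧ R.* ⟦ d ⟧)) R.+ g R.* (⟦ a ⟧ R.* ⟦ d ⟧ R.+ ⟦ b ⟧ R.* ⟦ c ⟧)
            ≈⟨ solve 5 (λ g a b c d → (a :* c :+ g :* g :* (b :* d)) :+ g :* (a :* d :+ b :* c)
                                      := (a :+ g :* b) :* (c :+ g :* d))
                 R.refl g ⟦ a ⟧ ⟦ b ⟧ ⟦ c ⟧ ⟦ d ⟧ ⟩
          ⟦ a , b ⟧√ R.* ⟦ c , d ⟧√ ∎

        √-neg : ∀ a b → ⟦ - a , - b ⟧√ R.≈ R.- ⟦ a , b ⟧√
        √-neg a b = begin
          ⟦ - a ⟧ R.+ g R.* ⟦ - b ⟧            ≈⟨ R.+-cong (⟦⟧-neg a) (R.*-congˡ (⟦⟧-neg b)) ⟩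
          (R.- ⟦ a ⟧) R.+ g R.* (R.- ⟦ b ⟧)
            ≈⟨ solve 3 (λ g a b → :- a :+ g :* :- b := :- (a :+ g :* b)) R.refl g ⟦ a ⟧ ⟦ b ⟧ ⟩
          R.- ⟦ a , b ⟧√                          ∎

        √-constant : ∀ a → ⟦ a , 0# ⟧√ R.≈ ⟦ a ⟧
        √-constant a = begin
          ⟦ a ⟧ R.+ g R.* ⟦ 0# ⟧  ≈⟨ R.+-congˡ (R.trans (R.*-congˡ ⟦⟧-0) (R.zeroʳ g)) ⟩
          ⟦ a ⟧ R.+ R.0#           ≈⟨ R.+-identityʳ _ ⟩
          ⟦ a ⟧                    ∎

        -- The source of injectivity: an element sent to 0 has a norm sent to 0, the norm lives one
        -- level below where injectivity is known, and a norm vanishes at 0 alone.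
        ⟦norm⟧ : ∀ a b → ⟦ norm (a , b) ⟧ R.≈ ⟦ a , b ⟧√ R.* (⟦ a ⟧ R.- g R.* ⟦ b ⟧)
        ⟦norm⟧ a b = begin
          ⟦ a * a - t * (b * b) ⟧
            ≈⟨ R.trans (⟦⟧-+ _ _) (R.+-cong (⟦⟧-* a a) (R.trans (⟦⟧-neg _) (R.-‿cong
                 (R.trans (⟦⟧-* _ _) (R.*-cong (R.sym g²≈t) (⟦⟧-* b b)))))) ⟩
          ⟦ a ⟧ R.* ⟦ a ⟧ R.- g R.* g R.* (⟦ b ⟧ R.* ⟦ b ⟧)
            ≈⟨ solve 3 (λ g a b → a :* a :- g :* g :* (b :* b) := (a :+ g :* b) :* (a :- g :* b))
                 R.refl g ⟦ a ⟧ ⟦ b ⟧ ⟩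
          ⟦ a , b ⟧√ R.* (⟦ a ⟧ R.- g R.* ⟦ b ⟧) ∎

      √-embedding : Embedding algebra
      √-embedding = record
        { ⟦_⟧         = ⟦_⟧√
        ; ⟦⟧-cong     = λ (p , q) → R.+-cong (⟦⟧-cong p) (R.*-congˡ (⟦⟧-cong q))
        ; ⟦⟧-+        = λ (a , b) (c , d) → √-+ a b c d
        ; ⟦⟧-*        = λ (a , b) (c , d) → √-* a b c d
        ; ⟦⟧-neg      = λ (a , b) → √-neg a b
        ; ⟦⟧-constant = λ q → R.trans (√-constant (algebraMap q)) (⟦⟧-constant q)
        ; injective   = λ (a , b) h → norm≈0⇒≈0 A t t-nonsquare (a , b) (injective _
            (R.trans (⟦norm⟧ a b) (R.trans (R.*-congʳ h) (R.zeroˡ _))))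
        }

      √-embedding-√t : ⟦ √t ⟧√ R.≈ g
      √-embedding-√t = begin
        ⟦ 0# ⟧ R.+ g R.* ⟦ 1# ⟧  ≈⟨ R.+-cong ⟦⟧-0 (R.*-congˡ ⟦⟧-1) ⟩
        R.0# R.+ g R.* R.1#        ≈⟨ R.trans (R.+-identityˡ _) (R.*-identityʳ g) ⟩
        g                          ∎

  EmbeddingAt : (A : ℚ-Algebra) → ℚ-Algebra.Carrier A → R.Carrier → Set
  EmbeddingAt A x g = Σ[ φ ∈ Embedding A ] Embedding.⟦_⟧ φ x R.≈ g

  √-embeddingAt : ∀ A x → Nonsquare A (2minus A x) → ∀ {g h} → h R.* h R.≈ 2minus B g → EmbeddingAt A x g →
    EmbeddingAt (QuadraticExtension.algebra A (2minus A x)) (QuadraticExtension.√t A (2minus A x)) h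
  √-embeddingAt A x 2-x-nonsquare {g} {h} h²≈2-g (φ , x≈g) =
      √-embedding A (2minus A x) 2-x-nonsquare φ h h²≈2-x
    , √-embedding-√t A (2minus A x) 2-x-nonsquare φ h h²≈2-x
    where
    open ℚ-Algebra A
    open Embedding φ
    h²≈2-x : h R.* h R.≈ ⟦ 2minus A x ⟧
    h²≈2-x = R.trans h²≈2-g (R.sym (R.trans (⟦⟧-+ (algebraMap (ι 2)) (- x))
      (R.+-cong (⟦⟧-constant (ι 2)) (R.trans (⟦⟧-neg x) (R.-‿cong x≈g)))))

  tower-embedding : ∀ {k g} → RadicalChain B k g → EmbeddingAt (tower k) (γ k) g
  tower-embedding (base g≈-1)           = ℚ-embedding , R.sym g≈-1
  tower-embedding (step {k} chain h²≈2-g) =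
    √-embeddingAt (tower k) (γ k) (2-γ-nonsquare k) h²≈2-g (tower-embedding chain)

  chain-degree : ∀ {k g} → RadicalChain B k g → DegreeAtLeast B g (2 ^ k)
  chain-degree {k} chain p h =
    let (φ , γ≈g) = tower-embedding chain
        open Embedding φ
    in degree-γ k p (injective _ (R.trans (⟦⟧-evaluate p (γ k)) (R.trans (evaluate-cong p γ≈g) h)))

  -- X + 1 has the root -1, and if p(g) = 0 then p(2 - X²) vanishes at h. The sign built into
  -- `reflect` keeps this monic, and each step doubles the degree.
  chain-root : ∀ {k g} → RadicalChain B k g → Σ[ p ∈ MonicPoly (2 ^ k) ] evaluate p g R.≈ R.0#
  chain-root {g = g} (base g≈-1) = 1ℚ ∷ [] , (begin
    R.algebraMap 1ℚ R.+ g R.* R.1#                 ≈⟨ R.+-congˡ (R.trans (R.*-identityʳ g) g≈-1) ⟩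
    R.algebraMap 1ℚ R.+ R.algebraMap (ℚ.- 1ℚ)      ≈⟨ R.+-homo 1ℚ (ℚ.- 1ℚ) ⟨
    R.algebraMap 0ℚ                                ≈⟨ R.0-homo ⟩
    R.0#                                           ∎)
    where open R.≈-Reasoning
  chain-root (step {k} {g} {h} chain h²≈2-g) =
    let (p , p-root) = chain-root chain
    in ≡.subst (λ d → Σ[ p ∈ MonicPoly d ] evaluate p h R.≈ R.0#) (double≡2* (2 ^ k))
         (expand (reflect p) , (begin
           evaluate (expand (reflect p)) h               ≈⟨ evaluate-expand (reflect p) h ⟩
           evaluate (reflect p) (h R.* h)                ≈⟨ evaluate-reflect p g (h R.* h) h²≈2-g ⟩
           R.algebraMap (sign (2 ^ k)) R.* evaluate p g       ≈⟨ R.*-congˡ p-root ⟩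
           R.algebraMap (sign (2 ^ k)) R.* R.0#               ≈⟨ R.zeroʳ _ ⟩
           R.0#                                          ∎))
    where open R.≈-Reasoning

fromℚ-injective : ∀ q → fromℚ q ≈ᵣ fromℚ 0ℚ → q ≡ 0ℚ
fromℚ-injective q (≃⇒≈ q≃0) with q ℚ.≟ 0ℚ
... | yes q≡0 = q≡0
... | no  q≢0 =
  let (N , h) = q≃0 ℚ.∣ q ∣ (ℚ.≰⇒> λ ∣q∣≤0 → q≢0 (ℚ.∣p∣≡0⇒p≡0 q (ℚ.≤-antisym ∣q∣≤0 (ℚ.0≤∣p∣ q))))
  in contradiction (h N ℕ.≤-refl) (ℚ.<-irrefl (≡.cong ℚ.∣_∣ (ℚ.+-identityʳ q)))

open Embeddings ℝ-algebra fromℚ-injective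
open EvaluationProperties ℝ-algebra

-- The ring operations on ℝ are opaque, so the polynomial value of the statement has to be matched
-- with that of the algebra term by term.
eval≈evaluate : ∀ {d} (p : MonicPoly d) x → eval p x ≈ᵣ evaluate p x
eval≈evaluate p x = ≡⇒≈ᵣ (pointwise p)
  where
  pointwise : ∀ {d} (p : MonicPoly d) n → seq (eval p x) n ≡ seq (evaluate p x) n
  pointwise []      n = ≡.refl
  pointwise (c ∷ p) n = ≡.trans (≡.cong (λ y → c ℚ.+ seq x n ℚ.* y) (pointwise p n))
    (≡.sym (≡.trans (seq-⊕ (fromℚ c) (x ⊗ evaluate p x) n) (≡.cong (c ℚ.+_) (seq-⊗ x (evaluate p x) n))))

chain⇒HasDegree : ∀ {k g} → RadicalChain ℝ-algebra k g → HasDegree g (2 ^ k)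
chain⇒HasDegree {k} {g} chain = let (p , p-root) = chain-root chain in
    p
  , ≈⇒≃ (R.trans (eval≈evaluate p g) p-root)
  , λ q q-root → chain-degree chain q (R.trans (R.sym (eval≈evaluate q g)) (≃⇒≈ q-root))
  where module R = ℚ-Algebra ℝ-algebra

-- The product formula for the cosine

module _ where
  open import Data.Rational.Base using (_+_; _*_; _-_; -_)
  open ℚ.+-*-Solver using (solve; _:+_; _:*_; _:-_; :-_; _:=_; con)
  open ≡.≡-Reasoning
  open ≡ using (refl; sym; trans; cong; cong₂; subst)

  -- The Cauchy product, by recursion that shifts f, which avoids the index n - i.
  convolution : (ℕ → ℚ) → (ℕ → ℚ) → ℕ → ℚ
  convolution f g zero    = f 0 * g 0
  convolution f g (suc n) = f 0 * g (suc n) + convolution (λ i → f (suc i)) g n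

  convolution-cong : ∀ {f f′ g g′} → (∀ i → f i ≡ f′ i) → (∀ i → g i ≡ g′ i) →
    ∀ n → convolution f g n ≡ convolution f′ g′ n
  convolution-cong f≗ g≗ zero    = cong₂ _*_ (f≗ 0) (g≗ 0)
  convolution-cong f≗ g≗ (suc n) =
    cong₂ _+_ (cong₂ _*_ (f≗ 0) (g≗ (suc n))) (convolution-cong (λ i → f≗ (suc i)) g≗ n)

  convolution-+ˡ : ∀ f f′ g n → convolution (λ i → f i + f′ i) g n ≡ convolution f g n + convolution f′ g n
  convolution-+ˡ f f′ g zero    = ℚ.*-distribʳ-+ (g 0) (f 0) (f′ 0)
  convolution-+ˡ f f′ g (suc n) = trans
    (cong (λ z → (f 0 + f′ 0) * g (suc n) + z) (convolution-+ˡ (λ i → f (suc i)) (λ i → f′ (suc i)) g n))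
    (solve 5 (λ a b c x y → (a :+ b) :* c :+ (x :+ y) := (a :* c :+ x) :+ (b :* c :+ y)) refl
      (f 0) (f′ 0) (g (suc n)) (convolution (λ i → f (suc i)) g n) (convolution (λ i → f′ (suc i)) g n))

  convolution-+ʳ : ∀ f g g′ n → convolution f (λ i → g i + g′ i) n ≡ convolution f g n + convolution f g′ n
  convolution-+ʳ f g g′ zero    = ℚ.*-distribˡ-+ (f 0) (g 0) (g′ 0)
  convolution-+ʳ f g g′ (suc n) = trans
    (cong (λ z → f 0 * (g (suc n) + g′ (suc n)) + z) (convolution-+ʳ (λ i → f (suc i)) g g′ n))
    (solve 5 (λ a b c x y → a :* (b :+ c) :+ (x :+ y) := (a :* b :+ x) :+ (a :* c :+ y)) refl
      (f 0) (g (suc n)) (g′ (suc n)) (convolution (λ i → f (suc i)) g n) (convolution (λ i → f (suc i)) g′ n))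

  convolution-*ˡ : ∀ c f g n → convolution (λ i → c * f i) g n ≡ c * convolution f g n
  convolution-*ˡ c f g zero    = ℚ.*-assoc c (f 0) (g 0)
  convolution-*ˡ c f g (suc n) = trans
    (cong (λ z → c * f 0 * g (suc n) + z) (convolution-*ˡ c (λ i → f (suc i)) g n))
    (solve 4 (λ c a b x → c :* a :* b :+ c :* x := c :* (a :* b :+ x)) refl
      c (f 0) (g (suc n)) (convolution (λ i → f (suc i)) g n))

  convolution-*ʳ : ∀ c f g n → convolution f (λ i → c * g i) n ≡ c * convolution f g n
  convolution-*ʳ c f g zero    = solve 3 (λ c a b → a :* (c :* b) := c :* (a :* b)) refl c (f 0) (g 0)
  convolution-*ʳ c f g (suc n) = trans
    (cong (λ z → f 0 * (c * g (suc n)) + z) (convolution-*ʳ c (λ i → f (suc i)) g n))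
    (solve 4 (λ c a b x → a :* (c :* b) :+ c :* x := c :* (a :* b :+ x)) refl
      c (f 0) (g (suc n)) (convolution (λ i → f (suc i)) g n))

  -- Sequences stand for the coefficients of power series.
  derivative : (ℕ → ℚ) → ℕ → ℚ
  derivative f n = ι (suc n) * f (suc n)

  ι-suc-* : ∀ n x → ι (suc n) * x ≡ ι n * x + x
  ι-suc-* n x = trans (cong (_* x) (ι-suc n))
    (solve 2 (λ i x → (con 1ℚ :+ i) :* x := i :* x :+ x) refl (ι n) x)

  -- Differentiating the shifted f yields (i + 1) f(i + 2), one copy of f(i + 2) short of the
  -- shifted derivative. Writing n + 2 as (n + 1) + 1 in front of the tail supplies that copy.
  product-rule : ∀ f g n →
    derivative (convolution f g) n ≡ convolution (derivative f) g n + convolution f (derivative g) n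
  product-rule f g zero =
    solve 4 (λ a b c d → con 1ℚ :* (a :* b :+ c :* d) := (con 1ℚ :* c) :* d :+ a :* (con 1ℚ :* b)) refl
      (f 0) (g 1) (f 1) (g 0)
  product-rule f g (suc n) = begin
    ι (suc (suc n)) * (f 0 * g (suc (suc n)) + (f 1 * g (suc n) + convolution f″ g n))
      ≡⟨ trans (ℚ.*-distribˡ-+ (ι (suc (suc n))) (f 0 * g (suc (suc n))) (convolution f′ g (suc n))) (cong (λ z → ι (suc (suc n)) * (f 0 * g (suc (suc n))) + z) (ι-suc-* (suc n) (convolution f′ g (suc n)))) ⟩
    ι (suc (suc n)) * (f 0 * g (suc (suc n))) + (derivative (convolution f′ g) n + (f 1 * g (suc n) + convolution f″ g n))
      ≡⟨ cong (λ z → ι (suc (suc n)) * (f 0 * g (suc (suc n))) + (z + (f 1 * g (suc n) + convolution f″ g n))) (product-rule f′ g n) ⟩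
    ι (suc (suc n)) * (f 0 * g (suc (suc n))) +
      ((convolution (derivative f′) g n + convolution f′ (derivative g) n) + (f 1 * g (suc n) + convolution f″ g n))
      ≡⟨ solve 8 (λ i a b x y c d z → i :* (a :* b) :+ ((x :+ y) :+ (c :* d :+ z)) :=
                     (con 1ℚ :* c :* d :+ (x :+ z)) :+ (a :* (i :* b) :+ y)) refl
           (ι (suc (suc n))) (f 0) (g (suc (suc n))) (convolution (derivative f′) g n)
           (convolution f′ (derivative g) n) (f 1) (g (suc n)) (convolution f″ g n) ⟩
    (1ℚ * f 1 * g (suc n) + (convolution (derivative f′) g n + convolution f″ g n)) +
      (f 0 * (ι (suc (suc n)) * g (suc (suc n))) + convolution f′ (derivative g) n)
      ≡⟨ cong (λ z → (1ℚ * f 1 * g (suc n) + z) + (f 0 * derivative g (suc n) + convolution f′ (derivative g) n)) (begin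
           convolution (derivative f′) g n + convolution f″ g n   ≡⟨ convolution-+ˡ (derivative f′) f″ g n ⟨
           convolution (λ i → derivative f′ i + f″ i) g n         ≡⟨ convolution-cong (λ i → ι-suc-* (suc i) (f″ i)) (λ _ → refl) n ⟨
           convolution (λ i → derivative f (suc i)) g n           ∎) ⟩
    convolution (derivative f) g (suc n) + convolution f (derivative g) (suc n) ∎
    where
    f′ f″ : ℕ → ℚ
    f′ i = f (suc i)
    f″ i = f (suc (suc i))

  -- The coefficients of exp (x T); the cosine formula is drawn from exp ((x + y) T) = exp (x T) exp
  -- (y T).
  dividedPower : ℚ → ℕ → ℚ
  dividedPower x n = x ^ℚ n * 1/fact n

  1/fact*fact : ∀ n → 1/fact n * ι (n !) ≡ 1ℚ
  1/fact*fact n = 1/m*m≡1 (n !) {{n ℕ.!≢0}}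

  ι*1/fact : ∀ n → ι (suc n) * 1/fact (suc n) ≡ 1/fact n
  ι*1/fact n = begin
    ι (suc n) * a                        ≡⟨ ℚ.*-identityʳ _ ⟨
    ι (suc n) * a * 1ℚ                   ≡⟨ cong (ι (suc n) * a *_) (1/fact*fact n) ⟨
    ι (suc n) * a * (b * ι (n !))        ≡⟨ solve 4 (λ i a b f → i :* a :* (b :* f) := a :* (i :* f) :* b) refl
                                              (ι (suc n)) a b (ι (n !)) ⟩
    a * (ι (suc n) * ι (n !)) * b        ≡⟨ cong (λ z → a * z * b) (ι-* (suc n) (n !)) ⟩
    a * ι (suc n !) * b                  ≡⟨ cong (_* b) (1/fact*fact (suc n)) ⟩
    1ℚ * b                               ≡⟨ ℚ.*-identityˡ b ⟩
    b                                    ∎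
    where
    a = 1/fact (suc n)
    b = 1/fact n

  derivative-dividedPower : ∀ x n → derivative (dividedPower x) n ≡ x * dividedPower x n
  derivative-dividedPower x n = trans
    (solve 4 (λ i x p f → i :* (x :* p :* f) := x :* (p :* (i :* f))) refl (ι (suc n)) x (x ^ℚ n) (1/fact (suc n)))
    (cong (λ z → x * (x ^ℚ n * z)) (ι*1/fact n))

  -- The equation f′ = c f is a recursion (n + 1) f(n + 1) = c f(n) for the coefficients. Uniqueness
  -- of its solution stands in for the binomial theorem.
  derivative-unique : ∀ c f g → f 0 ≡ g 0 → (∀ n → derivative f n ≡ c * f n) → (∀ n → derivative g n ≡ c * g n) →
    ∀ n → f n ≡ g n
  derivative-unique c f g f₀≡g₀ f′ g′ zero    = f₀≡g₀
  derivative-unique c f g f₀≡g₀ f′ g′ (suc n) = begin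
    f (suc n)                                    ≡⟨ cancel (f (suc n)) ⟨
    1/suc * derivative f n                       ≡⟨ cong (1/suc *_) (f′ n) ⟩
    1/suc * (c * f n)                            ≡⟨ cong (λ z → 1/suc * (c * z)) (derivative-unique c f g f₀≡g₀ f′ g′ n) ⟩
    1/suc * (c * g n)                            ≡⟨ cong (1/suc *_) (g′ n) ⟨
    1/suc * derivative g n                       ≡⟨ cancel (g (suc n)) ⟩
    g (suc n)                                    ∎
    where
    1/suc = unit n
    cancel : ∀ x → 1/suc * (ι (suc n) * x) ≡ x
    cancel x = trans (sym (ℚ.*-assoc 1/suc (ι (suc n)) x)) (trans (cong (_* x) (unit*ι n)) (ℚ.*-identityˡ x))

  -- Both sides are the coefficients of a power series f with f′ = (x + y) f and f(0) = 1.
  dividedPower-+ : ∀ x y n → convolution (dividedPower x) (dividedPower y) n ≡ dividedPower (x + y) n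
  dividedPower-+ x y = derivative-unique (x + y) (convolution ex ey) (dividedPower (x + y)) refl
    (λ n → begin
      derivative (convolution ex ey) n
        ≡⟨ product-rule ex ey n ⟩
      convolution (derivative ex) ey n + convolution ex (derivative ey) n
        ≡⟨ cong₂ _+_ (trans (convolution-cong (derivative-dividedPower x) (λ _ → refl) n) (convolution-*ˡ x ex ey n))
                     (trans (convolution-cong (λ _ → refl) (derivative-dividedPower y) n) (convolution-*ʳ y ex ey n)) ⟩
      x * convolution ex ey n + y * convolution ex ey n
        ≡⟨ ℚ.*-distribʳ-+ (convolution ex ey n) x y ⟨
      (x + y) * convolution ex ey n ∎)
    (derivative-dividedPower (x + y))
    where
    ex = dividedPower x
    ey = dividedPower y

  -- If i + j is even and j is even, then so is i: it suffices that g has no odd coefficients.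
  convolution-even : ∀ f g → (∀ j → g (suc (double j)) ≡ 0ℚ) →
    ∀ k → convolution f g (double k) ≡ convolution (λ i → f (double i)) (λ j → g (double j)) k
  convolution-even f g g-odd zero    = refl
  convolution-even f g g-odd (suc k) = cong (λ z → f 0 * g (double (suc k)) + z) (begin
    f 1 * g (suc (double k)) + convolution f″ g (double k)
      ≡⟨ cong₂ _+_ (trans (cong (f 1 *_) (g-odd k)) (ℚ.*-zeroʳ (f 1))) (convolution-even f″ g g-odd k) ⟩
    0ℚ + convolution (λ i → f″ (double i)) (λ j → g (double j)) k
      ≡⟨ ℚ.+-identityˡ _ ⟩
    convolution (λ i → f″ (double i)) (λ j → g (double j)) k ∎)
    where
    f″ : ℕ → ℚ
    f″ i = f (suc (suc i))

  convolution-alternating : ∀ f g k →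
    convolution (λ i → (- 1ℚ) ^ℚ i * f i) (λ j → (- 1ℚ) ^ℚ j * g j) k ≡ (- 1ℚ) ^ℚ k * convolution f g k
  convolution-alternating f g zero    =
    solve 2 (λ a b → (con 1ℚ :* a) :* (con 1ℚ :* b) := con 1ℚ :* (a :* b)) refl (f 0) (g 0)
  convolution-alternating f g (suc k) = begin
    1ℚ * f 0 * (s′ * g (suc k)) + convolution (λ i → (- 1ℚ) ^ℚ suc i * f′ i) (λ j → (- 1ℚ) ^ℚ j * g j) k
      ≡⟨ cong (λ z → 1ℚ * f 0 * (s′ * g (suc k)) + z) (begin
           convolution (λ i → (- 1ℚ) ^ℚ suc i * f′ i) σg k       ≡⟨ convolution-cong (λ i → ℚ.*-assoc (- 1ℚ) ((- 1ℚ) ^ℚ i) (f′ i)) (λ _ → refl) k ⟩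
           convolution (λ i → - 1ℚ * ((- 1ℚ) ^ℚ i * f′ i)) σg k  ≡⟨ convolution-*ˡ (- 1ℚ) (λ i → (- 1ℚ) ^ℚ i * f′ i) σg k ⟩
           - 1ℚ * convolution (λ i → (- 1ℚ) ^ℚ i * f′ i) σg k    ≡⟨ cong (- 1ℚ *_) (convolution-alternating f′ g k) ⟩
           - 1ℚ * (s * convolution f′ g k)                      ∎) ⟩
    1ℚ * f 0 * (s′ * g (suc k)) + - 1ℚ * (s * convolution f′ g k)
      ≡⟨ solve 4 (λ s a b x → con 1ℚ :* a :* (con (- 1ℚ) :* s :* b) :+ con (- 1ℚ) :* (s :* x)
                              := con (- 1ℚ) :* s :* (a :* b :+ x)) refl s (f 0) (g (suc k)) (convolution f′ g k) ⟩
    s′ * (f 0 * g (suc k) + convolution f′ g k) ∎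
    where
    s = (- 1ℚ) ^ℚ k
    s′ = (- 1ℚ) ^ℚ suc k
    σg f′ : ℕ → ℚ
    σg j = (- 1ℚ) ^ℚ j * g j
    f′ i = f (suc i)

  neg^-even : ∀ y j → (- y) ^ℚ double j ≡ y ^ℚ double j
  neg^-even y zero    = refl
  neg^-even y (suc j) = trans (cong (λ z → - y * (- y * z)) (neg^-even y j))
    (solve 2 (λ y z → :- y :* (:- y :* z) := y :* (y :* z)) refl y (y ^ℚ double j))

  cosTerm≡ : ∀ q k → cosTerm q k ≡ (- 1ℚ) ^ℚ k * dividedPower q (double k)
  cosTerm≡ q k = trans (ℚ.*-assoc ((- 1ℚ) ^ℚ k) _ _)
    (cong (λ m → (- 1ℚ) ^ℚ k * dividedPower q m) (sym (double≡2* k)))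

  -- exp (y T) + exp (- y T) has no odd coefficients and twice the even ones of exp (y T).
  -- Multiplied by exp (x T) it gives, in even degrees, the formula for cosh; the signs (-1)ᵏ turn
  -- it into the one for cos.
  cosTerm-product : ∀ x y k →
    cosTerm (x + y) k + cosTerm (x - y) k ≡ ι 2 * convolution (cosTerm x) (cosTerm y) k
  cosTerm-product x y k = begin
    cosTerm (x + y) k + cosTerm (x - y) k
      ≡⟨ cong₂ _+_ (cosTerm≡ (x + y) k) (cosTerm≡ (x - y) k) ⟩
    s * dividedPower (x + y) (double k) + s * dividedPower (x - y) (double k)
      ≡⟨ ℚ.*-distribˡ-+ s _ _ ⟨
    s * (dividedPower (x + y) (double k) + dividedPower (x - y) (double k))
      ≡⟨ cong (s *_) (begin
           dividedPower (x + y) (double k) + dividedPower (x - y) (double k)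
             ≡⟨ cong₂ _+_ (dividedPower-+ x y (double k)) (dividedPower-+ x (- y) (double k)) ⟨
           convolution ex (dividedPower y) (double k) + convolution ex (dividedPower (- y)) (double k)
             ≡⟨ convolution-+ʳ ex (dividedPower y) (dividedPower (- y)) (double k) ⟨
           convolution ex g (double k)
             ≡⟨ convolution-even ex g g-odd k ⟩
           convolution (λ i → ex (double i)) (λ j → g (double j)) k
             ≡⟨ convolution-cong (λ _ → refl) g-even k ⟩
           convolution (λ i → ex (double i)) (λ j → ι 2 * dividedPower y (double j)) k
             ≡⟨ convolution-*ʳ (ι 2) _ _ k ⟩
           ι 2 * P ∎) ⟩
    s * (ι 2 * P)
      ≡⟨ solve 2 (λ s p → s :* (con (ι 2) :* p) := con (ι 2) :* (s :* p)) refl s P ⟩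
    ι 2 * (s * P)
      ≡⟨ cong (ι 2 *_) (trans (convolution-cong (cosTerm≡ x) (cosTerm≡ y) k) (convolution-alternating _ _ k)) ⟨
    ι 2 * convolution (cosTerm x) (cosTerm y) k ∎
    where
    s = (- 1ℚ) ^ℚ k
    ex = dividedPower x
    P = convolution (λ i → ex (double i)) (λ j → dividedPower y (double j)) k
    g : ℕ → ℚ
    g j = dividedPower y j + dividedPower (- y) j
    g-even : ∀ j → g (double j) ≡ ι 2 * dividedPower y (double j)
    g-even j = trans (cong (λ z → dividedPower y (double j) + z * 1/fact (double j)) (neg^-even y j))
      (solve 1 (λ a → a :+ a := con (ι 2) :* a) refl (dividedPower y (double j)))
    g-odd : ∀ j → g (suc (double j)) ≡ 0ℚ
    g-odd j = trans (cong (λ z → dividedPower y (suc (double j)) + - y * z * 1/fact (suc (double j))) (neg^-even y j))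
      (solve 3 (λ y p f → y :* p :* f :+ :- y :* p :* f := con 0ℚ) refl y (y ^ℚ double j) (1/fact (suc (double j))))

-- Convergence of the Cauchy product

module _ where
  open ≡ using (refl; sym; trans; cong)

  suc-n≤2^n : ∀ n → suc n ℕ.≤ 2 ^ n
  suc-n≤2^n zero    = ℕ.≤-refl
  suc-n≤2^n (suc n) = ℕ.≤-trans (ℕ.+-monoʳ-≤ 1 (suc-n≤2^n n))
    (ℕ.+-mono-≤ (ℕ.≤-trans (ℕ.s≤s ℕ.z≤n) (suc-n≤2^n n)) (ℕ.≤-reflexive (sym (ℕ.+-identityʳ (2 ^ n)))))

  -- Makes n / 2ⁿ at most 2 / (n + 1). In the induction the left side grows by 2 (n + 1), the right
  -- side by 2 · 2ⁿ.
  suc-n*n≤2*2^n : ∀ n → suc n ℕ.* n ℕ.≤ 2 ℕ.* 2 ^ n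
  suc-n*n≤2*2^n zero    = ℕ.z≤n
  suc-n*n≤2*2^n (suc n) = ℕ.≤-trans (ℕ.≤-reflexive eq)
    (ℕ.≤-trans (ℕ.+-mono-≤ (suc-n*n≤2*2^n n) (ℕ.*-monoʳ-≤ 2 (suc-n≤2^n n)))
      (ℕ.≤-reflexive (trans (sym (ℕ.*-distribˡ-+ 2 (2 ^ n) (2 ^ n))) (cong (λ z → 2 ℕ.* (2 ^ n ℕ.+ z)) (sym (ℕ.+-identityʳ (2 ^ n)))))))
    where
    open ℕ.+-*-Solver using (solve; _:+_; _:*_; _:=_; con)
    eq : suc (suc n) ℕ.* suc n ≡ suc n ℕ.* n ℕ.+ 2 ℕ.* suc n
    eq = solve 1 (λ n → (con 2 :+ n) :* (con 1 :+ n) := (con 1 :+ n) :* n :+ con 2 :* (con 1 :+ n)) refl n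

module _ where
  open import Data.Rational.Base using (_+_; _*_; _-_; -_; ∣_∣; _≤_; _<_; nonNegative)
  open ℚ.+-*-Solver using (solve; _:+_; _:*_; _:-_; :-_; _:=_; con)
  open ℚ.≤-Reasoning
  open ≡ using (refl; sym; trans; cong; cong₂; subst)

  partialSum : (ℕ → ℚ) → ℕ → ℚ
  partialSum f zero    = 0ℚ
  partialSum f (suc n) = partialSum f n + f n

  partialSum-suc : ∀ f n → partialSum f (suc n) ≡ f 0 + partialSum (λ i → f (suc i)) n
  partialSum-suc f zero    = ℚ.+-comm 0ℚ (f 0)
  partialSum-suc f (suc n) = trans (cong (_+ f (suc n)) (partialSum-suc f n)) (ℚ.+-assoc (f 0) _ (f (suc n)))

  -- The triangle i + j ≤ n is cut into its row i = 0 and the smaller triangle that belongs to the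
  -- shifted f.
  partialSum-convolution-suc : ∀ f g n → partialSum (convolution f g) (suc n) ≡
    f 0 * partialSum g (suc n) + partialSum (convolution (λ i → f (suc i)) g) n
  partialSum-convolution-suc f g zero    =
    solve 2 (λ a b → con 0ℚ :+ a :* b := a :* (con 0ℚ :+ b) :+ con 0ℚ) refl (f 0) (g 0)
  partialSum-convolution-suc f g (suc n) = trans
    (cong (_+ convolution f g (suc n)) (partialSum-convolution-suc f g n))
    (solve 5 (λ a x y b z → (a :* x :+ y) :+ (a :* b :+ z) := a :* (x :+ b) :+ (y :+ z)) refl
      (f 0) (partialSum g (suc n)) (partialSum (convolution (λ i → f (suc i)) g) n) (g (suc n))
      (convolution (λ i → f (suc i)) g n))

  cosPartial≡partialSum : ∀ n q → cosPartial n q ≡ partialSum (cosTerm q) n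
  cosPartial≡partialSum zero    q = refl
  cosPartial≡partialSum (suc n) q = cong (_+ cosTerm q n) (cosPartial≡partialSum n q)

  partialSum-cosTerm-product : ∀ x y n →
    cosPartial n (x + y) + cosPartial n (x - y) ≡ ι 2 * partialSum (convolution (cosTerm x) (cosTerm y)) n
  partialSum-cosTerm-product x y zero    = refl
  partialSum-cosTerm-product x y (suc n) = trans
    (solve 4 (λ a b c d → (a :+ b) :+ (c :+ d) := (a :+ c) :+ (b :+ d)) refl
      (cosPartial n (x + y)) (cosTerm (x + y) n) (cosPartial n (x - y)) (cosTerm (x - y) n))
    (trans (cong₂ _+_ (partialSum-cosTerm-product x y n) (cosTerm-product x y n))
      (sym (ℚ.*-distribˡ-+ (ι 2) (partialSum (convolution (cosTerm x) (cosTerm y)) n) (convolution (cosTerm x) (cosTerm y) n))))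

  Geometric : ℚ → (ℕ → ℚ) → Set
  Geometric A f = ∀ i → ∣ f i ∣ ≤ A * ½ ^ℚ i

  0≤½^ : ∀ n → 0ℚ ≤ ½ ^ℚ n
  0≤½^ = 0≤^ (ℚ.nonNegative⁻¹ ½)

  -- The second summand on the left is the part of the geometric budget not yet spent. One more term
  -- costs at most A ½ⁱ⁺ᵖ, exactly the amount by which the budget halves.
  geometric-tail : ∀ A f → Geometric A f → ∀ i p →
    ∣ partialSum f (i ℕ.+ p) - partialSum f p ∣ + ι 2 * A * ½ ^ℚ (i ℕ.+ p) ≤ ι 2 * A * ½ ^ℚ p
  geometric-tail A f f-geom zero    p = ℚ.≤-reflexive
    (trans (cong (_+ ι 2 * A * ½ ^ℚ p) (∣p-p∣≡0 (partialSum f p))) (ℚ.+-identityˡ _))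
  geometric-tail A f f-geom (suc i) p = begin
    ∣ (S + t) - S₀ ∣ + ι 2 * A * (½ * r)
      ≡⟨ cong₂ (λ x y → ∣ x ∣ + y) (solve 3 (λ s t z → (s :+ t) :- z := (s :- z) :+ t) refl S t S₀)
           (solve 2 (λ a r → con (ι 2) :* a :* (con ½ :* r) := a :* r) refl A r) ⟩
    ∣ (S - S₀) + t ∣ + A * r              ≤⟨ ℚ.+-monoˡ-≤ (A * r) (ℚ.≤-trans (ℚ.∣p+q∣≤∣p∣+∣q∣ (S - S₀) t)
                                               (ℚ.+-monoʳ-≤ ∣ S - S₀ ∣ (f-geom (i ℕ.+ p)))) ⟩
    (∣ S - S₀ ∣ + A * r) + A * r          ≡⟨ solve 3 (λ d a r → (d :+ a :* r) :+ a :* r := d :+ con (ι 2) :* a :* r) refl ∣ S - S₀ ∣ A r ⟩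
    ∣ S - S₀ ∣ + ι 2 * A * r              ≤⟨ geometric-tail A f f-geom i p ⟩
    ι 2 * A * ½ ^ℚ p                       ∎
    where
    S = partialSum f (i ℕ.+ p)
    t = f (i ℕ.+ p)
    S₀ = partialSum f p
    r = ½ ^ℚ (i ℕ.+ p)

  geometric-close : ∀ {A} f → 0ℚ ≤ A → Geometric A f → ∀ {p n} → p ℕ.≤ n →
    ∣ partialSum f n - partialSum f p ∣ ≤ ι 2 * A * ½ ^ℚ p
  geometric-close {A} f 0≤A f-geom {p} {n} p≤n = begin
    d                        ≡⟨ ℚ.+-identityʳ d ⟨
    d + 0ℚ                   ≤⟨ ℚ.+-monoʳ-≤ d (0≤* (0≤* (0≤ι 2) 0≤A) (0≤½^ n)) ⟩
    d + ι 2 * A * ½ ^ℚ n      ≤⟨ subst (λ m → ∣ partialSum f m - partialSum f p ∣ + ι 2 * A * ½ ^ℚ m ≤ ι 2 * A * ½ ^ℚ p)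
                                  (ℕ.m∸n+n≡m p≤n) (geometric-tail A f f-geom (n ℕ.∸ p) p) ⟩
    ι 2 * A * ½ ^ℚ p          ∎
    where d = ∣ partialSum f n - partialSum f p ∣

  -- Row i of the triangle misses f i times a tail of g, which is at most A ½ⁱ · B ½ⁿ⁻ⁱ, and there
  -- are n rows. N stays fixed while n descends; shifting f halves A, which makes up for the lower
  -- exponent.
  convolution-error : ∀ A B f g N → 0ℚ ≤ B → Geometric A f →
    (∀ {p} → p ℕ.≤ N → ∣ partialSum g N - partialSum g p ∣ ≤ B * ½ ^ℚ p) → ∀ n → n ℕ.≤ N →
    ∣ partialSum f n * partialSum g N - partialSum (convolution f g) n ∣ ≤ ι n * (A * B * ½ ^ℚ n)
  convolution-error A B f g N 0≤B f-geom g-close zero    n≤N = ℚ.≤-reflexive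
    (trans (cong ∣_∣ (solve 1 (λ x → con 0ℚ :* x :- con 0ℚ := con 0ℚ) refl (partialSum g N)))
      (sym (ℚ.*-zeroˡ (A * B * ½ ^ℚ 0))))
  convolution-error A B f g N 0≤B f-geom g-close (suc n) n<N = begin
    ∣ partialSum f (suc n) * U - partialSum (convolution f g) (suc n) ∣
      ≡⟨ cong ∣_∣ (trans (cong₂ (λ x y → x * U - y) (partialSum-suc f n) (partialSum-convolution-suc f g n))
           (solve 5 (λ a t u v s → (a :+ t) :* u :- (a :* v :+ s) := a :* (u :- v) :+ (t :* u :- s)) refl
             (f 0) (partialSum f′ n) U V S)) ⟩
    ∣ f 0 * (U - V) + (partialSum f′ n * U - S) ∣
      ≤⟨ ℚ.∣p+q∣≤∣p∣+∣q∣ (f 0 * (U - V)) _ ⟩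
    ∣ f 0 * (U - V) ∣ + ∣ partialSum f′ n * U - S ∣
      ≤⟨ ℚ.+-mono-≤ first (convolution-error (A * ½) B f′ g N 0≤B f′-geom g-close n
           (ℕ.≤-trans (ℕ.n≤1+n n) n<N)) ⟩
    A * (B * (½ * r)) + ι n * (A * ½ * B * r)
      ≡⟨ solve 4 (λ a b r i → a :* (b :* (con ½ :* r)) :+ i :* (a :* con ½ :* b :* r) := (con 1ℚ :+ i) :* (a :* b :* (con ½ :* r)))
           refl A B r (ι n) ⟩
    (1ℚ + ι n) * (A * B * (½ * r))
      ≡⟨ cong (_* (A * B * (½ * r))) (ι-suc n) ⟨
    ι (suc n) * (A * B * (½ * r)) ∎
    where
    r = ½ ^ℚ n
    U = partialSum g N
    V = partialSum g (suc n)
    f′ : ℕ → ℚ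
    f′ i = f (suc i)
    S = partialSum (convolution f′ g) n
    f′-geom : Geometric (A * ½) f′
    f′-geom i = subst (∣ f (suc i) ∣ ≤_) (sym (ℚ.*-assoc A ½ (½ ^ℚ i))) (f-geom (suc i))
    first : ∣ f 0 * (U - V) ∣ ≤ A * (B * (½ * r))
    first = begin
      ∣ f 0 * (U - V) ∣      ≡⟨ ℚ.∣p*q∣≡∣p∣*∣q∣ (f 0) (U - V) ⟩
      ∣ f 0 ∣ * ∣ U - V ∣    ≤⟨ *-mono-≤-nonNeg (ℚ.0≤∣p∣ (f 0)) (0≤* 0≤B (0≤½^ (suc n)))
                                  (subst (∣ f 0 ∣ ≤_) (ℚ.*-identityʳ A) (f-geom 0)) (g-close n<N) ⟩
      A * (B * (½ * r))      ∎

  -- By induction on the index where halving sets in: a constant A for the shifted sequence has to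
  -- be doubled to fit the unshifted powers of ½, and adding f 0 takes care of the term dropped.
  halving⇒geometric : ∀ K (f : ℕ → ℚ) → (∀ k → 0ℚ ≤ f k) → (∀ k → K ℕ.≤ k → f (suc k) + f (suc k) ≤ f k) →
    Σ[ A ∈ ℚ ] 0ℚ < A × (∀ k → f k ≤ A * ½ ^ℚ k)
  halving⇒geometric zero    f 0≤f halve = A , ℚ.+-mono-<-≤ 0<1 (0≤f 0) , bound
    where
    -- The 1 keeps A positive even if f 0 is 0.
    A = 1ℚ + f 0
    bound : ∀ k → f k ≤ A * ½ ^ℚ k
    bound zero    = ≤-by (ℚ.<⇒≤ 0<1) (solve 1 (λ a → a :+ con 1ℚ := (con 1ℚ :+ a) :* con 1ℚ) refl (f 0))
    bound (suc k) = begin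
      f (suc k)                      ≡⟨ solve 1 (λ a → a := con ½ :* (a :+ a)) refl (f (suc k)) ⟩
      ½ * (f (suc k) + f (suc k))    ≤⟨ ℚ.*-monoˡ-≤-nonNeg ½ (ℚ.≤-trans (halve k ℕ.z≤n) (bound k)) ⟩
      ½ * (A * ½ ^ℚ k)                ≡⟨ solve 2 (λ a r → con ½ :* (a :* r) := a :* (con ½ :* r)) refl A (½ ^ℚ k) ⟩
      A * ½ ^ℚ suc k                  ∎
  halving⇒geometric (suc K) f 0≤f halve =
    let (A , 0<A , bound) = halving⇒geometric K (λ i → f (suc i)) (λ i → 0≤f (suc i)) (λ k K≤k → halve (suc k) (ℕ.s≤s K≤k))
    in f 0 + ι 2 * A , ℚ.+-mono-≤-< (0≤f 0) (0<* (0<ι-suc 1) 0<A) , extend A 0<A bound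
    where
    extend : ∀ A → 0ℚ < A → (∀ k → f (suc k) ≤ A * ½ ^ℚ k) → ∀ k → f k ≤ (f 0 + ι 2 * A) * ½ ^ℚ k
    extend A 0<A bound zero    = ≤-by (0≤* (0≤ι 2) (ℚ.<⇒≤ 0<A))
      (solve 2 (λ f a → f :+ con (ι 2) :* a := (f :+ con (ι 2) :* a) :* con 1ℚ) refl (f 0) A)
    extend A 0<A bound (suc k) = begin
      f (suc k)                          ≤⟨ bound k ⟩
      A * ½ ^ℚ k                          ≤⟨ ≤-by (0≤* (0≤f 0) (0≤½^ (suc k))) (solve 3 (λ f a r →
                                              a :* r :+ f :* (con ½ :* r) := (f :+ con (ι 2) :* a) :* (con ½ :* r)) refl (f 0) A (½ ^ℚ k)) ⟩
      (f 0 + ι 2 * A) * ½ ^ℚ suc k        ∎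

  ∣^∣ : ∀ q n → ∣ q ^ℚ n ∣ ≡ ∣ q ∣ ^ℚ n
  ∣^∣ q zero    = refl
  ∣^∣ q (suc n) = trans (ℚ.∣p*q∣≡∣p∣*∣q∣ q (q ^ℚ n)) (cong (∣ q ∣ *_) (∣^∣ q n))

  ∣cosTerm∣ : ∀ q k → ∣ cosTerm q k ∣ ≡ ∣ (- 1ℚ) ^ℚ k ∣ * ∣ q ∣ ^ℚ (2 ℕ.* k) * ∣ 1/fact (2 ℕ.* k) ∣
  ∣cosTerm∣ q k = trans (ℚ.∣p*q∣≡∣p∣*∣q∣ ((- 1ℚ) ^ℚ k * q ^ℚ (2 ℕ.* k)) (1/fact (2 ℕ.* k)))
    (cong (_* ∣ 1/fact (2 ℕ.* k) ∣) (trans (ℚ.∣p*q∣≡∣p∣*∣q∣ ((- 1ℚ) ^ℚ k) (q ^ℚ (2 ℕ.* k)))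
      (cong (∣ (- 1ℚ) ^ℚ k ∣ *_) (∣^∣ q (2 ℕ.* k)))))

  ∣cosTerm∣-mono : ∀ p q k → ∣ p ∣ ≤ ∣ q ∣ → ∣ cosTerm p k ∣ ≤ ∣ cosTerm q k ∣
  ∣cosTerm∣-mono p q k p≤q = ℚ.≤-trans (ℚ.≤-reflexive (∣cosTerm∣ p k)) (ℚ.≤-trans
    (ℚ.*-monoʳ-≤-nonNeg ∣ 1/fact (2 ℕ.* k) ∣ {{ℚ.∣-∣-nonNeg (1/fact (2 ℕ.* k))}}
      (ℚ.*-monoˡ-≤-nonNeg ∣ (- 1ℚ) ^ℚ k ∣ {{ℚ.∣-∣-nonNeg ((- 1ℚ) ^ℚ k)}} (^-mono-≤ (ℚ.0≤∣p∣ p) p≤q (2 ℕ.* k))))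
    (ℚ.≤-reflexive (sym (∣cosTerm∣ q k))))

  -- The terms at K dominate those at every smaller argument and eventually halve. A single A for
  -- all these q is essential, because the argument moves with n along a Cauchy sequence.
  cosTerm-geometric : ∀ K → Σ[ A ∈ ℚ ] 0ℚ < A × (∀ q → ∣ q ∣ ≤ ι K → Geometric A (cosTerm q))
  cosTerm-geometric K =
    let (A , 0<A , bound) = halving⇒geometric K (λ k → ∣ cosTerm (ι K) k ∣) (λ k → ℚ.0≤∣p∣ (cosTerm (ι K) k))
                              (λ k → cosTerm-halve (ι K) K k ℚ.≤-refl)
    in A , 0<A , λ q q≤K k → ℚ.≤-trans (∣cosTerm∣-mono q (ι K) k q≤K) (bound k)

  ι2^*½^ : ∀ n → ι (2 ^ n) * ½ ^ℚ n ≡ 1ℚ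
  ι2^*½^ zero    = refl
  ι2^*½^ (suc n) = trans (cong (_* ½ ^ℚ suc n) (sym (ι-* 2 (2 ^ n))))
    (trans (solve 2 (λ a b → con (ι 2) :* a :* (con ½ :* b) := a :* b) refl (ι (2 ^ n)) (½ ^ℚ n)) (ι2^*½^ n))

  n*½^n≤2*unit : ∀ n → ι n * ½ ^ℚ n ≤ ι 2 * unit n
  n*½^n≤2*unit n = begin
    ι n * ½ ^ℚ n                                ≡⟨ ℚ.*-identityˡ _ ⟨
    1ℚ * (ι n * ½ ^ℚ n)                         ≡⟨ cong (_* (ι n * ½ ^ℚ n)) (unit*ι n) ⟨
    unit n * ι (suc n) * (ι n * ½ ^ℚ n)         ≡⟨ solve 4 (λ u s n r → u :* s :* (n :* r) := u :* ((s :* n) :* r)) refl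
                                                    (unit n) (ι (suc n)) (ι n) (½ ^ℚ n) ⟩
    unit n * ((ι (suc n) * ι n) * ½ ^ℚ n)       ≤⟨ ℚ.*-monoˡ-≤-nonNeg (unit n) {{nonNegative (ℚ.<⇒≤ (0<unit n))}}
                                                    (ℚ.*-monoʳ-≤-nonNeg (½ ^ℚ n) {{nonNegative (0≤½^ n)}} below) ⟩
    unit n * ((ι 2 * ι (2 ^ n)) * ½ ^ℚ n)     ≡⟨ cong (unit n *_) (trans (ℚ.*-assoc (ι 2) (ι (2 ^ n)) (½ ^ℚ n)) (cong (ι 2 *_) (ι2^*½^ n))) ⟩
    unit n * (ι 2 * 1ℚ)                        ≡⟨ ℚ.*-comm (unit n) (ι 2 * 1ℚ) ⟩
    ι 2 * unit n                               ∎
    where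
    below : ι (suc n) * ι n ≤ ι 2 * ι (2 ^ n)
    below = begin
      ι (suc n) * ι n        ≡⟨ ι-* (suc n) n ⟩
      ι (suc n ℕ.* n)        ≤⟨ ι-mono (suc-n*n≤2*2^n n) ⟩
      ι (2 ℕ.* 2 ^ n)      ≡⟨ ι-* 2 (2 ^ n) ⟨
      ι 2 * ι (2 ^ n)      ∎

  -- Terms t_i u_j of the product of partial sums with i + j ≥ n contribute O(n / 2ⁿ).
  cosPartial-product-error : ∀ A x y n → 0ℚ < A → Geometric A (cosTerm x) → Geometric A (cosTerm y) →
    ∣ (cosPartial n (x + y) + cosPartial n (x - y)) - ι 2 * (cosPartial n x * cosPartial n y) ∣ ≤
    ι 8 * (A * A) * unit n
  cosPartial-product-error A x y n 0<A x-geom y-geom = begin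
    ∣ (cosPartial n (x + y) + cosPartial n (x - y)) - ι 2 * (cosPartial n x * cosPartial n y) ∣
      ≡⟨ cong₂ (λ p q → ∣ p - q ∣) (partialSum-cosTerm-product x y n)
           (cong₂ (λ p q → ι 2 * (p * q)) (cosPartial≡partialSum n x) (cosPartial≡partialSum n y)) ⟩
    ∣ ι 2 * S - ι 2 * P ∣
      ≡⟨ cong ∣_∣ (solve 2 (λ s p → con (ι 2) :* s :- con (ι 2) :* p := con (- ι 2) :* (p :- s)) refl S P) ⟩
    ∣ - ι 2 * (P - S) ∣
      ≡⟨ ℚ.∣p*q∣≡∣p∣*∣q∣ (- ι 2) (P - S) ⟩
    ι 2 * ∣ P - S ∣
      ≤⟨ ℚ.*-monoˡ-≤-nonNeg (ι 2) (convolution-error A (ι 2 * A) (cosTerm x) (cosTerm y) n (0≤* (0≤ι 2) 0≤A)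
           x-geom (geometric-close (cosTerm y) 0≤A y-geom) n ℕ.≤-refl) ⟩
    ι 2 * (ι n * (A * (ι 2 * A) * ½ ^ℚ n))
      ≡⟨ solve 3 (λ a i r → con (ι 2) :* (i :* (a :* (con (ι 2) :* a) :* r)) := con (ι 4) :* (a :* a) :* (i :* r)) refl A (ι n) (½ ^ℚ n) ⟩
    ι 4 * (A * A) * (ι n * ½ ^ℚ n)
      ≤⟨ ℚ.*-monoˡ-≤-nonNeg (ι 4 * (A * A)) {{nonNegative (0≤* (0≤ι 4) (0≤* 0≤A 0≤A))}} (n*½^n≤2*unit n) ⟩
    ι 4 * (A * A) * (ι 2 * unit n)
      ≡⟨ solve 2 (λ a u → con (ι 4) :* a :* (con (ι 2) :* u) := con (ι 8) :* a :* u) refl (A * A) (unit n) ⟩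
    ι 8 * (A * A) * unit n ∎
    where
    0≤A = ℚ.<⇒≤ 0<A
    S = partialSum (convolution (cosTerm x) (cosTerm y)) n
    P = partialSum (cosTerm x) n * partialSum (cosTerm y) n

  cosPartial-product-null : ∀ {x y} → Cauchy x → Cauchy y →
    Null (λ n → (cosPartial n (x n + y n) + cosPartial n (x n - y n)) - ι 2 * (cosPartial n (x n) * cosPartial n (y n)))
  cosPartial-product-null {x} {y} x-cauchy y-cauchy ε 0<ε =
    let (B , _ , M , x≤B) = cauchy⇒bounded {x} x-cauchy
        (C , _ , N , y≤C) = cauchy⇒bounded {y} y-cauchy
        (k , B≤k) = archimedean B
        (l , C≤l) = archimedean C
        (A , 0<A , geom) = cosTerm-geometric (k ℕ.⊔ l)
        (L , small) = unit-small (ι 8 * (A * A)) ε (0<* (0<ι-suc 7) (0<* 0<A 0<A)) 0<ε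
    in L ℕ.⊔ (M ℕ.⊔ N) , λ n h →
      let MN = ℕ.m⊔n≤o⇒n≤o L (M ℕ.⊔ N) h in
      ℚ.≤-<-trans
        (cosPartial-product-error A (x n) (y n) n 0<A
          (geom (x n) (ℚ.≤-trans (x≤B n (ℕ.m⊔n≤o⇒m≤o M N MN)) (ℚ.≤-trans B≤k (ι-mono (ℕ.m≤m⊔n k l)))))
          (geom (y n) (ℚ.≤-trans (y≤C n (ℕ.m⊔n≤o⇒n≤o M N MN)) (ℚ.≤-trans C≤l (ι-mono (ℕ.m≤n⊔m k l))))))
        (small n (ℕ.m⊔n≤o⇒m≤o L (M ℕ.⊔ N) h))

-- Values of the cosine at rational multiples of π

-- The angle π/3 in units of π/2.
⅔ : ℚ
⅔ = ℤ.+ 2 ℚ./ 3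

module _ (A : ℚ-Algebra) where
  open ℚ-Algebra A

  -- C a plays the role of cos (a π / 2).
  module Cosine (C : ℚ → Carrier)
    (C-product : ∀ a b → C (a ℚ.+ b) + C (a ℚ.- b) ≈ algebraMap (ι 2) * (C a * C b))
    (C-neg : ∀ a → C (ℚ.- a) ≈ C a) (C-0 : C 0ℚ ≈ 1#) (C-1 : C 1ℚ ≈ 0#)
    (C-⅔+1-regular : ∀ x → x * (C ⅔ + 1#) ≈ 0# → x ≈ 0#)
    where

    -- Here the zero of the cosine at π/2 enters: it annihilates the product on the right of the
    -- product formula.
    C-1+ : ∀ a → C (1ℚ ℚ.+ a) ≈ - C (1ℚ ℚ.- a)
    C-1+ a = inverseˡ-unique _ _ (trans (C-product 1ℚ a)
      (trans (*-congˡ (trans (*-congʳ C-1) (zeroˡ (C a)))) (zeroʳ (algebraMap (ι 2)))))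
      where open import Algebra.Properties.AbelianGroup +-abelianGroup using (inverseˡ-unique)

    C-double : ∀ a → C (a ℚ.+ a) + 1# ≈ algebraMap (ι 2) * (C a * C a)
    C-double a = trans (+-congˡ (sym (trans (C-cong (ℚ.+-inverseʳ a)) C-0))) (C-product a a)
      where
      C-cong : ∀ {a b} → a ≡ b → C a ≈ C b
      C-cong ≡.refl = refl

    C-supplement : ∀ a b → a ℚ.+ b ≡ ι 2 → C a ≈ - C b
    C-supplement a b a+b≡2 = ≡.subst₂ (λ p q → C p ≈ - C q)
      (≡.trans (solve 1 (λ b → con 1ℚ :+ (con 1ℚ :- b) := con (ι 2) :- b) ≡.refl b)
        (≡.trans (≡.cong (ℚ._- b) (≡.sym a+b≡2)) (solve 2 (λ a b → (a :+ b) :- b := a) ≡.refl a b)))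
      (solve 1 (λ b → con 1ℚ :- (con 1ℚ :- b) := b) ≡.refl b)
      (C-1+ (1ℚ ℚ.- b))
      where open ℚ.+-*-Solver using (solve; _:+_; _:-_; _:=_; con)

    2C : ℚ → Carrier
    2C a = algebraMap (ι 2) * C a

    -- (2 cos a)² = 2 (cos 2a + 1), and π is 2 in the present units, so that cos 2a = - cos b. This
    -- is the form that `step` asks for.
    half-angle : ∀ a b → (a ℚ.+ a) ℚ.+ b ≡ ι 2 → 2C a * 2C a ≈ 2minus A (2C b)
    half-angle a b 2a+b≡2 = begin
      2C a * 2C a
        ≈⟨ solve 1 (λ c → (con (ι 2) :* c) :* (con (ι 2) :* c) := con (ι 2) :* (con (ι 2) :* (c :* c))) refl (C a) ⟩
      algebraMap (ι 2) * (algebraMap (ι 2) * (C a * C a))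
        ≈⟨ *-congˡ (C-double a) ⟨
      algebraMap (ι 2) * (C (a ℚ.+ a) + 1#)
        ≈⟨ *-congˡ (+-cong (C-supplement (a ℚ.+ a) b 2a+b≡2) (sym 1-homo)) ⟩
      algebraMap (ι 2) * (- C b + algebraMap 1ℚ)
        ≈⟨ solve 1 (λ e → con (ι 2) :* (:- e :+ con 1ℚ) := con (ι 2) :- con (ι 2) :* e) refl (C b) ⟩
      algebraMap (ι 2) - 2C b ∎
      where
      open ≈-Reasoning
      open Solver using (solve; _:+_; _:*_; _:-_; :-_; _:=_; con)

    -- With c = cos (π/3), the duplication formula and cos (2π/3) = -c give (2c - 1)(c + 1) = 0.
    2C-⅔ : 2C ⅔ ≈ 1#
    2C-⅔ = x∙y⁻¹≈ε⇒x≈y _ _ (C-⅔+1-regular (2C ⅔ - 1#) (begin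
      (2C ⅔ - 1#) * (c + 1#)
        ≈⟨ *-cong (+-congˡ (-‿cong 1-homo)) (+-congˡ 1-homo) ⟨
      (algebraMap (ι 2) * c - algebraMap 1ℚ) * (c + algebraMap 1ℚ)
        ≈⟨ solve 1 (λ c → (con (ι 2) :* c :- con 1ℚ) :* (c :+ con 1ℚ) := con (ι 2) :* (c :* c) :+ (c :- con 1ℚ)) refl c ⟩
      algebraMap (ι 2) * (c * c) + (c - algebraMap 1ℚ)
        ≈⟨ +-congʳ (trans (sym (C-double ⅔)) (+-cong (C-supplement (⅔ ℚ.+ ⅔) ⅔ ≡.refl) (sym 1-homo))) ⟩
      (- c + algebraMap 1ℚ) + (c - algebraMap 1ℚ)
        ≈⟨ solve 1 (λ c → (:- c :+ con 1ℚ) :+ (c :- con 1ℚ) := con 0ℚ) refl c ⟩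
      algebraMap 0ℚ
        ≈⟨ 0-homo ⟩
      0# ∎))
      where
      open ≈-Reasoning
      open Solver using (solve; _:+_; _:*_; _:-_; :-_; _:=_; con)
      open import Algebra.Properties.AbelianGroup +-abelianGroup using (x∙y⁻¹≈ε⇒x≈y)
      c = C ⅔

    2C-supplement : ∀ a b → a ℚ.+ b ≡ ι 2 → 2C b ≈ 1# → 2C a ≈ algebraMap (ℚ.- 1ℚ)
    2C-supplement a b a+b≡2 2cos≈1 = trans (*-congˡ (C-supplement a b a+b≡2))
      (trans (sym (-‿distribʳ-* (algebraMap (ι 2)) (C b))) (trans (-‿cong (trans 2cos≈1 (sym 1-homo))) (sym (-‿homo 1ℚ))))
      where open import Algebra.Properties.Ring ring using (-‿distribʳ-*)

    -- 2 · ½ᵏ is π/2ᵏ in units of π/2.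
    angle⁺ angle⁻ : ℕ → ℚ
    angle⁺ k = ⅔ ℚ.+ ι 2 ℚ.* ½ ^ℚ k
    angle⁻ k = ⅔ ℚ.- ι 2 ℚ.* ½ ^ℚ k

    -- π/3 is the fixed point of x ↦ π - 2x, which doubles the distance to it and changes sides. So
    -- the two sides feed each other and have to be built together.
    angle-chain : ∀ k → RadicalChain A k (2C (angle⁺ k)) × RadicalChain A k (2C (angle⁻ k))
    angle-chain zero =
        -- `angle⁺ 0` is 8/3, the supplement of -⅔, and `angle⁻ 0` is -4/3, where 4/3 = ⅔ + ⅔ is the
        -- supplement of ⅔.
        base (2C-supplement (angle⁺ 0) (ℚ.- ⅔) ≡.refl (trans (*-congˡ (C-neg ⅔)) 2C-⅔))
      , base (trans (*-congˡ (C-neg (⅔ ℚ.+ ⅔))) (2C-supplement (⅔ ℚ.+ ⅔) ⅔ ≡.refl 2C-⅔))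
    angle-chain (suc k) =
      let (chain⁺ , chain⁻) = angle-chain k in
        step chain⁻ (half-angle (angle⁺ (suc k)) (angle⁻ k) (sum⁺ (½ ^ℚ k)))
      , step chain⁺ (half-angle (angle⁻ (suc k)) (angle⁺ k) (sum⁻ (½ ^ℚ k)))
      where
      open ℚ.+-*-Solver using (solve; _:+_; _:*_; _:-_; _:=_; con)
      sum⁺ : ∀ r → (⅔ ℚ.+ ι 2 ℚ.* (½ ℚ.* r)) ℚ.+ (⅔ ℚ.+ ι 2 ℚ.* (½ ℚ.* r)) ℚ.+ (⅔ ℚ.- ι 2 ℚ.* r) ≡ ι 2
      sum⁺ = solve 1 (λ r → (con ⅔ :+ con (ι 2) :* (con ½ :* r)) :+ (con ⅔ :+ con (ι 2) :* (con ½ :* r)) :+ (con ⅔ :- con (ι 2) :* r)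
                            := con (ι 2)) ≡.refl
      sum⁻ : ∀ r → (⅔ ℚ.- ι 2 ℚ.* (½ ℚ.* r)) ℚ.+ (⅔ ℚ.- ι 2 ℚ.* (½ ℚ.* r)) ℚ.+ (⅔ ℚ.+ ι 2 ℚ.* r) ≡ ι 2
      sum⁻ = solve 1 (λ r → (con ⅔ :- con (ι 2) :* (con ½ :* r)) :+ (con ⅔ :- con (ι 2) :* (con ½ :* r)) :+ (con ⅔ :+ con (ι 2) :* r)
                            := con (ι 2)) ≡.refl

-- The real cosine satisfies the hypotheses on C

halfπ : ℝ
halfπ = mkℝ halfPi cauchy-halfPi

-- cos (c π / 2)
abstract
  cosAt : ℚ → ℝ
  cosAt c = cos (fromℚ c *ᵣ halfπ)

  seq-cosAt : ∀ c n → seq (cosAt c) n ≡ cosPartial n (c ℚ.* halfPi n)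
  seq-cosAt c n = ≡.refl

cosAt-product : ∀ a b → cosAt (a ℚ.+ b) ⊕ cosAt (a ℚ.- b) ≈ᵣ fromℚ (ι 2) ⊗ (cosAt a ⊗ cosAt b)
cosAt-product a b = ≃⇒≈ (null-≡ (λ n → ≡.sym (pointwise n))
  (cosPartial-product-null (cauchy (fromℚ a *ᵣ halfπ)) (cauchy (fromℚ b *ᵣ halfπ))))
  where
  open ℚ.+-*-Solver using (solve; _:+_; _:*_; _:-_; _:=_)
  sum : ∀ h → a ℚ.* h ℚ.+ b ℚ.* h ≡ (a ℚ.+ b) ℚ.* h
  sum h = solve 3 (λ a b h → a :* h :+ b :* h := (a :+ b) :* h) ≡.refl a b h
  difference : ∀ h → a ℚ.* h ℚ.- b ℚ.* h ≡ (a ℚ.- b) ℚ.* h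
  difference h = solve 3 (λ a b h → a :* h :- b :* h := (a :- b) :* h) ≡.refl a b h
  pointwise : ∀ n → seq (cosAt (a ℚ.+ b) ⊕ cosAt (a ℚ.- b)) n ℚ.- seq (fromℚ (ι 2) ⊗ (cosAt a ⊗ cosAt b)) n ≡
    (cosPartial n (a ℚ.* halfPi n ℚ.+ b ℚ.* halfPi n) ℚ.+ cosPartial n (a ℚ.* halfPi n ℚ.- b ℚ.* halfPi n))
      ℚ.- ι 2 ℚ.* (cosPartial n (a ℚ.* halfPi n) ℚ.* cosPartial n (b ℚ.* halfPi n))
  pointwise n = ≡.cong₂ ℚ._-_
    (≡.trans (seq-⊕ (cosAt (a ℚ.+ b)) (cosAt (a ℚ.- b)) n) (≡.cong₂ ℚ._+_
      (≡.trans (seq-cosAt (a ℚ.+ b) n) (≡.cong (cosPartial n) (≡.sym (sum (halfPi n)))))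
      (≡.trans (seq-cosAt (a ℚ.- b) n) (≡.cong (cosPartial n) (≡.sym (difference (halfPi n)))))))
    (≡.trans (seq-⊗ (fromℚ (ι 2)) (cosAt a ⊗ cosAt b) n) (≡.cong (ι 2 ℚ.*_)
      (≡.trans (seq-⊗ (cosAt a) (cosAt b) n) (≡.cong₂ ℚ._*_ (seq-cosAt a n) (seq-cosAt b n)))))

cosPartial-neg : ∀ n q → cosPartial n (ℚ.- q) ≡ cosPartial n q
cosPartial-neg n q = ≡.trans (cosPartial≡altSum n (ℚ.- q))
  (≡.trans (≡.cong (λ s → altSum (cosCoef s) n) (solve 1 (λ q → :- q :* :- q := q :* q) ≡.refl q))
    (≡.sym (cosPartial≡altSum n q)))
  where open ℚ.+-*-Solver using (solve; _:*_; :-_; _:=_)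

cosAt-neg : ∀ a → cosAt (ℚ.- a) ≈ᵣ cosAt a
cosAt-neg a = ≡⇒≈ᵣ λ n → ≡.trans (seq-cosAt (ℚ.- a) n) (≡.trans
  (≡.cong (cosPartial n) (≡.sym (ℚ.neg-distribˡ-* a (halfPi n))))
  (≡.trans (cosPartial-neg n (a ℚ.* halfPi n)) (≡.sym (seq-cosAt a n))))

cosAt-0 : cosAt 0ℚ ≈ᵣ fromℚ 1ℚ
-- The approximation with index 0 is the empty sum 0, so equality with 1 holds from index 1 on.
cosAt-0 = ≃⇒≈ λ ε 0<ε → 1 , λ { (suc n) _ → ≡.subst (λ z → ℚ.∣ z ∣ ℚ.< ε)
  (≡.sym (≡.trans (≡.cong (ℚ._- 1ℚ) (≡.trans (seq-cosAt 0ℚ (suc n)) (≡.trans (≡.cong (cosPartial (suc n)) (ℚ.*-zeroˡ (halfPi (suc n)))) (cosPartial-0 n))))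
    (ℚ.+-inverseʳ 1ℚ))) 0<ε }

cosAt-1 : cosAt 1ℚ ≈ᵣ fromℚ 0ℚ
cosAt-1 = ≃⇒≈ (null-≡
  (λ n → ≡.cong (ℚ._- 0ℚ) (≡.trans
    (≡.cong (cosPartial n) (≡.trans (π/2≡halfPi n) (≡.sym (ℚ.*-identityˡ (halfPi n))))) (≡.sym (seq-cosAt 1ℚ n))))
  (IsPi.cos-zero π-isPi))

-- From 1 - cos y ≤ y²/2 and the crude bound π/2 ≤ 2: here y ≤ 4/3, and (4/3)²/2 = 8/9 is below 1.
-- This rules out cos (π/3) = -1.
0≤cosAt-⅔ : ∀ n → 2 ℕ.≤ n → 0ℚ ℚ.≤ seq (cosAt ⅔) n
0≤cosAt-⅔ (suc n) 2≤n = ≡.subst (0ℚ ℚ.≤_) (≡.sym (seq-cosAt ⅔ (suc n))) (ℚ.≤-trans (from-yes (0ℚ ℚ.≤? 1ℚ ℚ.- square ℚ.* ½)) (ℚ.≤-trans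
  (ℚ.+-monoʳ-≤ 1ℚ (ℚ.neg-antimono-≤ 1-C≤))
  (ℚ.≤-reflexive (solve 1 (λ c → con 1ℚ :- (con 1ℚ :- c) := c) ≡.refl C))))
  where
  open ℚ.+-*-Solver using (solve; _:+_; _:-_; _:=_; con)
  open HalfPiSpec (halfPi-spec≥2 2≤n)
  open ℚ.≤-Reasoning
  y = ⅔ ℚ.* halfPi (suc n)
  C = cosPartial (suc n) y
  square = (⅔ ℚ.* ι 2) ℚ.* (⅔ ℚ.* ι 2)
  0≤y : 0ℚ ℚ.≤ y
  0≤y = 0≤* (ℚ.nonNegative⁻¹ ⅔) (ℚ.≤-trans (ℚ.<⇒≤ 0<1) 1≤h)
  y≤ : y ℚ.≤ ⅔ ℚ.* ι 2
  y≤ = ℚ.*-monoˡ-≤-nonNeg ⅔ h≤2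
  1-C≤ : 1ℚ ℚ.- C ℚ.≤ square ℚ.* ½
  1-C≤ = begin
    1ℚ ℚ.- C                                ≡⟨ ≡.cong (ℚ._- C) (cosPartial-0 n) ⟨
    cosPartial (suc n) 0ℚ ℚ.- C             ≤⟨ cosPartial-upper 0ℚ y n ℚ.≤-refl 0≤y (ℚ.≤-trans y≤ (from-yes (⅔ ℚ.* ι 2 ℚ.≤? ι 2))) ⟩
    (y ℚ.* y ℚ.- 0ℚ) ℚ.* ½                  ≡⟨ ≡.cong (ℚ._* ½) (ℚ.+-identityʳ (y ℚ.* y)) ⟩
    y ℚ.* y ℚ.* ½                           ≤⟨ ℚ.*-monoʳ-≤-nonNeg ½ (square-mono 0≤y y≤) ⟩
    square ℚ.* ½                            ∎

-- |x| ≤ |x y| wherever y ≥ 1, so the factor is cancelled without dividing by it.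
*-cancel-≥1 : ∀ x y N → (∀ n → N ℕ.≤ n → 1ℚ ℚ.≤ seq y n) → x ⊗ y ≈ᵣ fromℚ 0ℚ → x ≈ᵣ fromℚ 0ℚ
*-cancel-≥1 x y N 1≤y (≃⇒≈ xy≃0) = ≃⇒≈ λ ε 0<ε →
  let (M , h) = xy≃0 ε 0<ε in
  N ℕ.⊔ M , λ n N⊔M≤n → ℚ.≤-<-trans (bound n (1≤y n (ℕ.m⊔n≤o⇒m≤o N M N⊔M≤n))) (h n (ℕ.m⊔n≤o⇒n≤o N M N⊔M≤n))
  where
  open ℚ.≤-Reasoning
  bound : ∀ n → 1ℚ ℚ.≤ seq y n → ℚ.∣ seq x n ℚ.- 0ℚ ∣ ℚ.≤ ℚ.∣ seq (x ⊗ y) n ℚ.- 0ℚ ∣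
  bound n 1≤y = begin
    ℚ.∣ seq x n ℚ.- 0ℚ ∣               ≡⟨ ≡.cong ℚ.∣_∣ (ℚ.+-identityʳ (seq x n)) ⟩
    ℚ.∣ seq x n ∣                      ≡⟨ ℚ.*-identityʳ _ ⟨
    ℚ.∣ seq x n ∣ ℚ.* 1ℚ               ≤⟨ ℚ.*-monoˡ-≤-nonNeg ℚ.∣ seq x n ∣ {{ℚ.∣-∣-nonNeg (seq x n)}} (ℚ.≤-trans 1≤y (p≤∣p∣ (seq y n))) ⟩
    ℚ.∣ seq x n ∣ ℚ.* ℚ.∣ seq y n ∣    ≡⟨ ℚ.∣p*q∣≡∣p∣*∣q∣ (seq x n) (seq y n) ⟨
    ℚ.∣ seq x n ℚ.* seq y n ∣          ≡⟨ ≡.cong ℚ.∣_∣ (seq-⊗ x y n) ⟨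
    ℚ.∣ seq (x ⊗ y) n ∣                ≡⟨ ≡.cong ℚ.∣_∣ (ℚ.+-identityʳ (seq (x ⊗ y) n)) ⟨
    ℚ.∣ seq (x ⊗ y) n ℚ.- 0ℚ ∣         ∎

cosAt-⅔+1-regular : ∀ x → x ⊗ (cosAt ⅔ ⊕ fromℚ 1ℚ) ≈ᵣ fromℚ 0ℚ → x ≈ᵣ fromℚ 0ℚ
cosAt-⅔+1-regular x = *-cancel-≥1 x (cosAt ⅔ ⊕ fromℚ 1ℚ) 2 λ n 2≤n →
  ≡.subst (1ℚ ℚ.≤_) (≡.sym (seq-⊕ (cosAt ⅔) (fromℚ 1ℚ) n)) (ℚ.+-monoˡ-≤ 1ℚ (0≤cosAt-⅔ n 2≤n))

open Cosine ℝ-algebra cosAt cosAt-product cosAt-neg cosAt-0 cosAt-1 cosAt-⅔+1-regular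

-- Matching the angle of the statement

½^n≡1/2^n : ∀ n → ½ ^ℚ n ≡ (+ 1 / (2 ^ n)) {{m^n≢0 2 n}}
½^n≡1/2^n n = begin
  ½ ^ℚ n                         ≡⟨ ℚ.*-identityˡ _ ⟨
  1ℚ ℚ.* ½ ^ℚ n                  ≡⟨ ≡.cong (ℚ._* ½ ^ℚ n) (1/m*m≡1 (2 ^ n) {{m^n≢0 2 n}}) ⟨
  1/2^n ℚ.* ι (2 ^ n) ℚ.* ½ ^ℚ n ≡⟨ ℚ.*-assoc 1/2^n (ι (2 ^ n)) (½ ^ℚ n) ⟩
  1/2^n ℚ.* (ι (2 ^ n) ℚ.* ½ ^ℚ n) ≡⟨ ≡.cong (1/2^n ℚ.*_) (ι2^*½^ n) ⟩
  1/2^n ℚ.* 1ℚ                   ≡⟨ ℚ.*-identityʳ 1/2^n ⟩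
  1/2^n                          ∎
  where
  open ≡.≡-Reasoning
  1/2^n = (+ 1 / (2 ^ n)) {{m^n≢0 2 n}}

2cos[π/3+π/2^n] : ℕ → ℝ
2cos[π/3+π/2^n] n = fromℚ (+ 2 / 1) *ᵣ cos ((π /ᵣ 3) +ᵣ ((π /ᵣ (2 ^ n)) {{m^n≢0 2 n}}))

angle≡ : ∀ n m → angle⁺ n ℚ.* halfPi m ≡ seq ((π /ᵣ 3) +ᵣ ((π /ᵣ (2 ^ n)) {{m^n≢0 2 n}})) m
angle≡ n m = ≡.trans (≡.cong (λ r → (⅔ ℚ.+ ι 2 ℚ.* r) ℚ.* halfPi m) (½^n≡1/2^n n))
  (eq ((+ 1 / (2 ^ n)) {{m^n≢0 2 n}}) (halfPi m))
  where
  open ℚ.+-*-Solver using (solve; _:+_; _:*_; _:=_; con)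
  eq : ∀ r h → (⅔ ℚ.+ ι 2 ℚ.* r) ℚ.* h ≡ ι 2 ℚ.* h ℚ.* (+ 1 / 3) ℚ.+ ι 2 ℚ.* h ℚ.* r
  eq = solve 2 (λ r h → (con ⅔ :+ con (ι 2) :* r) :* h := con (ι 2) :* h :* con (+ 1 / 3) :+ con (ι 2) :* h :* r) ≡.refl

2C≈2cos : ∀ n → 2C (angle⁺ n) ≈ᵣ 2cos[π/3+π/2^n] n
2C≈2cos n = ≡⇒≈ᵣ λ m → ≡.trans (seq-⊗ (fromℚ (ι 2)) (cosAt (angle⁺ n)) m)
  (≡.cong (ι 2 ℚ.*_) (≡.trans (seq-cosAt (angle⁺ n) m) (≡.cong (cosPartial m) (angle≡ n m))))

RadicalChain-resp : ∀ (B : ℚ-Algebra) {k g h} → ℚ-Algebra._≈_ B g h → RadicalChain B k g → RadicalChain B k h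
RadicalChain-resp B g≈h (base g≈-1)    = base (ℚ-Algebra.trans B (ℚ-Algebra.sym B g≈h) g≈-1)
RadicalChain-resp B g≈h (step chain e) = step chain (ℚ-Algebra.trans B (ℚ-Algebra.*-cong B (ℚ-Algebra.sym B g≈h) (ℚ-Algebra.sym B g≈h)) e)

propositionC1 : (n : ℕ) →
    HasDegree (fromℚ (+ 2 / 1) *ᵣ cos ((π /ᵣ 3) +ᵣ ((π /ᵣ (2 ^ n)) {{m^n≢0 2 n}}))) (2 ^ n)
propositionC1 n = chain⇒HasDegree (RadicalChain-resp ℝ-algebra (2C≈2cos n) (proj₁ (angle-chain n)))
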